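{- Let $k\ge 1$ and let $\lambda$ be a strict partition. There is a bijection $\Phi^k_\lambda$ between the set of standard shifted $k$-ribbon tableaux of shape $\lambda$ and the set of standard fillings of the $k$-quotient $\overline{\Phi^k}(\lambda)$. It preserves diagonal values: ribbons whose heads have the same diagonal value in $\lambda$ are mapped to cells lying on one common diagonal of one common component of the $k$-quotient.
   Context: Conventions. Diagrams are drawn in French convention: a cell is a pair $(c,r)$ of integers (column $c$, row $r$), with rows numbered from bottom to top. A strict partition $\lambda=(\lambda_1>\lambda_2>\cdots>\lambda_\ell>0)$ is identified with its shifted diagram $\{(c,r):1\le r\le \ell,\ r\le c\le r+\lambda_r-1\}$; so row $r$ has $\lambda_r$ cells and starts in column $r$. The diagonal value of a cell is $\mathrm{diag}(c,r)=c-r+1$. The main diagonal consists of the cells of diagonal value $1$. For strict partitions $\mu\subseteq\lambda$, the skew-shifted diagram $\lambda\setminus\mu$ is the set difference of shifted diagrams. A subset $R\subseteq\lambda$ is removable if $\lambda\setminus R$ is again (the shifted diagram of) a strict partition. Ribbons. A single ribbon is a nonempty edge-connected skew-shifted diagram whose cells have pairwise distinct diagonal values. Its head $H(R)$ is its cell of largest diagonal value and its tail $T(R)$ is its cell of smallest diagonal value. A double ribbon in $\lambda$ is a union $R\cup S$ of two disjoint single ribbons with $|R|\ge |S|$ satisfying three conditions: $T(R)$ lies on the main diagonal of $\lambda$; $T(S)$ lies on the main diagonal of $\lambda\setminus R$; and $R\cup S$ is a skew-shifted diagram. Its head is $H(R)$. A $k$-ribbon is a single or double ribbon with $k$ cells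 in total. A $k$-core is a shifted diagram with no removable $k$-ribbon. Standard shifted $k$-ribbon tableau of shape $\lambda$. This is a chain of shifted diagrams $\lambda^{(0)}\subset\lambda^{(1)}\subset\cdots\subset\lambda^{(n)}=\lambda$ such that $\lambda^{(0)}$ is a $k$-core and each $\lambda^{(i)}\setminus\lambda^{(i-1)}$ is a removable $k$-ribbon of $\lambda^{(i)}$. The ribbon $\lambda^{(i)}\setminus\lambda^{(i-1)}$ is labelled $i$. Abacus representation. For $1\le i\le k$, let $\alpha^{(i)}$ be the strict partition whose parts are the numbers $(p-i)/k+1$, where $p$ runs over the parts of $\lambda$ with $p\equiv i \pmod k$. Combination. Let $\alpha,\beta$ be strict partitions with $a,b$ rows respectively, and let $n=\min(a,b)$. Their combination $\alpha\diamond\beta$ is the pair $(C,\mathfrak d)$ defined as follows. The cell set is $$C=\{(y-(a-n),\,x-(a-n)) : (x,y)\in\alpha,\ x>a-n\}\ \cup\ \{(x-(b-n),\,y-(b-n)) : (x,y)\in\beta,\ x>b-n\}.$$ The specialized diagonal is the line $\mathfrak d=\{(x,y): x=y\}$. In words: the $|a-b|$ leftmost columns of the taller shape are deleted, $\alpha$ is transposed, and the two are glued along their main diagonals. The set $C$ is a translate of a Young diagram, called the underlying shape. $k$-quotient. The $k$-quotient $\overline{\Phi^k}(\lambda)$ is a tuple of components defined as follows. - If $k$ is odd, it is $(\alpha^{(1)}\diamond\alpha^{(k-1)},\ \alpha^{(2)}\diamond\alpha^{(k-2)},\ \dots,\ \alpha^{((k-1)/2)}\diamond\alpha^{((k+1)/2)},\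 \alpha^{(k)})$. - If $k$ is even, it is $(\alpha^{(1)}\diamond\alpha^{(k-1)},\ \dots,\ \alpha^{(k/2-1)}\diamond\alpha^{(k/2+1)},\ \alpha^{(k/2)}\diamond\varnothing,\ \alpha^{(k)})$. The last component $\alpha^{(k)}$ is a shifted diagram; the others are folded diagrams. Standard filling of the $k$-quotient. Let $N$ be the total number of cells of all components. A standard filling places the numbers $1,\dots,N$, each exactly once, in the cells of all components simultaneously. Within each component, entries must increase from left to right along rows and from bottom to top along columns. -}

module Defs where

open import Data.Nat using (ℕ; zero; suc; _+_; _*_; _∸_; _≤_; _<_; _>_; _⊓_; NonZero; _≡ᵇ_)
open import Data.Nat.DivMod using (_/_; _%_)
open import Data.Nat.Properties using (_≟_)
open import Data.Integer as ℤ using (ℤ; +_)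
open import Data.Bool using (if_then_else_)
open import Data.List using (List; []; _∷_; map; filter; length; upTo; _++_)
open import Data.List.Membership.Propositional using (_∈_; _∉_)
open import Data.List.Relation.Unary.All using (All)
open import Data.List.Relation.Unary.Linked using (Linked)
open import Data.List.Relation.Unary.Unique.Propositional using (Unique)
open import Data.Product using (Σ; ∃; ∃-syntax; _×_; _,_)
open import Data.Sum using (_⊎_)
open import Data.Empty using (⊥)
open import Data.Unit using (⊤)
open import Relation.Nullary using (¬_)
open import Relation.Binary.PropositionalEquality using (_≡_; _≢_)
open import Function.Bundles using (_⇔_)

-- A cell (c , r) : column c, row r (rows numbered bottom to top, from 1).
Cell : Set
Cell = ℕ × ℕ

Strict : List ℕ → Set
Strict la = Linked _>_ la × All (0 <_) la

-- part la r = λ_r (1-indexed), and 0 if r = 0 or r > ℓ.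
part : List ℕ → ℕ → ℕ
part []       _             = 0
part (x ∷ xs) zero          = 0
part (x ∷ xs) (suc zero)    = x
part (x ∷ xs) (suc (suc r)) = part xs (suc r)

_∈S_ : Cell → List ℕ → Set
(c , r) ∈S la = 1 ≤ r × r ≤ c × c < r + part la r

-- diagonal value diag(c,r) = c - r + 1 (cells of shifted diagrams have c ≥ r)
diag : Cell → ℕ
diag (c , r) = suc c ∸ r

_⊆S_ : List ℕ → List ℕ → Set
mu ⊆S la = ∀ x → x ∈S mu → x ∈S la

SkewCell : List ℕ → List ℕ → Cell → Set
SkewCell la mu x = x ∈S la × ¬ (x ∈S mu)

SkewShifted : (Cell → Set) → Set
SkewShifted P = ∃[ nu ] ∃[ rho ] Strict nu × Strict rho × rho ⊆S nu ×
                  (∀ x → P x ⇔ SkewCell nu rho x)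

-- Ribbons (a finite set of cells is represented by a list of cells)

Adj : Cell → Cell → Set
Adj (c , r) (c' , r') =
  (c' ≡ suc c × r' ≡ r) ⊎ (c ≡ suc c' × r' ≡ r) ⊎
  (r' ≡ suc r × c' ≡ c) ⊎ (r ≡ suc r' × c' ≡ c)

data Path (R : List Cell) : Cell → Cell → Set where
  stop : ∀ {a} → Path R a a
  step : ∀ {a b d} → Adj a b → b ∈ R → Path R b d → Path R a d

EdgeConnected : List Cell → Set
EdgeConnected R = ∀ a b → a ∈ R → b ∈ R → Path R a b

SingleRibbon : List Cell → Set
SingleRibbon R = R ≢ [] × EdgeConnected R × Unique (map diag R) ×
                 SkewShifted (λ x → x ∈ R)

IsHead : List Cell → Cell → Set
IsHead R h = h ∈ R × (∀ x → x ∈ R → diag x ≤ diag h)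

IsTail : List Cell → Cell → Set
IsTail R t = t ∈ R × (∀ x → x ∈ R → diag t ≤ diag x)

DoubleRibbon : List ℕ → List Cell → List Cell → Set
DoubleRibbon la R S =
  SingleRibbon R × SingleRibbon S ×
  (∀ x → x ∈ R → x ∈S la) × (∀ x → x ∈ S → x ∈S la) ×
  (∀ x → x ∈ R → x ∉ S) ×
  length S ≤ length R ×
  (∃[ t ] IsTail R t × t ∈S la × diag t ≡ 1) ×
  (∃[ t ] IsTail S t × t ∈S la × t ∉ R × diag t ≡ 1) ×
  SkewShifted (λ x → x ∈ R ⊎ x ∈ S)

KRibbonHead : ℕ → List ℕ → (Cell → Set) → Cell → Set
KRibbonHead k la X h =
  (∃[ R ] SingleRibbon R × (∀ x → x ∈ R ⇔ X x) × length R ≡ k × IsHead R h)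
  ⊎
  (∃[ R ] ∃[ S ] DoubleRibbon la R S × (∀ x → (x ∈ R ⊎ x ∈ S) ⇔ X x) ×
     length R + length S ≡ k × IsHead R h)

RemovableKRibbon : ℕ → List ℕ → List ℕ → Set
RemovableKRibbon k la mu =
  Strict mu × mu ⊆S la × ∃[ h ] KRibbonHead k la (SkewCell la mu) h

KCore : ℕ → List ℕ → Set
KCore k la = ¬ (∃[ mu ] RemovableKRibbon k la mu)

-- Standard shifted k-ribbon tableaux
-- A tableau is the chain [λ⁽⁰⁾ , λ⁽¹⁾ , … , λ⁽ⁿ⁾] as a list of partitions.

ValidChain : ℕ → List ℕ → List (List ℕ) → List ℕ → Set
ValidChain k prev []           la = prev ≡ la
ValidChain k prev (nu ∷ rest) la =
  Strict nu × RemovableKRibbon k nu prev × ValidChain k nu rest la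

StdRibbonTableau : ℕ → List ℕ → List (List ℕ) → Set
StdRibbonTableau k la []           = ⊥
StdRibbonTableau k la (mu0 ∷ rest) =
  Strict mu0 × KCore k mu0 × ValidChain k mu0 rest la

-- RibbonAt T i nu mu : the ribbon labelled i in T is nu ∖ mu
-- (nu = λ⁽ⁱ⁾, mu = λ⁽ⁱ⁻¹⁾, i ≥ 1)
data RibbonAt : List (List ℕ) → ℕ → List ℕ → List ℕ → Set where
  here  : ∀ {mu nu rest} → RibbonAt (mu ∷ nu ∷ rest) 1 nu mu
  there : ∀ {x rest i nu mu} → RibbonAt rest i nu mu →
          RibbonAt (x ∷ rest) (suc i) nu mu

RibbonHead : ℕ → List (List ℕ) → ℕ → Cell → Set
RibbonHead k T i h =
  ∃[ nu ] ∃[ mu ] RibbonAt T i nu mu × KRibbonHead k nu (SkewCell nu mu) h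

abacus : (k : ℕ) → .{{_ : NonZero k}} → ℕ → List ℕ → List ℕ
abacus k i la = map (λ p → (p ∸ i) / k + 1) (filter (λ p → p % k ≟ i % k) la)

data Component : Set where
  fold  : List ℕ → List ℕ → Component
  shift : List ℕ → Component

-- cells of components live in ℤ × ℤ (column , row)
ZCell : Set
ZCell = ℤ × ℤ

-- the underlying cell set C of α ⋄ β (the specialized diagonal is the
-- fixed line x = y and carries no further data)
_∈⋄_ : ZCell → List ℕ × List ℕ → Set
(X , Y) ∈⋄ (al , be) =
  (∃[ x ] ∃[ y ] (x , y) ∈S al × (length al ∸ n) < x ×
      X ≡ + y ℤ.- + (length al ∸ n) × Y ≡ + x ℤ.- + (length al ∸ n))
  ⊎
  (∃[ x ] ∃[ y ] (x , y) ∈S be × (length be ∸ n) < x ×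
      X ≡ + x ℤ.- + (length be ∸ n) × Y ≡ + y ℤ.- + (length be ∸ n))
  where n = length al ⊓ length be

_∈C_ : ZCell → Component → Set
z ∈C fold al be = z ∈⋄ (al , be)
(X , Y) ∈C shift al = ∃[ x ] ∃[ y ] (x , y) ∈S al × X ≡ + x × Y ≡ + y

diagZ : ZCell → ℤ
diagZ (X , Y) = X ℤ.- Y

kQuotient : (k : ℕ) → .{{_ : NonZero k}} → List ℕ → List Component
kQuotient k la =
  if k % 2 ≡ᵇ 0
  then map combo (map suc (upTo (k / 2 ∸ 1)))
       ++ (fold (abacus k (k / 2) la) [] ∷ shift (abacus k k la) ∷ [])
  else map combo (map suc (upTo (k / 2)))
       ++ (shift (abacus k k la) ∷ [])
  where
  combo : ℕ → Component
  combo i = fold (abacus k i la) (abacus k (k ∸ i) la)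

InQ : List Component → ℕ → ZCell → Set
InQ []       _       z = ⊥
InQ (C ∷ Q)  zero    z = z ∈C C
InQ (C ∷ Q)  (suc j) z = InQ Q j z

-- a filling assigns to (component index, cell) an entry
Filling : Set
Filling = ℕ → ZCell → ℕ

-- standard filling: the entries on the cells of all components are exactly
-- 1, … , N each once (N is then the total number of cells), increasing
-- along rows (left to right) and columns (bottom to top) in each component
StdFilling : List Component → Filling → Set
StdFilling Q F =
  (∃[ N ]
     (∀ j z → InQ Q j z → 1 ≤ F j z × F j z ≤ N) ×
     (∀ i → 1 ≤ i → i ≤ N → ∃[ j ] ∃[ z ] InQ Q j z × F j z ≡ i)) ×
  (∀ j z j' z' → InQ Q j z → InQ Q j' z' → F j z ≡ F j' z' →
     j ≡ j' × z ≡ z') ×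
  (∀ j X X' Y → InQ Q j (X , Y) → InQ Q j (X' , Y) → X ℤ.< X' →
     F j (X , Y) < F j (X' , Y)) ×
  (∀ j X Y Y' → InQ Q j (X , Y) → InQ Q j (X , Y') → Y ℤ.< Y' →
     F j (X , Y) < F j (X , Y'))

_≈[_]_ : Filling → List Component → Filling → Set
F ≈[ Q ] G = ∀ j z → InQ Q j z → F j z ≡ G j z

{-# OPTIONS --safe #-}
module Submission where

-- A strict partition is determined by how many of its parts are at least d, for
-- each d, and this number is also the number of its cells on the diagonal d.
-- Hence removing a k-ribbon with head on the diagonal p either replaces the part
-- p by p - k, or deletes p together with the part k - p. On the abacus such a move
-- shortens by one cell a single diagonal of a single component of the k-quotient
-- (deleting two parts shortens the main diagonal of α ⋄ β), and the removed cell
-- is a corner; conversely every corner comes from exactly one move. So reading a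
-- ribbon tableau as a chain of quotients, each with one cell fewer than the next,
-- and numbering the cells by the step at which they appear, gives the bijection;
-- the head p determines the component and the diagonal of the removed cell.

open import Defs
open import Data.Nat using (ℕ; zero; suc; _+_; _*_; _∸_; _≤_; _<_; _⊓_; z≤n; s≤s; NonZero; >-nonZero⁻¹)
open import Data.Nat.DivMod using (_/_; _%_; m≡m%n+[m/n]*n; m%n<n; [m+kn]%n≡m%n; m<n⇒m%n≡m; m*n/n≡m; n%n≡0)
open import Data.Nat.Properties
open import Algebra.Properties.CommutativeSemigroup +-commutativeSemigroup using () renaming (interchange to +-interchange)
open import Data.Nat.Tactic.RingSolver using (solve-∀)
open import Data.Integer as ℤ using (ℤ)
import Data.Integer.Properties as ℤ
import Data.Integer.Tactic.RingSolver as ℤ-Solver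
open import Data.List using (List; []; _∷_; length; map; filter; applyUpTo; _++_; _∷ʳ_)
open import Data.List.Properties using (length-applyUpTo; map-applyUpTo; length-++; length-map; map-++; filter-accept; filter-reject; ++-assoc; ++-identityʳ; ∷ʳ-injective)
open import Data.List.Membership.Propositional using (_∈_; _∉_)
open import Data.List.Membership.Propositional.Properties using (∈-applyUpTo⁺; ∈-applyUpTo⁻; ∈-∃++; ∈-++⁺ˡ; ∈-++⁺ʳ; ∈-++⁻; ∈-filter⁺; ∈-filter⁻; ∈-map⁺; ∈-map⁻)
open import Data.List.Relation.Unary.Any using (here; there)
open import Data.List.Relation.Unary.All as All using (All; []; _∷_)
open import Data.List.Relation.Unary.AllPairs using ([]; _∷_)
open import Data.List.Relation.Unary.Linked as Linked using ([]; [-]; _∷_)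
open import Data.List.Relation.Unary.Unique.Propositional using (Unique)
import Data.List.Relation.Unary.Unique.Propositional.Properties as Unique
open import Data.Product using (Σ; Σ-syntax; ∃-syntax; _×_; _,_; proj₁; proj₂)
open import Data.Product.Properties using (≡-dec)
open import Data.Sum using (_⊎_; inj₁; inj₂; [_,_]′; swap)
open import Function.Bundles using (_⇔_; mk⇔; Equivalence)
open import Relation.Nullary using (¬_; Dec; yes; no; contradiction; map′; _×-dec_; _⊎-dec_)
open import Relation.Binary.Definitions using (tri<; tri≈; tri>)
open import Relation.Binary.PropositionalEquality

-- The form of the quotient is dictated by how a part can vanish. Lowering a part by k keeps its
-- residue and deletes it only when p = k, on runner k; that runner therefore stays a shifted
-- diagram by itself. On a runner i < k the part 1 of the abacus partition can go only together with
-- the part 1 of runner k - i: the two main diagonals shrink at once and must be glued. For i = k/2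
-- the partner would be a second copy of the same part, which a strict partition lacks, so the
-- second factor is empty. The obstacle is to compare cells of successive quotients without
-- renormalising. The offsets s = a - n and t = b - n achieve this: a move off the main diagonal
-- changes neither a nor b, deleting a pair lowers both by one, and either way s and t survive, so
-- the smaller component is literally a subset of the larger one. The removed cell has to be known
-- only up to its diagonal, since two corners of a component on one diagonal coincide.

⟦_≤_⟧ : ℕ → ℕ → ℕ
⟦ zero  ≤ _     ⟧ = 1
⟦ suc _ ≤ zero  ⟧ = 0
⟦ suc d ≤ suc p ⟧ = ⟦ d ≤ p ⟧

⟦_≡_⟧ : ℕ → ℕ → ℕ
⟦ zero  ≡ zero  ⟧ = 1
⟦ zero  ≡ suc _ ⟧ = 0
⟦ suc _ ≡ zero  ⟧ = 0
⟦ suc d ≡ suc p ⟧ = ⟦ d ≡ p ⟧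

⟦≤⟧-split : ∀ d p → ⟦ d ≤ p ⟧ ≡ ⟦ d ≡ p ⟧ + ⟦ suc d ≤ p ⟧
⟦≤⟧-split zero    zero    = refl
⟦≤⟧-split zero    (suc p) = refl
⟦≤⟧-split (suc d) zero    = refl
⟦≤⟧-split (suc d) (suc p) = ⟦≤⟧-split d p

⟦≤⟧-yes : ∀ {d p} → d ≤ p → ⟦ d ≤ p ⟧ ≡ 1
⟦≤⟧-yes z≤n       = refl
⟦≤⟧-yes (s≤s d≤p) = ⟦≤⟧-yes d≤p

⟦≤⟧-no : ∀ {d p} → p < d → ⟦ d ≤ p ⟧ ≡ 0
⟦≤⟧-no {suc d} {zero}  _         = refl
⟦≤⟧-no {suc d} {suc p} (s≤s p<d) = ⟦≤⟧-no p<d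

⟦≡⟧-yes : ∀ d → ⟦ d ≡ d ⟧ ≡ 1
⟦≡⟧-yes zero    = refl
⟦≡⟧-yes (suc d) = ⟦≡⟧-yes d

⟦≡⟧-no : ∀ {d p} → d ≢ p → ⟦ d ≡ p ⟧ ≡ 0
⟦≡⟧-no {zero}  {zero}  d≢p = contradiction refl d≢p
⟦≡⟧-no {zero}  {suc p} d≢p = refl
⟦≡⟧-no {suc d} {zero}  d≢p = refl
⟦≡⟧-no {suc d} {suc p} d≢p = ⟦≡⟧-no (λ e → d≢p (cong suc e))

-- Multiplicities of parts and their partial sums

mult : List ℕ → ℕ → ℕ
mult []       d = 0
mult (x ∷ xs) d = ⟦ d ≡ x ⟧ + mult xs d

atLeast : List ℕ → ℕ → ℕ
atLeast []       d = 0
atLeast (x ∷ xs) d = ⟦ d ≤ x ⟧ + atLeast xs d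

atLeast-split : ∀ la d → atLeast la d ≡ mult la d + atLeast la (suc d)
atLeast-split []       d = refl
atLeast-split (x ∷ xs) d = begin
  ⟦ d ≤ x ⟧ + atLeast xs d
    ≡⟨ cong₂ _+_ (⟦≤⟧-split d x) (atLeast-split xs d) ⟩
  (⟦ d ≡ x ⟧ + ⟦ suc d ≤ x ⟧) + (mult xs d + atLeast xs (suc d))
    ≡⟨ +-interchange ⟦ d ≡ x ⟧ _ _ _ ⟩
  (⟦ d ≡ x ⟧ + mult xs d) + (⟦ suc d ≤ x ⟧ + atLeast xs (suc d)) ∎
  where open ≡-Reasoning

atLeast-above : ∀ {xs d} → All (_< d) xs → atLeast xs d ≡ 0
atLeast-above []         = refl
atLeast-above (x<d ∷ ps) = cong₂ _+_ (⟦≤⟧-no x<d) (atLeast-above ps)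

mult-above : ∀ {xs d} → All (_< d) xs → mult xs d ≡ 0
mult-above []         = refl
mult-above (x<d ∷ ps) = cong₂ _+_ (⟦≡⟧-no (λ e → <⇒≢ x<d (sym e))) (mult-above ps)

mult-∈ : ∀ {xs d} → d ∈ xs → 1 ≤ mult xs d
mult-∈ {x ∷ xs} {d} (here refl) rewrite ⟦≡⟧-yes d = s≤s z≤n
mult-∈ {x ∷ xs} {d} (there d∈)  = ≤-trans (mult-∈ d∈) (m≤n+m _ ⟦ d ≡ x ⟧)

mult-∉ : ∀ {xs d} → d ∉ xs → mult xs d ≡ 0
mult-∉ {[]}     d∉ = refl
mult-∉ {x ∷ xs} d∉ =
  cong₂ _+_ (⟦≡⟧-no (λ e → d∉ (here e))) (mult-∉ (λ d∈ → d∉ (there d∈)))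

-- Strict partitions

bound : (xs : List ℕ) → ∃[ B ] All (_< B) xs
bound []       = 0 , []
bound (x ∷ xs) with bound xs
... | B , ps = suc x + B , m≤m+n (suc x) B ∷ All.map (λ p → ≤-trans p (m≤n+m B (suc x))) ps

strict-tail : ∀ {x xs} → Strict (x ∷ xs) → Strict xs
strict-tail (l , _ ∷ ps) = Linked.tail l , ps

strict-head : ∀ {x xs} → Strict (x ∷ xs) → All (_< x) xs
strict-head {x} {[]}     _                  = []
strict-head {x} {y ∷ ys} (y<x ∷ l , _ ∷ ps) =
  y<x ∷ All.map (λ p → <-trans p y<x) (strict-head (l , ps))

strict-[] : Strict []
strict-[] = [] , []

strict-∷ : ∀ {x xs} → All (_< x) xs → 0 < x → Strict xs → Strict (x ∷ xs)
strict-∷ []         0<x (_ , ps) = [-] , 0<x ∷ ps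
strict-∷ (y<x ∷ _) 0<x (l , ps) = (y<x ∷ l) , 0<x ∷ ps

mult≤1 : ∀ {xs} → Strict xs → ∀ d → mult xs d ≤ 1
mult≤1 {[]}     st d = z≤n
mult≤1 {x ∷ xs} st d with d ≟ x
... | yes refl rewrite ⟦≡⟧-yes d | mult-above (strict-head st) = ≤-refl
... | no  d≢x  rewrite ⟦≡⟧-no d≢x = mult≤1 (strict-tail st) d

atLeast-anti : ∀ la d → atLeast la (suc d) ≤ atLeast la d
atLeast-anti la d rewrite atLeast-split la d = m≤n+m _ _

atLeast-slope : ∀ {la} → Strict la → ∀ d → atLeast la d ≤ suc (atLeast la (suc d))
atLeast-slope {la} st d rewrite atLeast-split la d = +-monoˡ-≤ _ (mult≤1 st d)

atLeast-one : ∀ {xs} → Strict xs → atLeast xs 1 ≡ length xs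
atLeast-one {[]}         st             = refl
atLeast-one {suc x ∷ xs} st             = cong suc (atLeast-one (strict-tail st))
atLeast-one {zero ∷ xs}  (_ , () ∷ _)

-- Conjugation: the parts decrease, so those of size at least e + 1 are exactly the first ones.
-- Together with `atLeast⇒part` this turns row lengths into counts.
part⇒atLeast : ∀ {la} → Strict la → ∀ r e → suc e ≤ part la (suc r) → suc r ≤ atLeast la (suc e)
part⇒atLeast {x ∷ xs} st zero    e p rewrite ⟦≤⟧-yes p = s≤s z≤n
part⇒atLeast {x ∷ xs} st (suc r) e p with suc e ≤? x
... | yes e<x rewrite ⟦≤⟧-yes e<x = s≤s (part⇒atLeast (strict-tail st) r e p)
... | no  e≮x = contradiction (≤-trans (part⇒atLeast (strict-tail st) r e p)
                  (≤-reflexive (atLeast-above (All.map (λ q → <-trans q (≰⇒> e≮x)) (strict-head st))))) λ ()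

atLeast⇒part : ∀ {la} → Strict la → ∀ r e → suc r ≤ atLeast la (suc e) → suc e ≤ part la (suc r)
atLeast⇒part {x ∷ xs} st r e p with suc e ≤? x
atLeast⇒part {x ∷ xs} st zero    e p | yes e<x = e<x
atLeast⇒part {x ∷ xs} st (suc r) e p | yes e<x rewrite ⟦≤⟧-yes e<x =
  atLeast⇒part (strict-tail st) r e (≤-pred p)
... | no  e≮x = contradiction (≤-trans p (≤-reflexive (atLeast-above
                  (≰⇒> e≮x ∷ All.map (λ q → <-trans q (≰⇒> e≮x)) (strict-head st))))) λ ()

-- From here on a cell is addressed by its row r and its offset e = c - r. In these terms a diagonal
-- is filled from row 1 upwards without gaps, up to row `atLeast la (suc e)`.
∈S⇒ : ∀ {la} → Strict la → ∀ {c r} → (c , r) ∈S la →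
      ∃[ e ] c ≡ r + e × 1 ≤ r × r ≤ atLeast la (suc e)
∈S⇒ {la} st {c} {suc r} (s≤s z≤n , r≤c , c<) = c ∸ suc r , sym (m+[n∸m]≡n r≤c) , s≤s z≤n ,
  part⇒atLeast st r (c ∸ suc r)
    (+-cancelˡ-≤ (suc r) _ _ (≤-trans (≤-reflexive (trans (+-suc (suc r) _) (cong suc (m+[n∸m]≡n r≤c)))) c<))

⇒∈S : ∀ {la} → Strict la → ∀ {r} e → 1 ≤ r → r ≤ atLeast la (suc e) → (r + e , r) ∈S la
⇒∈S {la} st {suc r} e (s≤s z≤n) p = s≤s z≤n , m≤m+n (suc r) e ,
  ≤-trans (≤-reflexive (sym (+-suc (suc r) e))) (+-monoʳ-≤ (suc r) (atLeast⇒part st r e p))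

-- Compare the largest parts: if they differ, the larger one has multiplicity 0 in the other list.
strict-ext : ∀ {xs ys} → Strict xs → Strict ys → (∀ d → mult xs (suc d) ≡ mult ys (suc d)) → xs ≡ ys
strict-ext {[]}         {[]}         sx sy eq = refl
strict-ext {[]}         {suc y ∷ ys} sx sy eq with trans (eq y) (cong (_+ mult ys (suc y)) (⟦≡⟧-yes y))
... | ()
strict-ext {[]}         {zero ∷ ys}  sx (_ , () ∷ _) eq
strict-ext {zero ∷ xs}  {ys}         (_ , () ∷ _) sy eq
strict-ext {suc x ∷ xs} {[]}         sx sy eq with trans (sym (eq x)) (cong (_+ mult xs (suc x)) (⟦≡⟧-yes x))
... | ()
strict-ext {suc x ∷ xs} {zero ∷ ys}  sx (_ , () ∷ _) eq
strict-ext {suc x ∷ xs} {suc y ∷ ys} sx sy eq with <-cmp x y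
... | tri< x<y _ _ = contradiction (subst (1 ≤_)
        (trans (sym (eq y)) (mult-above (s≤s x<y ∷ All.map (λ p → <-trans p (s≤s x<y)) (strict-head sx))))
        (mult-∈ {suc y ∷ ys} (here refl))) λ ()
... | tri> _ _ y<x = contradiction (subst (1 ≤_)
        (trans (eq x) (mult-above (s≤s y<x ∷ All.map (λ p → <-trans p (s≤s y<x)) (strict-head sy))))
        (mult-∈ {suc x ∷ xs} (here refl))) λ ()
... | tri≈ _ refl _ = cong (suc x ∷_) (strict-ext (strict-tail sx) (strict-tail sy)
        (λ d → +-cancelˡ-≡ ⟦ suc d ≡ suc x ⟧ _ _ (eq d)))

fromMult : (ℕ → ℕ) → ℕ → List ℕ
fromMult w zero    = []
fromMult w (suc B) with w (suc B)
... | zero  = fromMult w B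
... | suc _ = suc B ∷ fromMult w B

fromMult-bound : ∀ w B → All (_≤ B) (fromMult w B)
fromMult-bound w zero    = []
fromMult-bound w (suc B) with w (suc B)
... | zero  = All.map m≤n⇒m≤1+n (fromMult-bound w B)
... | suc _ = ≤-refl ∷ All.map m≤n⇒m≤1+n (fromMult-bound w B)

fromMult-strict : ∀ w B → Strict (fromMult w B)
fromMult-strict w zero    = strict-[]
fromMult-strict w (suc B) with w (suc B)
... | zero  = fromMult-strict w B
... | suc _ = strict-∷ (All.map s≤s (fromMult-bound w B)) (s≤s z≤n) (fromMult-strict w B)

mult-fromMult : ∀ w B → (∀ d → w d ≤ 1) → ∀ d → suc d ≤ B → mult (fromMult w B) (suc d) ≡ w (suc d)
mult-fromMult w (suc B) w≤1 d (s≤s d≤B) with d ≟ B | w (suc B) in eq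
... | yes refl | zero  = trans (mult-above (All.map s≤s (fromMult-bound w B))) (sym eq)
... | yes refl | suc c = trans (cong₂ _+_ (⟦≡⟧-yes B) (mult-above (All.map s≤s (fromMult-bound w B))))
                           (sym (≤-antisym (w≤1 (suc B)) (subst (1 ≤_) (sym eq) (s≤s z≤n))))
... | no d≢B   | zero  = mult-fromMult w B w≤1 d (≤∧≢⇒< d≤B d≢B)
... | no d≢B   | suc c = trans (cong (_+ mult (fromMult w B) (suc d)) (⟦≡⟧-no d≢B))
                           (mult-fromMult w B w≤1 d (≤∧≢⇒< d≤B d≢B))

-- The inverse of `mult`: shapes are built by editing a multiplicity function and reading the parts
-- off downwards from B. The value at 0 does not enter the result, which suits the convention that a
-- part 0 is no part.
realise : ∀ w B → (∀ d → w d ≤ 1) → (∀ d → B < d → w d ≡ 0) →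
          ∃[ la ] Strict la × ∀ d → mult la (suc d) ≡ w (suc d)
realise w B w≤1 w0 = fromMult w B , fromMult-strict w B , lem
  where
  lem : ∀ d → mult (fromMult w B) (suc d) ≡ w (suc d)
  lem d with suc d ≤? B
  ... | yes p = mult-fromMult w B w≤1 d p
  ... | no ¬p = trans (mult-above (All.map (λ q → ≤-<-trans q (≰⇒> ¬p)) (fromMult-bound w B)))
                      (sym (w0 (suc d) (≰⇒> ¬p)))

-- Induction from infinity: the difference equations make f and g the sums of u and v over all
-- arguments from e on, up to a tail on which they agree.
downward : ∀ (f g u v : ℕ → ℕ) B → (∀ e → B ≤ e → f e ≡ g e) →
           (∀ e → f e ≡ u e + f (suc e)) → (∀ e → g e ≡ v e + g (suc e)) →
           (∀ e → u e ≡ v e) → ∀ e → f e ≡ g e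
downward f g u v zero    tl f-split g-split uv e = tl e z≤n
downward f g u v (suc B) tl f-split g-split uv e = downward f g u v B tl′ f-split g-split uv e
  where
  tl′ : ∀ e → B ≤ e → f e ≡ g e
  tl′ e B≤e with m≤n⇒m<n∨m≡n B≤e
  ... | inj₁ B<e  = tl e B<e
  ... | inj₂ refl = trans (f-split B) (trans (cong₂ _+_ (uv B) (tl (suc B) ≤-refl)) (sym (g-split B)))

-- Ribbons

diag-row : ∀ r e → diag (r + e , r) ≡ suc e
diag-row r e = trans (cong (_∸ r) (sym (+-suc r e))) (m+n∸m≡n r (suc e))

Adj-sym : ∀ {x y} → Adj x y → Adj y x
Adj-sym (inj₁ (p , q))               = inj₂ (inj₁ (p , sym q))
Adj-sym (inj₂ (inj₁ (p , q)))        = inj₁ (p , sym q)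
Adj-sym (inj₂ (inj₂ (inj₁ (p , q)))) = inj₂ (inj₂ (inj₂ (p , sym q)))
Adj-sym (inj₂ (inj₂ (inj₂ (p , q)))) = inj₂ (inj₂ (inj₁ (p , sym q)))

-- In terms of the numbers of cells on the diagonals, replacing the part p by q
-- removes one cell from each of the diagonals q + 1, …, p.
Lowers : List ℕ → List ℕ → ℕ → ℕ → Set
Lowers nu mu q p = ∀ e → atLeast nu (suc e) + ⟦ suc e ≤ q ⟧ ≡ atLeast mu (suc e) + ⟦ suc e ≤ p ⟧

module _ (nu mu : List ℕ) (q n : ℕ) (lw : Lowers nu mu q (q + n)) where

  lowers-inside : ∀ {e} → q ≤ e → e < q + n → atLeast nu (suc e) ≡ suc (atLeast mu (suc e))
  lowers-inside {e} q≤e e<p = begin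
    atLeast nu (suc e)                 ≡⟨ +-identityʳ _ ⟨
    atLeast nu (suc e) + 0             ≡⟨ cong (atLeast nu (suc e) +_) (⟦≤⟧-no (s≤s q≤e)) ⟨
    atLeast nu (suc e) + ⟦ suc e ≤ q ⟧ ≡⟨ lw e ⟩
    atLeast mu (suc e) + _             ≡⟨ cong (atLeast mu (suc e) +_) (⟦≤⟧-yes e<p) ⟩
    atLeast mu (suc e) + 1             ≡⟨ +-comm _ 1 ⟩
    suc (atLeast mu (suc e))           ∎
    where open ≡-Reasoning

  lowers-below : ∀ {e} → e < q → atLeast nu (suc e) ≡ atLeast mu (suc e)
  lowers-below {e} e<q = +-cancelʳ-≡ 1 _ _ (begin
    atLeast nu (suc e) + 1             ≡⟨ cong (atLeast nu (suc e) +_) (⟦≤⟧-yes e<q) ⟨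
    atLeast nu (suc e) + ⟦ suc e ≤ q ⟧ ≡⟨ lw e ⟩
    atLeast mu (suc e) + _             ≡⟨ cong (atLeast mu (suc e) +_) (⟦≤⟧-yes (≤-trans e<q (m≤m+n q n))) ⟩
    atLeast mu (suc e) + 1             ∎)
    where open ≡-Reasoning

  lowers-above : ∀ {e} → q + n ≤ e → atLeast nu (suc e) ≡ atLeast mu (suc e)
  lowers-above {e} p≤e = +-cancelʳ-≡ 0 _ _ (begin
    atLeast nu (suc e) + 0             ≡⟨ cong (atLeast nu (suc e) +_) (⟦≤⟧-no (s≤s (≤-trans (m≤m+n q n) p≤e))) ⟨
    atLeast nu (suc e) + ⟦ suc e ≤ q ⟧ ≡⟨ lw e ⟩
    atLeast mu (suc e) + _             ≡⟨ cong (atLeast mu (suc e) +_) (⟦≤⟧-no (s≤s p≤e)) ⟩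
    atLeast mu (suc e) + 0             ∎)
    where open ≡-Reasoning

  lowers-≤ : ∀ e → atLeast mu (suc e) ≤ atLeast nu (suc e)
  lowers-≤ e with e <? q | e <? q + n
  ... | yes e<q | _       = ≤-reflexive (sym (lowers-below e<q))
  ... | no  e≮q | yes e<p = ≤-trans (n≤1+n _) (≤-reflexive (sym (lowers-inside (≮⇒≥ e≮q) e<p)))
  ... | no  e≮q | no  e≮p = ≤-reflexive (sym (lowers-above (≮⇒≥ e≮p)))

-- Diagonals fill from row 1 upwards, so when a diagonal loses one cell it is the last one; a
-- removable single ribbon consists of such cells.
topCell : List ℕ → ℕ → Cell
topCell nu e = atLeast nu (suc e) + e , atLeast nu (suc e)

⊆S-atLeast : ∀ {nu mu} → Strict nu → Strict mu →
             (∀ e → atLeast mu (suc e) ≤ atLeast nu (suc e)) → mu ⊆S nu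
⊆S-atLeast st-nu st-mu mu≤nu (c , r) x∈mu with ∈S⇒ st-mu x∈mu
... | e , refl , 1≤r , r≤ = ⇒∈S st-nu e 1≤r (≤-trans r≤ (mu≤nu e))

-- The rim goes right if e + 1 is not a part and down if it is; distinctness of the parts excludes a
-- longer descent.
topCell-adj : ∀ {nu} → Strict nu → ∀ e → Adj (topCell nu e) (topCell nu (suc e))
topCell-adj {nu} st e with mult nu (suc e) in eq | mult≤1 st (suc e) | atLeast-split nu (suc e)
... | zero        | _ | sp rewrite sp = inj₁ (+-suc _ e , refl)
... | suc zero    | _ | sp rewrite sp = inj₂ (inj₂ (inj₂ (refl , +-suc _ e)))
... | suc (suc _) | s≤s () | _

-- Produces an actual ribbon from counts alone: the last cells of the diagonals q + 1, ..., q + n +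
-- 1. The length is a successor because a ribbon is nonempty.
module Ribbon {nu mu : List ℕ} (st-nu : Strict nu) (st-mu : Strict mu)
              {q n : ℕ} (lw : Lowers nu mu q (q + suc n)) where

  private
    cell : ℕ → Cell
    cell i = topCell nu (q + i)

  ribbon : List Cell
  ribbon = applyUpTo cell (suc n)

  private
    diag-cell : ∀ i → diag (cell i) ≡ suc (q + i)
    diag-cell i = diag-row (atLeast nu (suc (q + i))) (q + i)

    inside : ∀ {i} → i < suc n → atLeast nu (suc (q + i)) ≡ suc (atLeast mu (suc (q + i)))
    inside {i} i<n = lowers-inside nu mu q (suc n) lw (m≤m+n q i) (+-monoʳ-< q i<n)

  ⊆S-lowers : mu ⊆S nu
  ⊆S-lowers = ⊆S-atLeast st-nu st-mu (lowers-≤ nu mu q (suc n) lw)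

  ribbon⇒skew : ∀ x → x ∈ ribbon → SkewCell nu mu x
  ribbon⇒skew x x∈ with ∈-applyUpTo⁻ cell x∈
  ... | i , i<n , refl =
      ⇒∈S st-nu (q + i) (subst (1 ≤_) (sym (inside i<n)) (s≤s z≤n)) ≤-refl
    , λ x∈mu → absurd (∈S⇒ st-mu x∈mu)
    where
    absurd : ¬ (∃[ e ] proj₁ (cell i) ≡ proj₂ (cell i) + e × 1 ≤ proj₂ (cell i) ×
                       proj₂ (cell i) ≤ atLeast mu (suc e))
    absurd (e , eq , _ , r≤) with +-cancelˡ-≡ (atLeast nu (suc (q + i))) _ _ eq
    ... | refl = <-irrefl refl (≤-trans (≤-reflexive (sym (inside i<n))) r≤)

  skew⇒ribbon : ∀ x → SkewCell nu mu x → x ∈ ribbon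
  skew⇒ribbon (c , r) (x∈nu , x∉mu) with ∈S⇒ st-nu x∈nu
  ... | e , refl , 1≤r , r≤ with e <? q | e <? q + suc n
  ... | yes e<q | _ =
    contradiction (⇒∈S st-mu e 1≤r (≤-trans r≤ (≤-reflexive (lowers-below nu mu q (suc n) lw e<q)))) x∉mu
  ... | no  _   | no e≮p =
    contradiction (⇒∈S st-mu e 1≤r (≤-trans r≤ (≤-reflexive (lowers-above nu mu q (suc n) lw (≮⇒≥ e≮p))))) x∉mu
  ... | no  e≮q | yes e<p = subst (_∈ ribbon) cell≡ (∈-applyUpTo⁺ cell i<n)
    where
    q≤e = ≮⇒≥ e≮q
    q+i≡e : q + (e ∸ q) ≡ e
    q+i≡e = m+[n∸m]≡n q≤e
    i<n : e ∸ q < suc n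
    i<n = +-cancelˡ-< q _ _ (subst (_< q + suc n) (sym q+i≡e) e<p)
    -- On this diagonal nu has just one cell more than mu, so any row below the last one would lie
    -- in mu.
    r≡ : atLeast nu (suc e) ≡ r
    r≡ with m≤n⇒m<n∨m≡n r≤
    ... | inj₂ r≡′ = sym r≡′
    ... | inj₁ r<  = contradiction
      (⇒∈S st-mu e 1≤r (≤-pred (≤-trans r< (≤-reflexive (lowers-inside nu mu q (suc n) lw q≤e e<p))))) x∉mu
    cell≡ : cell (e ∸ q) ≡ (r + e , r)
    cell≡ = trans (cong (topCell nu) q+i≡e) (cong (λ s → s + e , s) r≡)

  length-ribbon : length ribbon ≡ suc n
  length-ribbon = length-applyUpTo cell (suc n)

  private
    up : ∀ m i → i + m < suc n → Path ribbon (cell i) (cell (i + m))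
    up zero    i i<n = subst (λ j → Path ribbon (cell i) (cell j)) (sym (+-identityʳ i)) stop
    up (suc m) i i<n = step (subst (λ j → Adj (cell i) (topCell nu j)) (sym (+-suc q i)) (topCell-adj st-nu (q + i)))
      (∈-applyUpTo⁺ cell (≤-<-trans (≤-trans (m≤m+n (suc i) m) (≤-reflexive (sym (+-suc i m)))) i<n))
      (subst (λ j → Path ribbon (cell (suc i)) (cell j)) (sym (+-suc i m))
        (up m (suc i) (subst (_< suc n) (+-suc i m) i<n)))

    down : ∀ m i → i + m < suc n → Path ribbon (cell (i + m)) (cell i)
    down zero    i i<n = subst (λ j → Path ribbon (cell j) (cell i)) (sym (+-identityʳ i)) stop
    down (suc m) i i<n = step
      (Adj-sym (subst (λ j → Adj (cell (i + m)) (cell j)) (sym (+-suc i m))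
        (subst (λ j → Adj (cell (i + m)) (topCell nu j)) (sym (+-suc q (i + m))) (topCell-adj st-nu (q + (i + m))))))
      (∈-applyUpTo⁺ cell i+m<n) (down m i i+m<n)
      where
      i+m<n : i + m < suc n
      i+m<n = <-trans (≤-reflexive (sym (+-suc i m))) i<n

  ribbon-connected : EdgeConnected ribbon
  ribbon-connected a b a∈ b∈ with ∈-applyUpTo⁻ cell a∈ | ∈-applyUpTo⁻ cell b∈
  ... | i , i<n , refl | j , j<n , refl with ≤-total i j
  ... | inj₁ i≤j = subst (λ m → Path ribbon (cell i) (cell m)) (m+[n∸m]≡n i≤j)
                     (up (j ∸ i) i (subst (_< suc n) (sym (m+[n∸m]≡n i≤j)) j<n))
  ... | inj₂ j≤i = subst (λ m → Path ribbon (cell m) (cell j)) (m+[n∸m]≡n j≤i)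
                     (down (i ∸ j) j (subst (_< suc n) (sym (m+[n∸m]≡n j≤i)) i<n))

  ribbon-unique-diag : Unique (map diag ribbon)
  ribbon-unique-diag = subst Unique (sym (map-applyUpTo cell diag (suc n)))
    (Unique.applyUpTo⁺₁ _ (suc n) λ {i} {j} i<j _ eq → <⇒≢ i<j
      (+-cancelˡ-≡ q _ _ (suc-injective (trans (sym (diag-cell i)) (trans eq (diag-cell j))))))

  single : SingleRibbon ribbon
  single = (λ ()) , ribbon-connected , ribbon-unique-diag ,
    nu , mu , st-nu , st-mu , ⊆S-lowers , λ x → mk⇔ (ribbon⇒skew x) (skew⇒ribbon x)

  head : IsHead ribbon (cell n)
  head = ∈-applyUpTo⁺ cell ≤-refl , λ x x∈ → le x (∈-applyUpTo⁻ cell x∈)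
    where
    le : ∀ x → (∃[ i ] i < suc n × x ≡ cell i) → diag x ≤ diag (cell n)
    le x (i , s≤s i≤n , refl) =
      subst₂ _≤_ (sym (diag-cell i)) (sym (diag-cell n)) (s≤s (+-monoʳ-≤ q i≤n))

  tail : IsTail ribbon (cell 0)
  tail = ∈-applyUpTo⁺ cell (s≤s z≤n) , λ x x∈ → le x (∈-applyUpTo⁻ cell x∈)
    where
    le : ∀ x → (∃[ i ] i < suc n × x ≡ cell i) → diag (cell 0) ≤ diag x
    le x (i , s≤s i≤n , refl) =
      subst₂ _≤_ (sym (diag-cell 0)) (sym (diag-cell i)) (s≤s (+-monoʳ-≤ q z≤n))

  diag-tail : diag (cell 0) ≡ suc q
  diag-tail = trans (diag-cell 0) (cong suc (+-identityʳ q))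

  tail∈ : cell 0 ∈ ribbon
  tail∈ = proj₁ tail

-- Counting cells on a diagonal

unique-⊆-length : ∀ {A : Set} {xs ys : List A} → Unique xs → (∀ {x} → x ∈ xs → x ∈ ys) →
                  length xs ≤ length ys
unique-⊆-length {xs = []}     []       sub = z≤n
unique-⊆-length {xs = x ∷ xs} (x∉ ∷ u) sub with ∈-∃++ (sub (here refl))
... | as , bs , refl = ≤-trans (s≤s (unique-⊆-length u sub′)) (≤-reflexive (sym len))
  where
  len : length (as ++ x ∷ bs) ≡ suc (length (as ++ bs))
  len = trans (length-++ as) (trans (+-suc (length as) _) (cong suc (sym (length-++ as))))
  sub′ : ∀ {y} → y ∈ xs → y ∈ as ++ bs
  sub′ {y} y∈ with ∈-++⁻ as (sub (there y∈))
  ... | inj₁ y∈as         = ∈-++⁺ˡ y∈as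
  ... | inj₂ (here refl)  = contradiction refl (All.lookup x∉ y∈)
  ... | inj₂ (there y∈bs) = ∈-++⁺ʳ as y∈bs

unique-length : ∀ {A : Set} {xs ys : List A} → Unique xs → Unique ys → (∀ {x} → x ∈ xs → x ∈ ys) →
                (∀ {x} → x ∈ ys → x ∈ xs) → length xs ≡ length ys
unique-length u v sub sup = ≤-antisym (unique-⊆-length u sub) (unique-⊆-length v sup)

onDiag : ℕ → List Cell → List Cell
onDiag d = filter (λ x → diag x ≟ d)

length-onDiag : ∀ d L → length (onDiag d L) ≡ mult (map diag L) d
length-onDiag d []      = refl
length-onDiag d (x ∷ L) with diag x ≟ d
... | yes x≡d = trans (cong length (filter-accept (λ y → diag y ≟ d) {x} {L} x≡d))
                  (cong₂ _+_ (sym (trans (cong (λ y → ⟦ d ≡ y ⟧) x≡d) (⟦≡⟧-yes d))) (length-onDiag d L))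
... | no  x≢d = trans (cong length (filter-reject (λ y → diag y ≟ d) {x} {L} x≢d))
                  (cong₂ _+_ (sym (⟦≡⟧-no (λ e → x≢d (sym e)))) (length-onDiag d L))

mult-++ : ∀ xs ys d → mult (xs ++ ys) d ≡ mult xs d + mult ys d
mult-++ []       ys d = refl
mult-++ (x ∷ xs) ys d = trans (cong (⟦ d ≡ x ⟧ +_) (mult-++ xs ys d)) (sym (+-assoc ⟦ d ≡ x ⟧ _ _))

unique-mult : ∀ {xs d} → Unique xs → d ∈ xs → mult xs d ≡ 1
unique-mult {x ∷ xs} {d} (x∉ ∷ u) (here refl) =
  cong₂ _+_ (⟦≡⟧-yes d) (mult-∉ (λ d∈ → All.lookup x∉ d∈ refl))
unique-mult {x ∷ xs} {d} (x∉ ∷ u) (there d∈)  =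
  cong₂ _+_ (⟦≡⟧-no (λ e → All.lookup x∉ d∈ (sym e))) (unique-mult u d∈)

-- On a fixed diagonal nu occupies the rows 1, ..., N and mu the rows 1, ..., M, so `L` holds there
-- precisely the rows M + 1, ..., N. Duplicate-free lists with the same elements have the same
-- length.
count-diag : ∀ {nu mu} → Strict nu → Strict mu → mu ⊆S nu → ∀ {L} → Unique L →
             (∀ x → x ∈ L → SkewCell nu mu x) → (∀ x → SkewCell nu mu x → x ∈ L) →
             ∀ e → atLeast nu (suc e) ≡ mult (map diag L) (suc e) + atLeast mu (suc e)
count-diag {nu} {mu} st-nu st-mu mu⊆nu {L} uL to from e = begin
  atLeast nu (suc e)                                     ≡⟨ m∸n+n≡m M≤N ⟨
  N ∸ M + M                                              ≡⟨ cong (_+ M) (length-applyUpTo row (N ∸ M)) ⟨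
  length (applyUpTo row (N ∸ M)) + M                     ≡⟨ cong (_+ M) (unique-length uRows uD rows⊆ ⊆rows) ⟩
  length (onDiag (suc e) L) + M                          ≡⟨ cong (_+ M) (length-onDiag (suc e) L) ⟩
  mult (map diag L) (suc e) + atLeast mu (suc e)         ∎
  where
  open ≡-Reasoning
  N = atLeast nu (suc e)
  M = atLeast mu (suc e)
  row : ℕ → Cell
  row i = suc (M + i) + e , suc (M + i)

  M≤N : M ≤ N
  M≤N with M in eq
  ... | zero   = z≤n
  ... | suc M′ with ∈S⇒ st-nu (mu⊆nu _ (⇒∈S st-mu {suc M′} e (s≤s z≤n) (≤-reflexive (sym eq))))
  ... | e′ , eq′ , _ , le with +-cancelˡ-≡ (suc M′) _ _ eq′
  ... | refl = le

  uRows : Unique (applyUpTo row (N ∸ M))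
  uRows = Unique.applyUpTo⁺₁ row (N ∸ M) λ i<j _ eq → <⇒≢ i<j
    (+-cancelˡ-≡ M _ _ (suc-injective (cong proj₂ eq)))

  uD : Unique (onDiag (suc e) L)
  uD = Unique.filter⁺ (λ x → diag x ≟ suc e) uL

  rows⊆ : ∀ {x} → x ∈ applyUpTo row (N ∸ M) → x ∈ onDiag (suc e) L
  rows⊆ x∈ with ∈-applyUpTo⁻ row x∈
  ... | i , i< , refl = ∈-filter⁺ (λ x → diag x ≟ suc e) (from _ (in-nu , out-mu)) (diag-row (suc (M + i)) e)
    where
    in-nu : row i ∈S nu
    in-nu = ⇒∈S st-nu e (s≤s z≤n)
      (≤-trans (≤-reflexive (sym (+-suc M i))) (≤-trans (+-monoʳ-≤ M i<) (≤-reflexive (m+[n∸m]≡n M≤N))))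
    out-mu : ¬ (row i ∈S mu)
    out-mu x∈mu with ∈S⇒ st-mu x∈mu
    ... | e′ , eq′ , _ , le with +-cancelˡ-≡ (suc (M + i)) _ _ eq′
    ... | refl = <-irrefl refl (≤-trans (s≤s (m≤m+n M i)) le)

  ⊆rows : ∀ {x} → x ∈ onDiag (suc e) L → x ∈ applyUpTo row (N ∸ M)
  ⊆rows {c , r} x∈ with ∈-filter⁻ (λ x → diag x ≟ suc e) x∈
  ... | x∈L , dx with to (c , r) x∈L
  ... | x∈nu , x∉mu with ∈S⇒ st-nu x∈nu
  ... | e′ , refl , 1≤r , r≤N with suc-injective (trans (sym (diag-row r e′)) dx)
  ... | refl = subst (_∈ applyUpTo row (N ∸ M)) (cong (λ s → s + e , s) r≡) (∈-applyUpTo⁺ row i<)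
    where
    M<r : M < r
    M<r = ≰⇒> (λ r≤M → x∉mu (⇒∈S st-mu e 1≤r r≤M))
    r≡ : suc (M + (r ∸ suc M)) ≡ r
    r≡ = m+[n∸m]≡n M<r
    i< : r ∸ suc M < N ∸ M
    i< = +-cancelˡ-≤ M _ _ (≤-trans (≤-reflexive (trans (+-suc M _) r≡)) (≤-trans r≤N (≤-reflexive (sym (m+[n∸m]≡n M≤N)))))

suc-∸-≤ : ∀ m n → suc m ∸ n ≤ suc (m ∸ n)
suc-∸-≤ m       zero    = ≤-refl
suc-∸-≤ zero    (suc n) rewrite 0∸n≡0 n = z≤n
suc-∸-≤ (suc m) (suc n) = suc-∸-≤ m n

-- Consecutive cells of a path have diagonal values differing by at most one,
-- so a connected set of cells meets every diagonal between two of its cells.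

diag-adj : ∀ {x y} → Adj x y → diag y ≤ suc (diag x)
diag-adj {c , r} (inj₁ (refl , refl))                   = suc-∸-≤ (suc c) r
diag-adj {suc c , r} (inj₂ (inj₁ (refl , refl)))        = m≤n⇒m≤1+n (∸-monoˡ-≤ r (n≤1+n (suc c)))
diag-adj {c , r} (inj₂ (inj₂ (inj₁ (refl , refl))))     = m≤n⇒m≤1+n (∸-monoʳ-≤ (suc c) (n≤1+n r))
diag-adj {c , suc r} (inj₂ (inj₂ (inj₂ (refl , refl)))) = suc-∸-≤ c r

path-diag : ∀ {R a b d} → a ∈ R → Path R a b → diag a ≤ d → d ≤ diag b → d ∈ map diag R
path-diag {R} {a} a∈ stop a≤d d≤a = subst (_∈ map diag R) (≤-antisym a≤d d≤a) (∈-map⁺ diag a∈)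
path-diag {R} {a} a∈ (step adj b∈ path) a≤d d≤b with m≤n⇒m<n∨m≡n a≤d
... | inj₂ refl = ∈-map⁺ diag a∈
... | inj₁ a<d  = path-diag b∈ path (≤-trans (diag-adj adj) a<d) d≤b

module _ {R : List Cell} (conn : EdgeConnected R) (uniq : Unique (map diag R))
         {t h : Cell} (tail : IsTail R t) (head : IsHead R h) {q : ℕ} (dt : diag t ≡ suc q) where

  private
    p = diag h
    interval : ℕ → ℕ
    interval i = suc q + i

    q<p : suc q ≤ p
    q<p = subst (_≤ p) dt (proj₂ head t (proj₁ tail))

    ∈-lower : ∀ {d} → d ∈ map diag R → suc q ≤ d
    ∈-lower d∈ with ∈-map⁻ diag d∈
    ... | x , x∈ , refl = subst (_≤ diag x) dt (proj₂ tail x x∈)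

    ∈-upper : ∀ {d} → d ∈ map diag R → d ≤ p
    ∈-upper d∈ with ∈-map⁻ diag d∈
    ... | x , x∈ , refl = proj₂ head x x∈

    ∈-between : ∀ {d} → suc q ≤ d → d ≤ p → d ∈ map diag R
    ∈-between {d} lo hi = path-diag (proj₁ tail) (conn t h (proj₁ tail) (proj₁ head)) (subst (_≤ d) (sym dt) lo) hi

  -- Connectedness yields every diagonal value between tail and head, and distinctness yields each
  -- of them once, so the values form an interval with as many elements as R.
  head-diag : q + length R ≡ p
  head-diag = trans (cong (q +_) len) (m+[n∸m]≡n (<⇒≤ q<p))
    where
    u : Unique (applyUpTo interval (p ∸ q))
    u = Unique.applyUpTo⁺₁ interval (p ∸ q) λ i<j _ eq → <⇒≢ i<j (+-cancelˡ-≡ (suc q) _ _ eq)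
    to : ∀ {d} → d ∈ map diag R → d ∈ applyUpTo interval (p ∸ q)
    to {d} d∈ = subst (_∈ applyUpTo interval (p ∸ q)) (m+[n∸m]≡n (∈-lower d∈))
      (∈-applyUpTo⁺ interval (+-cancelˡ-< q _ _ (subst₂ _<_ refl (sym (m+[n∸m]≡n (<⇒≤ q<p)))
        (≤-trans (≤-reflexive (m+[n∸m]≡n (∈-lower d∈))) (∈-upper d∈)))))
    from : ∀ {d} → d ∈ applyUpTo interval (p ∸ q) → d ∈ map diag R
    from d∈ with ∈-applyUpTo⁻ interval d∈
    ... | i , i< , refl = ∈-between (m≤m+n (suc q) i)
      (≤-trans (≤-reflexive (sym (+-suc q i))) (≤-trans (+-monoʳ-≤ q i<) (≤-reflexive (m+[n∸m]≡n (<⇒≤ q<p)))))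
    len : length R ≡ p ∸ q
    len = trans (sym (length-map diag R))
      (trans (unique-length uniq u to from) (length-applyUpTo interval (p ∸ q)))

  mult-diag : ∀ e → mult (map diag R) (suc e) + ⟦ suc e ≤ q ⟧ ≡ ⟦ suc e ≤ p ⟧
  mult-diag e with suc e ≤? q | suc e ≤? p
  ... | yes e<q | _ = trans (cong₂ _+_ (mult-∉ {map diag R} (λ d∈ → <-irrefl refl (≤-trans (∈-lower d∈) e<q))) (⟦≤⟧-yes e<q))
                        (sym (⟦≤⟧-yes (≤-trans e<q (<⇒≤ q<p))))
  ... | no e≮q | yes e<p = trans (cong₂ _+_ (unique-mult uniq (∈-between (≰⇒> e≮q) e<p)) (⟦≤⟧-no (≰⇒> e≮q)))
                             (sym (⟦≤⟧-yes e<p))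
  ... | no e≮q | no e≮p  = trans (cong₂ _+_ (mult-∉ {map diag R} (λ d∈ → e≮p (∈-upper d∈))) (⟦≤⟧-no (≰⇒> e≮q)))
                             (sym (⟦≤⟧-no (≰⇒> e≮p)))

-- Ribbon removals as moves on parts

min-diag : ∀ R → R ≢ [] → ∃[ t ] IsTail R t
min-diag []           R≢ = contradiction refl R≢
min-diag (x ∷ [])     _  = x , here refl , λ { _ (here refl) → ≤-refl }
min-diag (x ∷ y ∷ R)  _  with min-diag (y ∷ R) (λ ())
... | t , t∈ , tmin with ≤-total (diag x) (diag t)
... | inj₁ x≤t = x , here refl , λ { _ (here refl) → ≤-refl ; z (there z∈) → ≤-trans x≤t (tmin z z∈) }
... | inj₂ t≤x = t , there t∈ , λ { _ (here refl) → t≤x ; z (there z∈) → tmin z z∈ }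

max-diag : ∀ R → R ≢ [] → ∃[ h ] IsHead R h
max-diag []           R≢ = contradiction refl R≢
max-diag (x ∷ [])     _  = x , here refl , λ { _ (here refl) → ≤-refl }
max-diag (x ∷ y ∷ R)  _  with max-diag (y ∷ R) (λ ())
... | h , h∈ , hmax with ≤-total (diag x) (diag h)
... | inj₁ x≤h = h , there h∈ , λ { _ (here refl) → x≤h ; z (there z∈) → hmax z z∈ }
... | inj₂ h≤x = x , here refl , λ { _ (here refl) → ≤-refl ; z (there z∈) → ≤-trans (hmax z z∈) h≤x }

-- The moves on the set of parts that correspond to removing a k-ribbon with
-- head on the diagonal p; a part q = 0 stands for no part.
data Step (k : ℕ) (nu mu : List ℕ) (p : ℕ) : Set where
  slide : ∀ q → p ≡ q + k →
          (∀ d → mult nu (suc d) + ⟦ suc d ≡ q ⟧ ≡ mult mu (suc d) + ⟦ suc d ≡ p ⟧) →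
          Step k nu mu p
  annihilate : ∀ q → 1 ≤ q → q < p → q + p ≡ k →
          (∀ d → mult nu (suc d) ≡ mult mu (suc d) + (⟦ suc d ≡ q ⟧ + ⟦ suc d ≡ p ⟧)) →
          Step k nu mu p

atLeast-end : ∀ la → ∃[ B ] ∀ e → B ≤ e → atLeast la e ≡ 0
atLeast-end la with bound la
... | B , ps = B , λ e B≤e → atLeast-above (All.map (λ p → ≤-trans p B≤e) ps)

atLeast+-split : ∀ la p d → atLeast la d + ⟦ d ≤ p ⟧ ≡
                 (mult la d + ⟦ d ≡ p ⟧) + (atLeast la (suc d) + ⟦ suc d ≤ p ⟧)
atLeast+-split la p d = trans (cong₂ _+_ (atLeast-split la d) (⟦≤⟧-split d p))
  (+-interchange (mult la d) _ ⟦ d ≡ p ⟧ _)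

atLeast++-split : ∀ la q p d → atLeast la d + (⟦ d ≤ q ⟧ + ⟦ d ≤ p ⟧) ≡
  (mult la d + (⟦ d ≡ q ⟧ + ⟦ d ≡ p ⟧)) + (atLeast la (suc d) + (⟦ suc d ≤ q ⟧ + ⟦ suc d ≤ p ⟧))
atLeast++-split la q p d = trans
  (cong₂ _+_ (atLeast-split la d)
    (trans (cong₂ _+_ (⟦≤⟧-split d q) (⟦≤⟧-split d p)) (+-interchange ⟦ d ≡ q ⟧ _ ⟦ d ≡ p ⟧ _)))
  (+-interchange (mult la d) _ (⟦ d ≡ q ⟧ + ⟦ d ≡ p ⟧) _)

-- Passes from parts to diagonals by summing from above; `lowers⁻¹` takes differences of consecutive
-- equations.
lowers : ∀ {nu mu q p} → (∀ d → mult nu (suc d) + ⟦ suc d ≡ q ⟧ ≡ mult mu (suc d) + ⟦ suc d ≡ p ⟧) →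
         Lowers nu mu q p
lowers {nu} {mu} {q} {p} eq = downward _ _
  (λ e → mult nu (suc e) + ⟦ suc e ≡ q ⟧) (λ e → mult mu (suc e) + ⟦ suc e ≡ p ⟧)
  (proj₁ (atLeast-end nu) + (proj₁ (atLeast-end mu) + (suc q + suc p)))
  end
  (λ e → atLeast+-split nu q (suc e))
  (λ e → atLeast+-split mu p (suc e))
  eq
  where
  Bn = proj₁ (atLeast-end nu)
  Bm = proj₁ (atLeast-end mu)
  end : ∀ e → Bn + (Bm + (suc q + suc p)) ≤ e →
        atLeast nu (suc e) + ⟦ suc e ≤ q ⟧ ≡ atLeast mu (suc e) + ⟦ suc e ≤ p ⟧
  end e B≤e = trans
    (cong₂ _+_ (proj₂ (atLeast-end nu) (suc e) (m≤n⇒m≤1+n (m+n≤o⇒m≤o Bn B≤e)))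
               (⟦≤⟧-no (m≤n⇒m≤1+n (m+n≤o⇒m≤o (suc q) B₂))))
    (sym (cong₂ _+_ (proj₂ (atLeast-end mu) (suc e) (m≤n⇒m≤1+n (m+n≤o⇒m≤o Bm B₁)))
               (⟦≤⟧-no (m≤n⇒m≤1+n (m+n≤o⇒n≤o (suc q) B₂)))))
    where
    B₁ = m+n≤o⇒n≤o Bn B≤e
    B₂ = m+n≤o⇒n≤o Bm B₁

lowers⁻¹ : ∀ {nu mu q p} → Lowers nu mu q p →
           ∀ d → mult nu (suc d) + ⟦ suc d ≡ q ⟧ ≡ mult mu (suc d) + ⟦ suc d ≡ p ⟧
lowers⁻¹ {nu} {mu} {q} {p} lw d = +-cancelʳ-≡ _ _ _ (begin
  (mult nu (suc d) + ⟦ suc d ≡ q ⟧) + (atLeast nu (suc (suc d)) + ⟦ suc (suc d) ≤ q ⟧)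
    ≡⟨ atLeast+-split nu q (suc d) ⟨
  atLeast nu (suc d) + ⟦ suc d ≤ q ⟧
    ≡⟨ lw d ⟩
  atLeast mu (suc d) + ⟦ suc d ≤ p ⟧
    ≡⟨ atLeast+-split mu p (suc d) ⟩
  (mult mu (suc d) + ⟦ suc d ≡ p ⟧) + (atLeast mu (suc (suc d)) + ⟦ suc (suc d) ≤ p ⟧)
    ≡⟨ cong ((mult mu (suc d) + ⟦ suc d ≡ p ⟧) +_) (lw (suc d)) ⟨
  (mult mu (suc d) + ⟦ suc d ≡ p ⟧) + (atLeast nu (suc (suc d)) + ⟦ suc (suc d) ≤ q ⟧) ∎)
  where open ≡-Reasoning

lowers₂⁻¹ : ∀ {nu mu q p} →
  (∀ e → atLeast nu (suc e) ≡ atLeast mu (suc e) + (⟦ suc e ≤ q ⟧ + ⟦ suc e ≤ p ⟧)) →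
  ∀ d → mult nu (suc d) ≡ mult mu (suc d) + (⟦ suc d ≡ q ⟧ + ⟦ suc d ≡ p ⟧)
lowers₂⁻¹ {nu} {mu} {q} {p} lw d = +-cancelʳ-≡ _ _ _ (begin
  mult nu (suc d) + atLeast nu (suc (suc d))
    ≡⟨ atLeast-split nu (suc d) ⟨
  atLeast nu (suc d)
    ≡⟨ lw d ⟩
  atLeast mu (suc d) + (⟦ suc d ≤ q ⟧ + ⟦ suc d ≤ p ⟧)
    ≡⟨ atLeast++-split mu q p (suc d) ⟩
  (mult mu (suc d) + (⟦ suc d ≡ q ⟧ + ⟦ suc d ≡ p ⟧)) +
  (atLeast mu (suc (suc d)) + (⟦ suc (suc d) ≤ q ⟧ + ⟦ suc (suc d) ≤ p ⟧))
    ≡⟨ cong (_ +_) (lw (suc d)) ⟨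
  (mult mu (suc d) + (⟦ suc d ≡ q ⟧ + ⟦ suc d ≡ p ⟧)) + atLeast nu (suc (suc d)) ∎)
  where open ≡-Reasoning

diag-pos : ∀ {la} → Strict la → ∀ {x} → x ∈S la → ∃[ q ] diag x ≡ suc q
diag-pos st {c , r} x∈ with ∈S⇒ st x∈
... | e , refl , _ , _ = e , diag-row r e

nonempty-length : ∀ {A : Set} {xs : List A} → xs ≢ [] → 1 ≤ length xs
nonempty-length {xs = []}    xs≢[] = contradiction refl xs≢[]
nonempty-length {xs = _ ∷ _} _     = s≤s z≤n

-- If q were p, this part would occur twice in nu. This sharpens |S| ≤ |R| to q < p for double
-- ribbons.
mult-pair-distinct : ∀ {nu mu q p} → Strict nu → 1 ≤ q →
  (∀ d → mult nu (suc d) ≡ mult mu (suc d) + (⟦ suc d ≡ q ⟧ + ⟦ suc d ≡ p ⟧)) → q ≢ p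
mult-pair-distinct {nu} {mu} {suc q} st-nu _ eq refl =
  contradiction (≤-trans (≤-reflexive (sym (cong₂ _+_ (⟦≡⟧-yes q) (⟦≡⟧-yes q)))) (≤-trans (m≤n+m _ (mult mu (suc q)))
    (≤-trans (≤-reflexive (sym (eq q))) (mult≤1 st-nu (suc q))))) λ { (s≤s ()) }

-- A single ribbon with tail on diagonal q + 1 takes one cell from each of the diagonals q + 1, ...,
-- p. In a double ribbon both tails lie on the main diagonal, so the lengths of the two ribbons are
-- their head diagonals, and they become the deleted parts q = |S| and p = |R|.
ribbon⇒step : ∀ {k nu mu h} → Strict nu → Strict mu → mu ⊆S nu →
              KRibbonHead k nu (SkewCell nu mu) h → Step k nu mu (diag h)
ribbon⇒step {k} {nu} {mu} {h} st-nu st-mu mu⊆nu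
  (inj₁ (R , (R≢[] , conn , uniq , _) , R⇔ , len , hd)) with min-diag R R≢[]
... | t , tl with diag-pos st-nu (proj₁ (Equivalence.to (R⇔ t) (proj₁ tl)))
... | q , dt = slide q (trans (sym (head-diag conn uniq tl hd dt)) (cong (q +_) len)) (lowers⁻¹ {nu} {mu} {q} {diag h} lw)
  where
  lw : Lowers nu mu q (diag h)
  lw e = begin
    atLeast nu (suc e) + ⟦ suc e ≤ q ⟧
      ≡⟨ cong (_+ ⟦ suc e ≤ q ⟧) (count-diag st-nu st-mu mu⊆nu (Unique.map⁻ uniq)
           (λ x → Equivalence.to (R⇔ x)) (λ x → Equivalence.from (R⇔ x)) e) ⟩
    (mult (map diag R) (suc e) + atLeast mu (suc e)) + ⟦ suc e ≤ q ⟧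
      ≡⟨ cong (_+ ⟦ suc e ≤ q ⟧) (+-comm (mult (map diag R) (suc e)) _) ⟩
    (atLeast mu (suc e) + mult (map diag R) (suc e)) + ⟦ suc e ≤ q ⟧
      ≡⟨ +-assoc (atLeast mu (suc e)) _ _ ⟩
    atLeast mu (suc e) + (mult (map diag R) (suc e) + ⟦ suc e ≤ q ⟧)
      ≡⟨ cong (atLeast mu (suc e) +_) (mult-diag conn uniq tl hd dt e) ⟩
    atLeast mu (suc e) + ⟦ suc e ≤ diag h ⟧ ∎
    where open ≡-Reasoning
ribbon⇒step {k} {nu} {mu} {h} st-nu st-mu mu⊆nu
  (inj₂ (R , S , ((_ , connR , uniqR , _) , (S≢[] , connS , uniqS , _) , _ , _ , disj , S≤R ,
                  (tR , tlR , _ , dtR) , (tS , tlS , _ , _ , dtS) , _) , RS⇔ , len , hdR))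
  with max-diag S S≢[]
... | hS , hdS = annihilate (length S) 1≤q (≤∧≢⇒< q≤p q≢p)
                   (trans (+-comm (length S) _) (trans (cong (_+ length S) (sym lenR)) len)) eq
  where
  lenR : length R ≡ diag h
  lenR = head-diag connR uniqR tlR hdR dtR
  lenS : length S ≡ diag hS
  lenS = head-diag connS uniqS tlS hdS dtS
  q≤p : length S ≤ diag h
  q≤p = ≤-trans S≤R (≤-reflexive lenR)
  1≤q : 1 ≤ length S
  1≤q = nonempty-length S≢[]
  uniq : Unique (R ++ S)
  uniq = Unique.++⁺ (Unique.map⁻ uniqR) (Unique.map⁻ uniqS) (λ {x} (x∈R , x∈S) → disj x x∈R x∈S)
  lw : ∀ e → atLeast nu (suc e) ≡ atLeast mu (suc e) + (⟦ suc e ≤ length S ⟧ + ⟦ suc e ≤ diag h ⟧)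
  lw e = begin
    atLeast nu (suc e)
      ≡⟨ count-diag st-nu st-mu mu⊆nu uniq
           (λ x x∈ → Equivalence.to (RS⇔ x) (∈-++⁻ R x∈))
           (λ x x∈ → [ ∈-++⁺ˡ , ∈-++⁺ʳ R ]′ (Equivalence.from (RS⇔ x) x∈)) e ⟩
    mult (map diag (R ++ S)) (suc e) + atLeast mu (suc e)
      ≡⟨ +-comm _ (atLeast mu (suc e)) ⟩
    atLeast mu (suc e) + mult (map diag (R ++ S)) (suc e)
      ≡⟨ cong (λ l → atLeast mu (suc e) + mult l (suc e)) (map-++ diag R S) ⟩
    atLeast mu (suc e) + mult (map diag R ++ map diag S) (suc e)
      ≡⟨ cong (atLeast mu (suc e) +_) (trans (mult-++ (map diag R) _ (suc e)) (+-comm (mult (map diag R) (suc e)) _)) ⟩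
    atLeast mu (suc e) + (mult (map diag S) (suc e) + mult (map diag R) (suc e))
      ≡⟨ cong (atLeast mu (suc e) +_) (cong₂ _+_
           (trans (sym (+-identityʳ _)) (trans (mult-diag connS uniqS tlS hdS dtS e) (cong (λ p → ⟦ suc e ≤ p ⟧) (sym lenS))))
           (trans (sym (+-identityʳ _)) (mult-diag connR uniqR tlR hdR dtR e))) ⟩
    atLeast mu (suc e) + (⟦ suc e ≤ length S ⟧ + ⟦ suc e ≤ diag h ⟧) ∎
    where open ≡-Reasoning
  eq : ∀ d → mult nu (suc d) ≡ mult mu (suc d) + (⟦ suc d ≡ length S ⟧ + ⟦ suc d ≡ diag h ⟧)
  eq = lowers₂⁻¹ {nu} {mu} {length S} {diag h} lw
  q≢p : length S ≢ diag h
  q≢p = mult-pair-distinct {nu} {mu} {length S} {diag h} st-nu 1≤q eq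

without : ∀ {nu} → Strict nu → ∀ {p} → 1 ≤ mult nu p →
          ∃[ la ] Strict la × ∀ d → mult nu (suc d) ≡ mult la (suc d) + ⟦ suc d ≡ p ⟧
without {nu} st {p} p∈ with bound nu
... | B , ps with realise (λ d → mult nu d ∸ ⟦ d ≡ p ⟧) B
                  (λ d → ≤-trans (m∸n≤m _ ⟦ d ≡ p ⟧) (mult≤1 st d))
                  (λ d B<d → trans (cong (_∸ ⟦ d ≡ p ⟧) (mult-above (All.map (λ q → <-trans q B<d) ps))) (0∸n≡0 ⟦ d ≡ p ⟧))
... | la , st-la , eq = la , st-la , λ d → sym (trans (cong (_+ ⟦ suc d ≡ p ⟧) (eq d)) (m∸n+n≡m (le (suc d))))
  where
  le : ∀ d → ⟦ d ≡ p ⟧ ≤ mult nu d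
  le d with d ≟ p
  ... | yes refl = ≤-trans (≤-reflexive (⟦≡⟧-yes d)) p∈
  ... | no d≢p   = ≤-trans (≤-reflexive (⟦≡⟧-no d≢p)) z≤n

step⇒ribbon : ∀ {k nu mu p} → 1 ≤ k → Strict nu → Strict mu → Step k nu mu p → RemovableKRibbon k nu mu
step⇒ribbon {suc k} {nu} {mu} 1≤k st-nu st-mu (slide q refl eq) =
  st-mu , ⊆S-lowers , _ ,
  inj₁ (ribbon , single , (λ x → mk⇔ (ribbon⇒skew x) (skew⇒ribbon x)) , length-ribbon , head)
  where open Ribbon {nu} {mu} st-nu st-mu {q} {k} (lowers {nu} {mu} {q} {q + suc k} eq)
-- The two parts are lowered to 0 one after the other: first p, which leads from nu to la and gives
-- R, then q, which leads from la to mu and gives S.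
step⇒ribbon {k} {nu} {mu} {suc p} 1≤k st-nu st-mu (annihilate (suc q) _ q<p q+p≡k eq)
  with without st-nu {suc p} (subst (1 ≤_) (sym (eq p))
         (≤-trans (≤-reflexive (sym (⟦≡⟧-yes p))) (≤-trans (m≤n+m _ ⟦ p ≡ q ⟧) (m≤n+m _ (mult mu (suc p))))))
... | la , st-la , eq₁ = st-mu , (λ x x∈ → R.⊆S-lowers x (S.⊆S-lowers x x∈)) , _ ,
  inj₂ (R.ribbon , S.ribbon ,
    ( R.single , S.single , R⊆ , S⊆
    , (λ x x∈R x∈S → proj₂ (R.ribbon⇒skew x x∈R) (proj₁ (S.ribbon⇒skew x x∈S)))
    , subst₂ _≤_ (sym S.length-ribbon) (sym R.length-ribbon) (<⇒≤ q<p)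
    , (_ , R.tail , R⊆ _ R.tail∈ , R.diag-tail)
    , (_ , S.tail , S⊆ _ S.tail∈
          , (λ x∈R → proj₂ (R.ribbon⇒skew _ x∈R) (proj₁ (S.ribbon⇒skew _ S.tail∈))) , S.diag-tail)
    , nu , mu , st-nu , st-mu , (λ x x∈ → R.⊆S-lowers x (S.⊆S-lowers x x∈)) , cover)
  , cover , trans (cong₂ _+_ R.length-ribbon S.length-ribbon) (trans (+-comm (suc p) (suc q)) q+p≡k) , R.head)
  where
  zero-part : ∀ d → mult nu (suc d) + ⟦ suc d ≡ 0 ⟧ ≡ mult la (suc d) + ⟦ suc d ≡ suc p ⟧
  zero-part d = trans (+-identityʳ _) (eq₁ d)
  eq₂ : ∀ d → mult la (suc d) + ⟦ suc d ≡ 0 ⟧ ≡ mult mu (suc d) + ⟦ suc d ≡ suc q ⟧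
  eq₂ d = trans (+-identityʳ _) (+-cancelʳ-≡ ⟦ suc d ≡ suc p ⟧ _ _
    (trans (sym (eq₁ d)) (trans (eq d) (sym (+-assoc (mult mu (suc d)) _ _)))))
  module R = Ribbon {nu} {la} st-nu st-la {0} {p} (lowers {nu} {la} {0} {suc p} zero-part)
  module S = Ribbon {la} {mu} st-la st-mu {0} {q} (lowers {la} {mu} {0} {suc q} eq₂)
  R⊆ : ∀ x → x ∈ R.ribbon → x ∈S nu
  R⊆ x x∈ = proj₁ (R.ribbon⇒skew x x∈)
  S⊆ : ∀ x → x ∈ S.ribbon → x ∈S nu
  S⊆ x x∈ = R.⊆S-lowers x (proj₁ (S.ribbon⇒skew x x∈))
  ∈S? : ∀ x → Dec (x ∈S la)
  ∈S? (c , r) with 1 ≤? r | r ≤? c | c <? r + part la r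
  ... | yes a | yes b | yes c′ = yes (a , b , c′)
  ... | no a  | _     | _      = no (λ z → a (proj₁ z))
  ... | _     | no b  | _      = no (λ z → b (proj₁ (proj₂ z)))
  ... | _     | _     | no c′  = no (λ z → c′ (proj₂ (proj₂ z)))
  cover : ∀ x → (x ∈ R.ribbon ⊎ x ∈ S.ribbon) ⇔ SkewCell nu mu x
  cover x = mk⇔ to from
    where
    to : x ∈ R.ribbon ⊎ x ∈ S.ribbon → SkewCell nu mu x
    to (inj₁ x∈) = R⊆ x x∈ , λ x∈mu → proj₂ (R.ribbon⇒skew x x∈) (S.⊆S-lowers x x∈mu)
    to (inj₂ x∈) = S⊆ x x∈ , proj₂ (S.ribbon⇒skew x x∈)
    from : SkewCell nu mu x → x ∈ R.ribbon ⊎ x ∈ S.ribbon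
    -- Membership in the intermediate shape decides which ribbon contains the cell.
    from (x∈nu , x∉mu) with ∈S? x
    ... | yes x∈la = inj₂ (S.skew⇒ribbon x (x∈la , x∉mu))
    ... | no  x∉la = inj₁ (R.skew⇒ribbon x (x∈nu , x∉la))

-- The abacus

⟦≡⟧-cong : ∀ {a b c d} → (a ≡ b → c ≡ d) → (c ≡ d → a ≡ b) → ⟦ a ≡ b ⟧ ≡ ⟦ c ≡ d ⟧
⟦≡⟧-cong {a} {b} {c} {d} to from with a ≟ b
... | yes refl with to refl
...   | refl = trans (⟦≡⟧-yes a) (sym (⟦≡⟧-yes c))
⟦≡⟧-cong {a} {b} {c} {d} to from | no a≢b =
  trans (⟦≡⟧-no a≢b) (sym (⟦≡⟧-no (λ e → a≢b (from e))))

module Abacus (k : ℕ) .{{_ : NonZero k}} where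

  -- Residues run through 1, ..., k, with k in the place of 0, as the abacus demands; dividing p - 1
  -- instead of p achieves this.
  digits : ∀ p → 1 ≤ p → ∃[ i ] ∃[ e ] 1 ≤ i × i ≤ k × p ≡ i + e * k
  digits (suc p) _ = suc (p % k) , p / k , s≤s z≤n , m%n<n p k , cong suc (m≡m%n+[m/n]*n p k)

  digits-unique : ∀ {i e i′ e′} → 1 ≤ i → i ≤ k → 1 ≤ i′ → i′ ≤ k →
                  i + e * k ≡ i′ + e′ * k → i ≡ i′ × e ≡ e′
  digits-unique {suc i} {e} {suc i′} {e′} _ i<k _ i′<k eq with
    (begin i ≡⟨ m<n⇒m%n≡m i<k ⟨ i % k ≡⟨ [m+kn]%n≡m%n i e k ⟨ (i + e * k) % k
       ≡⟨ cong (_% k) (suc-injective eq) ⟩ (i′ + e′ * k) % k ≡⟨ [m+kn]%n≡m%n i′ e′ k ⟩ i′ % k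
       ≡⟨ m<n⇒m%n≡m i′<k ⟩ i′ ∎)
    where open ≡-Reasoning
  ... | refl = refl , *-cancelʳ-≡ e e′ k (+-cancelˡ-≡ (suc i) _ _ eq)

  residue-unique : ∀ {i i′} → 1 ≤ i → i ≤ k → 1 ≤ i′ → i′ ≤ k → i % k ≡ i′ % k → i ≡ i′
  residue-unique {i} {i′} 1≤i i≤k 1≤i′ i′≤k eq with m≤n⇒m<n∨m≡n i≤k | m≤n⇒m<n∨m≡n i′≤k
  ... | inj₁ i<k  | inj₁ i′<k = trans (sym (m<n⇒m%n≡m i<k)) (trans eq (m<n⇒m%n≡m i′<k))
  ... | inj₂ refl | inj₂ refl = refl
  ... | inj₁ i<k  | inj₂ refl = contradiction
    (subst (1 ≤_) (trans (sym (m<n⇒m%n≡m i<k)) (trans eq (n%n≡0 k))) 1≤i) λ ()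
  ... | inj₂ refl | inj₁ i′<k = contradiction
    (subst (1 ≤_) (trans (sym (m<n⇒m%n≡m i′<k)) (trans (sym eq) (n%n≡0 k))) 1≤i′) λ ()

  abacus-∷ : ∀ {i x} xs → 1 ≤ i → i ≤ k → 1 ≤ x →
    (∃[ e ] x ≡ i + e * k × abacus k i (x ∷ xs) ≡ suc e ∷ abacus k i xs) ⊎
    ((∀ e → x ≢ i + e * k) × abacus k i (x ∷ xs) ≡ abacus k i xs)
  abacus-∷ {i} {x} xs 1≤i i≤k 1≤x with digits x 1≤x
  ... | i₀ , e , 1≤i₀ , i₀≤k , refl with i₀ ≟ i
  ... | yes refl = inj₁ (e , refl , trans
          (cong (map _) (filter-accept (λ p → p % k ≟ i % k) {i + e * k} {xs} ([m+kn]%n≡m%n i e k)))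
          (cong (_∷ abacus k i xs) (trans (+-comm _ 1) (cong suc (trans (cong (_/ k) (m+n∸m≡n i (e * k))) (m*n/n≡m e k))))))
  ... | no i₀≢i  = inj₂ ((λ e′ eq → i₀≢i (proj₁ (digits-unique {i₀} {e} {i} {e′} 1≤i₀ i₀≤k 1≤i i≤k eq))) ,
          cong (map _) (filter-reject (λ p → p % k ≟ i % k) {i₀ + e * k} {xs}
            (λ eq → i₀≢i (residue-unique 1≤i₀ i₀≤k 1≤i i≤k (trans (sym ([m+kn]%n≡m%n i₀ e k)) eq)))))

  module _ {i : ℕ} (1≤i : 1 ≤ i) (i≤k : i ≤ k) where

    -- The part e + 1 on runner i stands for the position i + e * k of the abacus.
    mult-abacus : ∀ {la} → All (0 <_) la → ∀ e → mult (abacus k i la) (suc e) ≡ mult la (i + e * k)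
    mult-abacus {[]}     []          e = refl
    mult-abacus {x ∷ xs} (0<x ∷ pos) e with abacus-∷ xs 1≤i i≤k 0<x
    ... | inj₁ (e₀ , refl , eq) rewrite eq = cong₂ _+_
          (⟦≡⟧-cong (λ e≡ → cong (λ z → i + z * k) (suc-injective e≡))
                    (λ ≡e → cong suc (*-cancelʳ-≡ e e₀ k (+-cancelˡ-≡ i _ _ ≡e))))
          (mult-abacus pos e)
    ... | inj₂ (x≢ , eq) rewrite eq = trans (mult-abacus pos e)
          (cong (_+ mult xs (i + e * k)) (sym (⟦≡⟧-no (λ ≡x → x≢ e (sym ≡x)))))

    abacus-< : ∀ {xs e} → All (0 <_) xs → All (_< i + e * k) xs → All (_< suc e) (abacus k i xs)
    abacus-< {[]}     []          []         = []
    abacus-< {x ∷ xs} {e} (0<x ∷ pos) (x< ∷ xs<) with abacus-∷ xs 1≤i i≤k 0<x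
    ... | inj₁ (e₀ , refl , eq) rewrite eq = s≤s (*-cancelʳ-< k e₀ e (+-cancelˡ-< i _ _ x<)) ∷ abacus-< pos xs<
    ... | inj₂ (_ , eq)         rewrite eq = abacus-< pos xs<

    abacus-strict : ∀ {la} → Strict la → Strict (abacus k i la)
    abacus-strict {[]}     st = strict-[]
    abacus-strict {x ∷ xs} st@(_ , 0<x ∷ pos) with abacus-∷ xs 1≤i i≤k 0<x
    ... | inj₁ (e , refl , eq) rewrite eq =
            strict-∷ (abacus-< pos (strict-head st)) (s≤s z≤n) (abacus-strict (strict-tail st))
    ... | inj₂ (_ , eq)        rewrite eq = abacus-strict (strict-tail st)

    abacus-ext : ∀ {nu mu} → Strict nu → Strict mu → (∀ e → mult nu (i + e * k) ≡ mult mu (i + e * k)) →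
                 abacus k i nu ≡ abacus k i mu
    abacus-ext st-nu st-mu eq = strict-ext (abacus-strict st-nu) (abacus-strict st-mu)
      (λ e → trans (mult-abacus (proj₂ st-nu) e) (trans (eq e) (sym (mult-abacus (proj₂ st-mu) e))))

  -- Exactly one cell is lost, on diagonal e + 1: the part e + 1 becomes e, or the part 1 is deleted
  -- when e is 0.
  Falls : List ℕ → List ℕ → ℕ → Set
  Falls al al′ e = ∀ d → atLeast al (suc d) ≡ atLeast al′ (suc d) + ⟦ d ≡ e ⟧

  lowers⇒falls : ∀ {al al′ e} → Lowers al al′ e (suc e) → Falls al al′ e
  lowers⇒falls {al} {al′} {e} lw d = +-cancelʳ-≡ ⟦ suc d ≤ e ⟧ _ _
    (trans (lw d) (trans (cong (atLeast al′ (suc d) +_) (⟦≤⟧-split d e)) (sym (+-assoc (atLeast al′ (suc d)) _ _))))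

  -- The condition `1 ≤ e ⊎ i ≡ k` records that a slide deletes no part on a runner i < k, since p =
  -- i would have to be q + k. The number of rows there changes only in `two`, on two runners at
  -- once.
  data Effect (nu mu : List ℕ) (p : ℕ) : Set where
    one : ∀ i e → 1 ≤ i → i ≤ k → p ≡ i + e * k → 1 ≤ e ⊎ i ≡ k →
          Falls (abacus k i nu) (abacus k i mu) e →
          (∀ i′ → 1 ≤ i′ → i′ ≤ k → i′ ≢ i → abacus k i′ nu ≡ abacus k i′ mu) →
          Effect nu mu p
    two : ∀ i i′ → 1 ≤ i → i < i′ → i + i′ ≡ k → p ≡ i′ →
          Falls (abacus k i nu) (abacus k i mu) 0 →
          Falls (abacus k i′ nu) (abacus k i′ mu) 0 →
          (∀ i″ → 1 ≤ i″ → i″ ≤ k → i″ ≢ i → i″ ≢ i′ → abacus k i″ nu ≡ abacus k i″ mu) →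
          Effect nu mu p

  mult-at : ∀ {w₁ w₂ : ℕ → ℕ} → (∀ d → w₁ (suc d) ≡ w₂ (suc d)) →
            ∀ {i} → 1 ≤ i → ∀ m → w₁ (i + m) ≡ w₂ (i + m)
  mult-at eq {suc i} _ m = eq (i + m)

  misses : ∀ {j i} d e → 1 ≤ j → j ≤ k → 1 ≤ i → i ≤ k → j ≢ i → ⟦ j + d * k ≡ i + e * k ⟧ ≡ 0
  misses d e 1≤j j≤k 1≤i i≤k j≢i =
    ⟦≡⟧-no (λ eq → j≢i (proj₁ (digits-unique {e = d} {e′ = e} 1≤j j≤k 1≤i i≤k eq)))

  misses₀ : ∀ {j i} d → 1 ≤ j → j ≤ k → 1 ≤ i → i ≤ k → j ≢ i → ⟦ j + d * k ≡ i ⟧ ≡ 0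
  misses₀ {j} {i} d 1≤j j≤k 1≤i i≤k j≢i =
    trans (cong (λ z → ⟦ j + d * k ≡ z ⟧) (sym (+-identityʳ i))) (misses d 0 1≤j j≤k 1≤i i≤k j≢i)

  effect : ∀ {nu mu p} → 1 ≤ p → Strict nu → Strict mu → Step k nu mu p → Effect nu mu p
  effect {nu} {mu} {p} 1≤p st-nu st-mu (slide q p≡q+k eq) with digits p 1≤p
  ... | i , e , 1≤i , i≤k , refl = one i e 1≤i i≤k refl (e≥1⊎i≡k e p≡q+k) (lowers⇒falls {α} {α′} lw) others
    where
    α = abacus k i nu
    α′ = abacus k i mu
    e≥1⊎i≡k : ∀ e → i + e * k ≡ q + k → 1 ≤ e ⊎ i ≡ k
    e≥1⊎i≡k zero    eq′ = inj₂ (≤-antisym i≤k (subst (k ≤_) (sym (trans (sym (+-identityʳ i)) eq′)) (m≤n+m k q)))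
    e≥1⊎i≡k (suc e) eq′ = inj₁ (s≤s z≤n)
    at : ∀ {j} → 1 ≤ j → ∀ d → mult nu (j + d * k) + ⟦ j + d * k ≡ q ⟧ ≡ mult mu (j + d * k) + ⟦ j + d * k ≡ i + e * k ⟧
    at 1≤j d = mult-at {λ d → mult nu d + ⟦ d ≡ q ⟧} {λ d → mult mu d + ⟦ d ≡ i + e * k ⟧} eq 1≤j (d * k)
    -- Adding k is one position upwards on the same runner, so if q lies on runner j then so does p;
    -- this excludes every j other than i.
    +k : ∀ {j} d → j + d * k ≡ q → j + suc d * k ≡ i + e * k
    +k {j} d eq′ = trans (cong (j +_) (+-comm k (d * k))) (trans (sym (+-assoc j _ k)) (trans (cong (_+ k) eq′) (sym p≡q+k)))
    -k : ∀ d → suc d ≡ e → i + d * k ≡ q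
    -k d refl = +-cancelʳ-≡ k _ _ (trans (+-assoc i _ k) (trans (cong (i +_) (+-comm (d * k) k)) p≡q+k))
    lw : Lowers α α′ e (suc e)
    lw = lowers {α} {α′} {e} {suc e} λ d → begin
      mult α (suc d) + ⟦ suc d ≡ e ⟧
        ≡⟨ cong₂ _+_ (mult-abacus 1≤i i≤k (proj₂ st-nu) d)
             (⟦≡⟧-cong (-k d) (λ eq′ → proj₂ (digits-unique {e = suc d} {e′ = e} 1≤i i≤k 1≤i i≤k (+k d eq′)))) ⟩
      mult nu (i + d * k) + ⟦ i + d * k ≡ q ⟧
        ≡⟨ at 1≤i d ⟩
      mult mu (i + d * k) + ⟦ i + d * k ≡ i + e * k ⟧
        ≡⟨ cong₂ _+_ (mult-abacus 1≤i i≤k (proj₂ st-mu) d)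
             (⟦≡⟧-cong {d} {e} (cong (λ z → i + z * k)) (λ eq′ → *-cancelʳ-≡ d e k (+-cancelˡ-≡ i _ _ eq′))) ⟨
      mult α′ (suc d) + ⟦ suc d ≡ suc e ⟧ ∎
      where open ≡-Reasoning
    misses-q : ∀ {j} d → 1 ≤ j → j ≤ k → j ≢ i → ⟦ j + d * k ≡ q ⟧ ≡ 0
    misses-q {j} d 1≤j j≤k j≢i =
      ⟦≡⟧-no {j + d * k} {q} (λ eq′ → j≢i (proj₁ (digits-unique {e = suc d} {e′ = e} 1≤j j≤k 1≤i i≤k (+k {j} d eq′))))
    others : ∀ j → 1 ≤ j → j ≤ k → j ≢ i → abacus k j nu ≡ abacus k j mu
    others j 1≤j j≤k j≢i = abacus-ext 1≤j j≤k st-nu st-mu λ d → +-cancelʳ-≡ 0 _ _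
      (trans (cong (mult nu (j + d * k) +_) (sym (misses-q d 1≤j j≤k j≢i)))
      (trans (at 1≤j d)
      (cong (mult mu (j + d * k) +_) (misses d e 1≤j j≤k 1≤i i≤k j≢i))))
  effect {nu} {mu} {p} 1≤p st-nu st-mu (annihilate q 1≤q q<p q+p≡k eq) =
    two q p 1≤q q<p q+p≡k refl
      (falls 1≤q q≤k (λ d → trans (cong₂ _+_ (hit q d) (misses₀ d 1≤q q≤k 1≤p p≤k q≢p)) (+-identityʳ _)))
      (falls 1≤p p≤k (λ d → cong₂ _+_ (misses₀ d 1≤p p≤k 1≤q q≤k (≢-sym q≢p)) (hit p d)))
      (λ j 1≤j j≤k j≢q j≢p → abacus-ext 1≤j j≤k st-nu st-mu λ d → trans (at 1≤j d) (trans
        (cong (mult mu (j + d * k) +_) (cong₂ _+_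
          (misses₀ d 1≤j j≤k 1≤q q≤k j≢q) (misses₀ d 1≤j j≤k 1≤p p≤k j≢p)))
        (+-identityʳ _)))
    where
    q≢p : q ≢ p
    q≢p = <⇒≢ q<p
    q≤k : q ≤ k
    q≤k = subst (q ≤_) q+p≡k (m≤m+n q p)
    p≤k : p ≤ k
    p≤k = subst (p ≤_) q+p≡k (m≤n+m p q)
    at : ∀ {j} → 1 ≤ j → ∀ d → mult nu (j + d * k) ≡ mult mu (j + d * k) + (⟦ j + d * k ≡ q ⟧ + ⟦ j + d * k ≡ p ⟧)
    at 1≤j d = mult-at {mult nu} {λ d → mult mu d + (⟦ d ≡ q ⟧ + ⟦ d ≡ p ⟧)} eq 1≤j (d * k)
    hit : ∀ j d → ⟦ j + d * k ≡ j ⟧ ≡ ⟦ d ≡ 0 ⟧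
    hit j d = ⟦≡⟧-cong (λ eq′ → *-cancelʳ-≡ d 0 k (+-cancelˡ-≡ j _ _ (trans eq′ (sym (+-identityʳ j)))))
                     (λ { refl → +-identityʳ j })
    falls : ∀ {j} → 1 ≤ j → j ≤ k → (∀ d → ⟦ j + d * k ≡ q ⟧ + ⟦ j + d * k ≡ p ⟧ ≡ ⟦ d ≡ 0 ⟧) →
            Falls (abacus k j nu) (abacus k j mu) 0
    falls {j} 1≤j j≤k hits = lowers⇒falls {abacus k j nu} {abacus k j mu}
      (lowers {abacus k j nu} {abacus k j mu} {0} {1} λ d → trans (+-identityʳ _)
        (trans (mult-abacus 1≤j j≤k (proj₂ st-nu) d) (trans (at 1≤j d)
          (cong₂ _+_ (sym (mult-abacus 1≤j j≤k (proj₂ st-mu) d)) (hits d)))))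

-- Shapes of the components

-- The profile of a strict partition: the lengths of consecutive diagonals differ by a multiplicity,
-- which is 0 or 1.
Slow : (ℕ → ℕ) → Set
Slow f = ∀ e → f (suc e) ≤ f e × f e ≤ suc (f (suc e))

slow-sum : ∀ {f} → Slow f → ∀ e → f 0 ≤ f e + e
slow-sum {f} sl zero    = m≤m+n (f 0) 0
slow-sum {f} sl (suc e) = ≤-trans (slow-sum sl e)
  (≤-trans (+-monoˡ-≤ e (proj₂ (sl e))) (≤-reflexive (sym (+-suc (f (suc e)) e))))

slow-anti : ∀ {f} → Slow f → ∀ m e → f (m + e) ≤ f e
slow-anti sl zero    e = ≤-refl
slow-anti sl (suc m) e = ≤-trans (proj₁ (sl (m + e))) (slow-anti sl m e)

slow-drop : ∀ {f} → Slow f → ∀ m e → f e ≤ m + f (m + e)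
slow-drop sl zero    e = ≤-refl
slow-drop {f} sl (suc m) e = ≤-trans (slow-drop sl m e)
  (≤-trans (+-monoʳ-≤ m (proj₂ (sl (m + e)))) (≤-reflexive (+-suc m (f (suc m + e)))))

Region : Set₁
Region = ℕ → ℕ → Set

-- Ambient regions in which the components are order ideals: a combination in the quadrant, a
-- shifted diagram only in the octant v ≤ u.
Quadrant : Region
Quadrant u v = 1 ≤ u × 1 ≤ v

Octant : Region
Octant u v = 1 ≤ v × v ≤ u

-- Coordinates (u , v) = (X + s , Y + t), where s = ℓ(α) - n and t = ℓ(β) - n;
-- f and g count the cells of α and of β on each diagonal.
Half : (ℕ → ℕ) → ℕ → ℕ → Region
Half f s t u v = ∃[ e ] u + e + t ≡ v + s × u ≤ f e

-- In the original coordinates u + e + t ≡ v + s reads X + e ≡ Y, so the transposed α lies weakly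
-- above the line X = Y and β weakly below it. The offset 0 occurs in both halves: it is the glued
-- diagonal.
Folded : (ℕ → ℕ) → (ℕ → ℕ) → ℕ → ℕ → Region
Folded f g s t u v = Quadrant u v × (Half f s t u v ⊎ Half g t s v u)

Shifted : (ℕ → ℕ) → Region
Shifted f u v = 1 ≤ v × ∃[ e ] u ≡ v + e × v ≤ f e

folded-swap : ∀ {f g s t u v} → Folded f g s t u v → Folded g f t s v u
folded-swap ((1≤u , 1≤v) , h) = (1≤v , 1≤u) , swap h

-- A step to the left raises the offset in the half of α, where the diagonal shrinks by at most one,
-- and lowers it in the half of β. The line is crossed only from offset 0 of β; there `bal` enters,
-- which makes the two main diagonals end in the same cell.
folded-left : ∀ {f g s t u v} → Slow f → Slow g → f 0 + t ≡ g 0 + s →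
              1 ≤ u → Folded f g s t (suc u) v → Folded f g s t u v
folded-left {t = t} {u} sf sg bal 1≤u ((_ , 1≤v) , inj₁ (e , eq , le)) =
  (1≤u , 1≤v) , inj₁ (suc e , trans (cong (_+ t) (+-suc u e)) eq , ≤-pred (≤-trans le (proj₂ (sf e))))
folded-left {f} {g} {s} {t} {u} {v} sf sg bal 1≤u ((_ , 1≤v) , inj₂ (zero , eq , le)) =
  (1≤u , 1≤v) , inj₁ (1 , trans (cong (_+ t) (+-comm u 1)) (sym (trans (cong (_+ s) (sym (+-identityʳ v))) eq)) ,
    ≤-pred (≤-trans u<f0 (proj₂ (sf 0))))
  where
  u<f0 : suc u ≤ f 0
  u<f0 = +-cancelʳ-≤ t _ _ (begin
    suc u + t ≡⟨ eq ⟨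
    v + 0 + s ≡⟨ cong (_+ s) (+-identityʳ v) ⟩
    v + s     ≤⟨ +-monoˡ-≤ s le ⟩
    g 0 + s   ≡⟨ bal ⟨
    f 0 + t   ∎)
    where open ≤-Reasoning
folded-left {s = s} {v = v} sf sg bal 1≤u ((_ , 1≤v) , inj₂ (suc e , eq , le)) =
  (1≤u , 1≤v) , inj₂ (e , suc-injective (trans (cong (_+ s) (sym (+-suc v e))) eq) , ≤-trans le (proj₁ (sg e)))

Closed : Region → Region → Set
Closed Amb P = ∀ {u v u′ v′} → P u′ v′ → Amb u v → u ≤ u′ → v ≤ v′ → P u v

folded-closed : ∀ {f g s t} → Slow f → Slow g → f 0 + t ≡ g 0 + s → Closed Quadrant (Folded f g s t)
folded-closed {f} {g} {s} {t} sf sg bal {u} {v} {u′} {v′} p (1≤u , 1≤v) u≤u′ v≤v′ =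
  lefts (u′ ∸ u) (subst (λ x → Folded f g s t x v) (sym (m∸n+n≡m u≤u′))
    (downs (v′ ∸ v) (subst (λ x → Folded f g s t u′ x) (sym (m∸n+n≡m v≤v′)) p)))
  where
  lefts : ∀ m → Folded f g s t (m + u) v → Folded f g s t u v
  lefts zero    p = p
  lefts (suc m) p = lefts m (folded-left sf sg bal (≤-trans 1≤u (m≤n+m u m)) p)
  downs : ∀ m → Folded f g s t u′ (m + v) → Folded f g s t u′ v
  downs zero    p = p
  downs (suc m) p = downs m (folded-swap
    (folded-left sg sf (sym bal) (≤-trans 1≤v (m≤n+m v m)) (folded-swap p)))

-- Towards the main diagonal the lengths can only grow. Going m diagonals outwards they shrink by at
-- most m, while u ≤ u′ forces the row to drop by at least m.
shifted-closed : ∀ {f} → Slow f → Closed Octant (Shifted f)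
shifted-closed {f} sf {u} {v} {u′} {v′} (1≤v′ , e′ , u′≡ , v′≤) (1≤v , v≤u) u≤u′ v≤v′ =
  1≤v , u ∸ v , sym (m+[n∸m]≡n v≤u) , v≤fe
  where
  e = u ∸ v
  v≤fe : v ≤ f e
  v≤fe with ≤-total e e′
  ... | inj₁ e≤e′ = ≤-trans v≤v′ (≤-trans v′≤
        (subst (λ x → f x ≤ f e) (m∸n+n≡m e≤e′) (slow-anti sf (e′ ∸ e) e)))
  ... | inj₂ e′≤e = +-cancelˡ-≤ m _ _ (begin
        m + v       ≤⟨ +-cancelʳ-≤ e′ _ _ m+v+e′≤ ⟩
        v′          ≤⟨ v′≤ ⟩
        f e′        ≤⟨ slow-drop sf m e′ ⟩
        m + f (m + e′) ≡⟨ cong (λ x → m + f x) (m∸n+n≡m e′≤e) ⟩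
        m + f e     ∎)
    where
    open ≤-Reasoning
    m = e ∸ e′
    regroup : ∀ m v e → m + v + e ≡ v + (m + e)
    regroup = solve-∀
    m+v+e′≤ : m + v + e′ ≤ v′ + e′
    m+v+e′≤ = begin
      m + v + e′   ≡⟨ regroup m v e′ ⟩
      v + (m + e′) ≡⟨ cong (v +_) (m∸n+n≡m e′≤e) ⟩
      v + e        ≡⟨ m+[n∸m]≡n v≤u ⟩
      u            ≤⟨ u≤u′ ⟩
      u′           ≡⟨ u′≡ ⟩
      v′ + e′      ∎

half? : ∀ f s t u v → Dec (Half f s t u v)
half? f s t u v = map′ (λ { (e , _ , p) → e , p })
  (λ { (e , eq , le) → e , s≤s (≤-trans (≤-trans (m≤n+m e u) (m≤m+n _ t)) (≤-reflexive eq)) , eq , le })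
  (anyUpTo? (λ e → (u + e + t ≟ v + s) ×-dec (u ≤? f e)) (suc (v + s)))

folded? : ∀ f g s t u v → Dec (Folded f g s t u v)
folded? f g s t u v = ((1 ≤? u) ×-dec (1 ≤? v)) ×-dec (half? f s t u v ⊎-dec half? g t s v u)

shifted? : ∀ f u v → Dec (Shifted f u v)
shifted? f u v = (1 ≤? v) ×-dec map′ (λ { (e , _ , p) → e , p })
  (λ { (e , eq , le) → e , s≤s (≤-trans (m≤n+m e v) (≤-reflexive (sym eq))) , eq , le })
  (anyUpTo? (λ e → (u ≟ v + e) ×-dec (v ≤? f e)) (suc u))

Bounded : Region → Set
Bounded P = ∃[ K ] ∀ {u v} → P u v → u + v ≤ K

half-bound : ∀ {f B} → Slow f → (∀ e → B ≤ e → f e ≡ 0) → ∀ s t {u v} → 1 ≤ u → Half f s t u v →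
             u + v ≤ f 0 + (f 0 + B + t)
half-bound {f} {B} sf end s t {u} {v} 1≤u (e , eq , u≤) = +-mono-≤ u≤f0 (begin
  v         ≤⟨ m≤m+n v s ⟩
  v + s     ≡⟨ eq ⟨
  u + e + t ≤⟨ +-monoˡ-≤ t (+-mono-≤ u≤f0 (<⇒≤ e<B)) ⟩
  f 0 + B + t ∎)
  where
  open ≤-Reasoning
  u≤f0 : u ≤ f 0
  u≤f0 = ≤-trans u≤ (subst (λ x → f x ≤ f 0) (+-identityʳ e) (slow-anti sf e 0))
  e<B : e < B
  e<B = ≰⇒> λ B≤e → contradiction (≤-trans 1≤u (≤-trans u≤ (≤-reflexive (end e B≤e)))) λ ()

folded-bounded : ∀ {f g B C} → Slow f → Slow g → (∀ e → B ≤ e → f e ≡ 0) → (∀ e → C ≤ e → g e ≡ 0) →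
                 ∀ s t → Bounded (Folded f g s t)
folded-bounded {f} {g} {B} {C} sf sg endf endg s t = (f 0 + (f 0 + B + t)) + (g 0 + (g 0 + C + s)) , λ
  { ((1≤u , 1≤v) , inj₁ h) → ≤-trans (half-bound sf endf s t 1≤u h) (m≤m+n _ _)
  ; {u} {v} ((1≤u , 1≤v) , inj₂ h) → ≤-trans (≤-reflexive (+-comm u v))
      (≤-trans (half-bound sg endg t s 1≤v h) (m≤n+m _ (f 0 + (f 0 + B + t)))) }

shifted-bounded : ∀ {f B} → Slow f → (∀ e → B ≤ e → f e ≡ 0) → Bounded (Shifted f)
shifted-bounded {f} {B} sf end = f 0 + (f 0 + B + 0) , λ
  { {u} {v} (1≤v , e , eq , le) → ≤-trans (≤-reflexive (+-comm u v))
      (half-bound sf end 0 0 1≤v (e , trans (+-identityʳ _) (trans (sym eq) (sym (+-identityʳ u))) , le)) }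

-- Removal of a single cell

record Loses (P P′ : Region) (u v : ℕ) : Set where
  field
    had  : P u v
    lost : ¬ P′ u v
    sub  : ∀ {x y} → P′ x y → P x y
    new  : ∀ {x y} → P x y → P′ x y ⊎ (x ≡ u × y ≡ v)

Drop : (ℕ → ℕ) → (ℕ → ℕ) → ℕ → Set
Drop f f′ e = ∀ d → f d ≡ f′ d + ⟦ d ≡ e ⟧

module _ {f f′ : ℕ → ℕ} {e : ℕ} (drop : Drop f f′ e) where

  drop-at : f e ≡ suc (f′ e)
  drop-at = trans (drop e) (trans (cong (f′ e +_) (⟦≡⟧-yes e)) (+-comm _ 1))

  drop-off : ∀ {d} → d ≢ e → f d ≡ f′ d
  drop-off {d} d≢e = trans (drop d) (trans (cong (f′ d +_) (⟦≡⟧-no d≢e)) (+-identityʳ _))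

  drop-≤ : ∀ d → f′ d ≤ f d
  drop-≤ d = subst (f′ d ≤_) (sym (drop d)) (m≤m+n _ _)

  drop-new : ∀ d {u} → u ≤ f d → u ≤ f′ d ⊎ (d ≡ e × u ≡ f e)
  drop-new d u≤ with d ≟ e
  ... | no d≢e = inj₁ (subst (_ ≤_) (drop-off d≢e) u≤)
  ... | yes refl with m≤n⇒m<n∨m≡n u≤
  ...   | inj₁ u<   = inj₁ (≤-pred (subst (_ <_) drop-at u<))
  ...   | inj₂ refl = inj₂ (refl , refl)

  drop-lost : ¬ (f e ≤ f′ e)
  drop-lost le = <-irrefl refl (subst (_≤ f′ e) drop-at le)

half-mono : ∀ {f f′ s t u v} → (∀ e → f′ e ≤ f e) → Half f′ s t u v → Half f s t u v
half-mono le (e , eq , u≤) = e , eq , ≤-trans u≤ (le e)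

-- The lost cell is the last one of diagonal e + 1 in the half of α. What needs an argument is that
-- it lies in the quadrant, that is, outside the deleted columns.
folded-drop : ∀ {f f′ g s t e} → Slow f′ → Drop f f′ (suc e) → s ≤ f 0 →
              ∃[ u ] ∃[ v ] u + suc e + t ≡ v + s × Loses (Folded f g s t) (Folded f′ g s t) u v
folded-drop {f} {f′} {g} {s} {t} {e} sf′ drop s≤f0 = u , v , eq , record
  { had  = (1≤u , 1≤v) , inj₁ (suc e , eq , ≤-refl)
  ; lost = lost
  ; sub  = λ { {x} {y} (q , inj₁ h) → q , inj₁ (half-mono {u = x} {y} (drop-≤ drop) h) ; (q , inj₂ h) → q , inj₂ h }
  ; new  = new }
  where
  u = f (suc e)
  v = (u + suc e + t) ∸ s
  -- Slowness of `f` would give only s ≤ u + suc e and leave v = 0 possible. Since `f′` is one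
  -- shorter on this diagonal and equal to `f` on the main one, its slowness makes the bound strict.
  s<u+e : s < u + suc e
  s<u+e = begin-strict
    s                     ≤⟨ s≤f0 ⟩
    f 0                   ≡⟨ drop-off drop (λ ()) ⟩
    f′ 0                  ≤⟨ slow-sum sf′ e ⟩
    f′ e + e              ≤⟨ +-monoˡ-≤ e (proj₂ (sf′ e)) ⟩
    suc (f′ (suc e)) + e  ≡⟨ cong (_+ e) (drop-at drop) ⟨
    u + e                 <⟨ +-monoʳ-< u (n<1+n e) ⟩
    u + suc e             ∎
    where open ≤-Reasoning
  s<w : s < u + suc e + t
  s<w = ≤-trans s<u+e (m≤m+n _ t)
  eq : u + suc e + t ≡ v + s
  eq = sym (m∸n+n≡m (<⇒≤ s<w))
  1≤u : 1 ≤ u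
  1≤u = subst (1 ≤_) (sym (drop-at drop)) (s≤s z≤n)
  1≤v : 1 ≤ v
  1≤v = m<n⇒0<n∸m s<w
  lost : ¬ Folded f′ g s t u v
  lost (_ , inj₁ (d , eq′ , le)) with +-cancelˡ-≡ u d (suc e) (+-cancelʳ-≡ t _ _ (trans eq′ (sym eq)))
  ... | refl = drop-lost drop le
  -- An offset suc e on one side of the line and an offset d on the other would have to add up to 0.
  lost (_ , inj₂ (d , eq′ , le)) = contradiction (+-cancelˡ-≡ (u + t + (v + s)) (suc e + d) 0 (begin
    u + t + (v + s) + (suc e + d)     ≡⟨ regroup′ u t v s (suc e) d ⟩
    (u + suc e + t) + (v + d + s)     ≡⟨ cong₂ _+_ eq eq′ ⟩
    (v + s) + (u + t)                 ≡⟨ +-comm (v + s) (u + t) ⟩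
    u + t + (v + s)                   ≡⟨ +-identityʳ _ ⟨
    u + t + (v + s) + 0               ∎)) λ ()
    where
    open ≡-Reasoning
    regroup′ : ∀ u t v s e d → u + t + (v + s) + (e + d) ≡ (u + e + t) + (v + d + s)
    regroup′ = solve-∀
  new : ∀ {x y} → Folded f g s t x y → Folded f′ g s t x y ⊎ (x ≡ u × y ≡ v)
  new (q , inj₂ h) = inj₁ (q , inj₂ h)
  new (q , inj₁ (d , eq′ , le)) with drop-new drop d le
  ... | inj₁ le′           = inj₁ (q , inj₁ (d , eq′ , le′))
  ... | inj₂ (refl , refl) = inj₂ (refl , +-cancelʳ-≡ s _ _ (trans (sym eq′) eq))

-- Each partition loses the last cell of its main diagonal; by `bal` gluing makes these one cell,
-- with coordinates (f 0, g 0).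
folded-drop₂ : ∀ {f f′ g g′ s t} → Drop f f′ 0 → Drop g g′ 0 → f 0 + t ≡ g 0 + s →
               Loses (Folded f g s t) (Folded f′ g′ s t) (f 0) (g 0)
folded-drop₂ {f} {f′} {g} {g′} {s} {t} dropf dropg bal = record
  { had  = (positive dropf , positive dropg) , inj₁ (0 , trans (cong (_+ t) (+-identityʳ _)) bal , ≤-refl)
  ; lost = lost
  ; sub  = λ { {x} {y} (q , inj₁ h) → q , inj₁ (half-mono {u = x} {y} (drop-≤ dropf) h)
             ; {x} {y} (q , inj₂ h) → q , inj₂ (half-mono {u = y} {x} (drop-≤ dropg) h) }
  ; new  = new }
  where
  positive : ∀ {f f′} → Drop f f′ 0 → 1 ≤ f 0
  positive drop = subst (1 ≤_) (sym (drop-at drop)) (s≤s z≤n)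
  lost : ¬ Folded f′ g′ s t (f 0) (g 0)
  lost (_ , inj₁ (d , eq , le)) with +-cancelˡ-≡ (f 0) d 0
    (trans (+-cancelʳ-≡ t _ _ (trans eq (sym bal))) (sym (+-identityʳ _)))
  ... | refl = drop-lost dropf le
  lost (_ , inj₂ (d , eq , le)) with +-cancelˡ-≡ (g 0) d 0
    (trans (+-cancelʳ-≡ s _ _ (trans eq bal)) (sym (+-identityʳ _)))
  ... | refl = drop-lost dropg le
  new : ∀ {x y} → Folded f g s t x y → Folded f′ g′ s t x y ⊎ (x ≡ f 0 × y ≡ g 0)
  new {x} {y} (q , inj₁ (d , eq , le)) with drop-new dropf d le
  ... | inj₁ le′           = inj₁ (q , inj₁ (d , eq , le′))
  ... | inj₂ (refl , refl) = inj₂ (refl , +-cancelʳ-≡ s _ _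
        (trans (sym eq) (trans (cong (_+ t) (+-identityʳ _)) bal)))
  new {x} {y} (q , inj₂ (d , eq , le)) with drop-new dropg d le
  ... | inj₁ le′           = inj₁ (q , inj₂ (d , eq , le′))
  ... | inj₂ (refl , refl) = inj₂ (+-cancelʳ-≡ t _ _
        (trans (sym eq) (trans (cong (_+ s) (+-identityʳ _)) (sym bal))) , refl)

loses-swap : ∀ {f f′ g g′ s t u v} → Loses (Folded f g s t) (Folded f′ g′ s t) u v →
             Loses (Folded g f t s) (Folded g′ f′ t s) v u
loses-swap l = record
  { had  = folded-swap had
  ; lost = λ p → lost (folded-swap p)
  ; sub  = λ p → folded-swap (sub (folded-swap p))
  ; new  = λ p → [ (λ q → inj₁ (folded-swap q)) , (λ { (a , b) → inj₂ (b , a) }) ]′ (new (folded-swap p)) }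
  where open Loses l

shifted-drop : ∀ {f f′ e} → Drop f f′ e → Loses (Shifted f) (Shifted f′) (f e + e) (f e)
shifted-drop {f} {f′} {e} drop = record
  { had  = subst (1 ≤_) (sym (drop-at drop)) (s≤s z≤n) , e , refl , ≤-refl
  ; lost = λ { (_ , d , eq , le) → lost d (+-cancelˡ-≡ (f e) e d eq) le }
  ; sub  = λ { (1≤y , d , eq , le) → 1≤y , d , eq , ≤-trans le (drop-≤ drop d) }
  ; new  = new }
  where
  lost : ∀ d → e ≡ d → ¬ (f e ≤ f′ d)
  lost d refl = drop-lost drop
  new : ∀ {x y} → Shifted f x y → Shifted f′ x y ⊎ (x ≡ f e + e × y ≡ f e)
  new (1≤y , d , eq , le) with drop-new drop d le
  ... | inj₁ le′           = inj₁ (1≤y , d , eq , le′)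
  ... | inj₂ (refl , refl) = inj₂ (eq , refl)

-- Corners

Corner : Region → ℕ → ℕ → Set
Corner P u v = P u v × ¬ P (suc u) v × ¬ P u (suc v)

-- Climb right or up as long as possible; u + v grows by one each time and is bounded by K.
corner-exists : ∀ {P} → (∀ u v → Dec (P u v)) → Bounded P → ∀ {u v} → P u v →
                ∃[ u′ ] ∃[ v′ ] Corner P u′ v′
corner-exists {P} P? (K , bnd) {u} {v} p = climb K p (m≤m+n K (u + v))
  where
  climb : ∀ n {u v} → P u v → K ≤ n + (u + v) → ∃[ u′ ] ∃[ v′ ] Corner P u′ v′
  climb n {u} {v} p le with P? (suc u) v | P? u (suc v)
  ... | no ¬r | no ¬u = u , v , p , ¬r , ¬u
  climb zero    {u} {v} p le | yes r | _ = contradiction (≤-trans (bnd r) le) (<-irrefl refl)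
  climb (suc n) {u} {v} p le | yes r | _ = climb n r (≤-trans le (≤-reflexive (sym (+-suc n (u + v)))))
  climb zero    {u} {v} p le | no _ | yes r =
    contradiction (≤-trans (≤-reflexive (sym (+-suc u v))) (≤-trans (bnd r) le)) (<-irrefl refl)
  climb (suc n) {u} {v} p le | no _ | yes r = climb n r
    (≤-trans le (≤-reflexive (sym (trans (cong (n +_) (+-suc u v)) (+-suc n (u + v))))))

-- For f counting the cells of α on each diagonal: e + 1 is, or is not, a part of α.
Bead : (ℕ → ℕ) → ℕ → Set
Bead f e = f (suc e) < f e

Gap : (ℕ → ℕ) → ℕ → Set
Gap f e = f e ≤ f (suc e)

data FoldedCorner (f g : ℕ → ℕ) (s t u v : ℕ) : Set where
  left  : ∀ e → u + suc e + t ≡ v + s → Bead f (suc e) → Gap f e → FoldedCorner f g s t u v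
  right : ∀ e → v + suc e + s ≡ u + t → Bead g (suc e) → Gap g e → FoldedCorner f g s t u v
  main  : u + t ≡ v + s → Bead f 0 → Bead g 0 → FoldedCorner f g s t u v

-- A neighbour missing on the next outer diagonal shows that the lengths drop there (a bead), one
-- missing on the next inner diagonal that they do not (a gap). From the main diagonal both
-- neighbours lie outwards, one in each half, so both partitions have the part 1.
folded-corner : ∀ {f g s t u v} → f 0 + t ≡ g 0 + s → Corner (Folded f g s t) u v → FoldedCorner f g s t u v
folded-corner {f} {g} {s} {t} {u} {v} bal (((1≤u , 1≤v) , h) , ¬right , ¬up) = cases h
  where
  inwards : ∀ u e t {w} → u + suc e + t ≡ w → suc u + e + t ≡ w
  inwards u e t eq = trans (cong (_+ t) (sym (+-suc u e))) eq
  outwards : ∀ u e t {w} → u + e + t ≡ w → u + suc e + t ≡ suc w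
  outwards u e t eq = trans (cong (_+ t) (+-suc u e)) (cong suc eq)
  bead-f : ∀ e → u + e + t ≡ v + s → u ≤ f e → Bead f e
  bead-f e eq u≤ = ≤-trans (≰⇒> λ u≤′ → ¬up ((1≤u , s≤s z≤n) , inj₁ (suc e , outwards u e t eq , u≤′))) u≤
  bead-g : ∀ e → v + e + s ≡ u + t → v ≤ g e → Bead g e
  bead-g e eq v≤ = ≤-trans (≰⇒> λ v≤′ → ¬right ((s≤s z≤n , 1≤v) , inj₂ (suc e , outwards v e s eq , v≤′))) v≤
  diagonal : u + t ≡ v + s → u ≤ f 0 → v ≤ g 0 → FoldedCorner f g s t u v
  diagonal eq u≤ v≤ = main eq (bead-f 0 (trans (cong (_+ t) (+-identityʳ u)) eq) u≤)
                              (bead-g 0 (trans (cong (_+ s) (+-identityʳ v)) (sym eq)) v≤)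
  cases : Half f s t u v ⊎ Half g t s v u → FoldedCorner f g s t u v
  cases (inj₁ (suc e , eq , u≤)) = left e eq (bead-f (suc e) eq u≤)
    (≤-trans (≮⇒≥ λ u<′ → ¬right ((s≤s z≤n , 1≤v) , inj₁ (e , inwards u e t eq , u<′))) u≤)
  cases (inj₂ (suc e , eq , v≤)) = right e eq (bead-g (suc e) eq v≤)
    (≤-trans (≮⇒≥ λ v<′ → ¬up ((1≤u , s≤s z≤n) , inj₂ (e , inwards v e s eq , v<′))) v≤)
  cases (inj₁ (zero , eq , u≤)) = diagonal eq′ u≤
    (+-cancelʳ-≤ s _ _ (subst₂ _≤_ eq′ bal (+-monoˡ-≤ t u≤)))
    where
    eq′ : u + t ≡ v + s
    eq′ = trans (cong (_+ t) (sym (+-identityʳ u))) eq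
  cases (inj₂ (zero , eq , v≤)) = diagonal (sym eq′) (+-cancelʳ-≤ t _ _ (subst₂ _≤_ eq′ (sym bal) (+-monoˡ-≤ s v≤))) v≤
    where
    eq′ : v + s ≡ u + t
    eq′ = trans (cong (_+ s) (sym (+-identityʳ v))) eq

shifted-corner : ∀ {f u v} → Corner (Shifted f) u v →
                 ∃[ e ] u ≡ v + e × Bead f e × (∀ e′ → e ≡ suc e′ → Gap f e′)
shifted-corner {f} {u} {v} ((1≤v , e , eq , v≤) , ¬right , ¬up) =
  e , eq , ≤-trans (≰⇒> λ v≤′ → ¬right (1≤v , suc e , trans (cong suc eq) (sym (+-suc v e)) , v≤′)) v≤ ,
  λ { e′ refl → ≤-trans (≮⇒≥ λ v<′ → ¬up (s≤s z≤n , e′ , trans eq (+-suc v e′) , v<′)) v≤ }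

open import Data.Integer using (+_)

-- Cells with integer coordinates

infixl 6 _⊝_

_⊝_ : ℕ → ℕ → ℤ
a ⊝ b = + a ℤ.- + b

⊝-injective : ∀ a b c d → a ⊝ b ≡ c ⊝ d → a + d ≡ c + b
⊝-injective a b c d eq = ℤ.+-injective (begin
  + (a + d)               ≡⟨ ℤ.pos-+ a d ⟩
  + a ℤ.+ + d             ≡⟨ add (+ a) (+ b) (+ d) ⟨
  a ⊝ b ℤ.+ (+ b ℤ.+ + d) ≡⟨ cong (ℤ._+ (+ b ℤ.+ + d)) eq ⟩
  c ⊝ d ℤ.+ (+ b ℤ.+ + d) ≡⟨ cong (λ x → c ⊝ d ℤ.+ x) (ℤ.+-comm (+ b) (+ d)) ⟩
  c ⊝ d ℤ.+ (+ d ℤ.+ + b) ≡⟨ add (+ c) (+ d) (+ b) ⟩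
  + c ℤ.+ + b             ≡⟨ ℤ.pos-+ c b ⟨
  + (c + b)               ∎)
  where
  open ≡-Reasoning
  add : ∀ x y w → x ℤ.- y ℤ.+ (y ℤ.+ w) ≡ x ℤ.+ w
  add = ℤ-Solver.solve-∀

⊝-cong : ∀ a b c d → a + d ≡ c + b → a ⊝ b ≡ c ⊝ d
⊝-cong a b c d eq = begin
  a ⊝ b                           ≡⟨ expand (+ a) (+ b) (+ d) ⟩
  (+ a ℤ.+ + d) ℤ.- (+ b ℤ.+ + d) ≡⟨ cong (ℤ._- (+ b ℤ.+ + d)) (trans (sym (ℤ.pos-+ a d)) (trans (cong +_ eq) (ℤ.pos-+ c b))) ⟩
  (+ c ℤ.+ + b) ℤ.- (+ b ℤ.+ + d) ≡⟨ cong (λ x → (+ c ℤ.+ + b) ℤ.- x) (ℤ.+-comm (+ b) (+ d)) ⟩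
  (+ c ℤ.+ + b) ℤ.- (+ d ℤ.+ + b) ≡⟨ expand (+ c) (+ d) (+ b) ⟨
  c ⊝ d                           ∎
  where
  open ≡-Reasoning
  expand : ∀ x y w → x ℤ.- y ≡ (x ℤ.+ w) ℤ.- (y ℤ.+ w)
  expand = ℤ-Solver.solve-∀

⊝-cancel-< : ∀ {a c} b → a ⊝ b ℤ.< c ⊝ b → a < c
⊝-cancel-< {a} {c} b lt = ≰⇒> λ c≤a →
  ℤ.<-irrefl refl (ℤ.<-≤-trans lt (ℤ.+-monoˡ-≤ (ℤ.- + b) (ℤ.+≤+ c≤a)))

⊝-suc : ∀ a b → suc a ⊝ b ≡ ℤ.suc (a ⊝ b)
⊝-suc a b = ℤ.+-assoc (+ 1) (+ a) (ℤ.- + b)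

⊝-zero : ∀ a → a ⊝ 0 ≡ + a
⊝-zero a = ℤ.+-identityʳ (+ a)

at : ℕ → ℕ → ℕ → ℕ → ZCell
at s t u v = u ⊝ s , v ⊝ t

⊝-cancelʳ : ∀ {a b} s → a ⊝ s ≡ b ⊝ s → a ≡ b
⊝-cancelʳ {a} {b} s eq = +-cancelʳ-≡ s a b (⊝-injective a s b s eq)

diagZ-at : ∀ s t u v → diagZ (at s t u v) ≡ (u + t) ⊝ (v + s)
diagZ-at s t u v = trans (regroup (+ u) (+ s) (+ v) (+ t)) (cong₂ ℤ._-_ (sym (ℤ.pos-+ u t)) (sym (ℤ.pos-+ v s)))
  where
  regroup : ∀ u s v t → (u ℤ.- s) ℤ.- (v ℤ.- t) ≡ (u ℤ.+ t) ℤ.- (v ℤ.+ s)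
  regroup = ℤ-Solver.solve-∀

diagZ-below : ∀ s t u v e → u + e + t ≡ v + s → diagZ (at s t u v) ≡ ℤ.- + e
diagZ-below s t u v e eq = trans (diagZ-at s t u v)
  (trans (⊝-cong (u + t) (v + s) 0 e (trans (regroup u t e) eq)) (ℤ.+-identityˡ (ℤ.- + e)))
  where
  regroup : ∀ u t e → u + t + e ≡ u + e + t
  regroup = solve-∀

diagZ-above : ∀ s t u v e → v + e + s ≡ u + t → diagZ (at s t u v) ≡ + e
diagZ-above s t u v e eq = trans (diagZ-at s t u v)
  (trans (⊝-cong (u + t) (v + s) e 0 (trans (+-identityʳ _) (trans (sym eq) (regroup v e s)))) (ℤ.+-identityʳ (+ e)))
  where
  regroup : ∀ v e s → v + e + s ≡ e + (v + s)
  regroup = solve-∀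

-- The cells of C are the points of the region P, translated by (- s , - t).
record Presents (C : Component) (s t : ℕ) (Amb P : Region) : Set where
  field
    to        : ∀ {z} → z ∈C C → ∃[ u ] ∃[ v ] z ≡ at s t u v × P u v
    from      : ∀ {u v} → P u v → at s t u v ∈C C
    closed    : Closed Amb P
    inAmb     : ∀ {u v} → P u v → Amb u v
    Amb-right : ∀ {u v} → Amb u v → Amb (suc u) v
    P?        : ∀ u v → Dec (P u v)
    bounded   : Bounded P

  from-at : ∀ {u v} → at s t u v ∈C C → P u v
  from-at {u} {v} z∈ with to z∈
  ... | u′ , v′ , eq , p = subst₂ P (sym (⊝-cancelʳ s (cong proj₁ eq))) (sym (⊝-cancelʳ t (cong proj₂ eq))) p

  ∈C? : ∀ z → Dec (z ∈C C)
  ∈C? z = map′ (λ { (u , _ , v , _ , refl , p) → from p })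
    (λ z∈ → let u , v , eq , p = to z∈ ; le = proj₂ bounded p in
      u , s≤s (≤-trans (m≤m+n u v) le) , v , s≤s (≤-trans (m≤n+m v u) le) , eq , p)
    (anyUpTo? (λ u → anyUpTo? (λ v → ≡-dec ℤ._≟_ ℤ._≟_ z (at s t u v) ×-dec P? u v) (suc K)) (suc K))
    where K = proj₁ bounded

-- `row` and `col` say that z ends its row and its column; this lets z carry the largest entry of a
-- standard filling.
record Removes (C C′ : Component) (z : ZCell) : Set where
  field
    had  : z ∈C C
    lost : ¬ z ∈C C′
    sub  : ∀ {w} → w ∈C C′ → w ∈C C
    new  : ∀ {w} → w ∈C C → w ∈C C′ ⊎ w ≡ z
    row  : ∀ {X} → proj₁ z ℤ.< X → ¬ (X , proj₂ z) ∈C C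
    col  : ∀ {Y} → proj₂ z ℤ.< Y → ¬ (proj₁ z , Y) ∈C C

-- Both components are presented with the same s and t. A cell beyond z in its row or column would
-- survive the removal, and closedness of `P′` would then put z back.
removes : ∀ {C C′ s t Amb P P′ u v} → Presents C s t Amb P → Presents C′ s t Amb P′ →
          Loses P P′ u v → Removes C C′ (at s t u v)
removes {C} {C′} {s} {t} {Amb} {P} {P′} {u} {v} pr pr′ l = record
  { had  = A.from had
  ; lost = λ z∈ → lost (B.from-at z∈)
  ; sub  = λ w∈ → sub′ (B.to w∈)
  ; new  = λ w∈ → new′ (A.to w∈)
  ; row  = λ lt w∈ → row′ lt (A.to w∈)
  ; col  = λ lt w∈ → col′ lt (A.to w∈)
  }
  where
  open Loses l
  module A = Presents pr
  module B = Presents pr′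
  sub′ : ∀ {w} → ∃[ u ] ∃[ v ] w ≡ at s t u v × P′ u v → w ∈C C
  sub′ (_ , _ , refl , p) = A.from (sub p)
  new′ : ∀ {w} → ∃[ u ] ∃[ v ] w ≡ at s t u v × P u v → w ∈C C′ ⊎ w ≡ at s t u v
  new′ (_ , _ , refl , p) = [ (λ p′ → inj₁ (B.from p′)) , (λ { (refl , refl) → inj₂ refl }) ]′ (new p)
  beyond : ∀ {x y} → P x y → u ≤ x → v ≤ y → (x ≡ u × y ≡ v)
  beyond p u≤x v≤y with new p
  ... | inj₂ eq = eq
  ... | inj₁ p′ = contradiction (B.closed p′ (A.inAmb had) u≤x v≤y) lost
  row′ : ∀ {X} → u ⊝ s ℤ.< X → ¬ (∃[ x ] ∃[ y ] (X , v ⊝ t) ≡ at s t x y × P x y)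
  row′ lt (x , y , eq , p) with ⊝-cancelʳ t (cong proj₂ eq) | ⊝-cancel-< s (subst (u ⊝ s ℤ.<_) (cong proj₁ eq) lt)
  ... | refl | u<x = <⇒≢ u<x (sym (proj₁ (beyond p (<⇒≤ u<x) ≤-refl)))
  col′ : ∀ {Y} → v ⊝ t ℤ.< Y → ¬ (∃[ x ] ∃[ y ] (u ⊝ s , Y) ≡ at s t x y × P x y)
  col′ lt (x , y , eq , p) with ⊝-cancelʳ s (cong proj₁ eq) | ⊝-cancel-< t (subst (v ⊝ t ℤ.<_) (cong proj₂ eq) lt)
  ... | refl | v<y = <⇒≢ v<y (sym (proj₂ (beyond p ≤-refl (<⇒≤ v<y))))

CornerZ : Component → ZCell → Set
CornerZ C (X , Y) = (X , Y) ∈C C × ¬ (ℤ.suc X , Y) ∈C C × ¬ (X , ℤ.suc Y) ∈C C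

module _ {C : Component} {s t : ℕ} {Amb P : Region} (pr : Presents C s t Amb P) where
  open Presents pr

  corner-to : ∀ {z} → CornerZ C z → ∃[ u ] ∃[ v ] z ≡ at s t u v × Corner P u v
  corner-to (z∈ , ¬right , ¬up) with to z∈
  ... | u , v , refl , p = u , v , refl , p ,
    (λ r → ¬right (subst (λ X → (X , v ⊝ t) ∈C C) (⊝-suc u s) (from r))) ,
    (λ r → ¬up (subst (λ Y → (u ⊝ s , Y) ∈C C) (⊝-suc v t) (from r)))

  corner-from : ∀ {u v} → Corner P u v → CornerZ C (at s t u v)
  corner-from {u} {v} (p , ¬right , ¬up) = from p ,
    (λ r → ¬right (from-at (subst (λ X → (X , v ⊝ t) ∈C C) (sym (⊝-suc u s)) r))) ,
    (λ r → ¬up (from-at (subst (λ Y → (u ⊝ s , Y) ∈C C) (sym (⊝-suc v t)) r)))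

  cornerZ-exists : ∀ {z} → z ∈C C → ∃[ w ] CornerZ C w
  cornerZ-exists z∈ with to z∈
  ... | _ , _ , refl , p with corner-exists P? bounded p
  ... | u , v , c = at s t u v , corner-from c

  -- Of two distinct cells on one diagonal, the further one dominates the right neighbour of the
  -- nearer one, which then belongs to the component as well.
  cornerZ-unique : ∀ {z w} → CornerZ C z → CornerZ C w → diagZ z ≡ diagZ w → z ≡ w
  cornerZ-unique cz cw eq with corner-to cz | corner-to cw
  ... | u , v , refl , (p , ¬r , _) | x , y , refl , (p′ , ¬r′ , _) = cong₂ (at s t) u≡x v≡y
    where
    crossed : ∀ u t y s → u + y + (t + s) ≡ u + t + (y + s)
    crossed = solve-∀
    u+y≡x+v : u + y ≡ x + v
    u+y≡x+v = +-cancelʳ-≡ (t + s) _ _ (begin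
      u + y + (t + s)   ≡⟨ crossed u t y s ⟩
      u + t + (y + s)   ≡⟨ ⊝-injective (u + t) (v + s) (x + t) (y + s)
                             (trans (sym (diagZ-at s t u v)) (trans eq (diagZ-at s t x y))) ⟩
      x + t + (v + s)   ≡⟨ crossed x t v s ⟨
      x + v + (t + s)   ∎)
      where open ≡-Reasoning
    u≡x : u ≡ x
    u≡x with <-cmp u x
    ... | tri≈ _ u≡x′ _ = u≡x′
    ... | tri< u<x _ _ = contradiction (closed p′ (Amb-right (inAmb p)) u<x
          (+-cancelˡ-≤ u v y (≤-trans (+-monoˡ-≤ v (<⇒≤ u<x)) (≤-reflexive (sym u+y≡x+v))))) ¬r
    ... | tri> _ _ x<u = contradiction (closed p (Amb-right (inAmb p′)) x<u
          (+-cancelˡ-≤ x y v (≤-trans (+-monoˡ-≤ y (<⇒≤ x<u)) (≤-reflexive u+y≡x+v)))) ¬r′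
    v≡y : v ≡ y
    v≡y = +-cancelˡ-≡ x v y (trans (sym u+y≡x+v) (cong (_+ y) u≡x))

i<suc[i] : ∀ i → i ℤ.< ℤ.suc i
i<suc[i] i = ℤ.suc[i]≤j⇒i<j ℤ.≤-refl

-- Combinations and shifted diagrams

diagLengths : List ℕ → ℕ → ℕ
diagLengths la e = atLeast la (suc e)

slow : ∀ {la} → Strict la → Slow (diagLengths la)
slow {la} st e = atLeast-anti la (suc e) , atLeast-slope st (suc e)

diagLengths-end : ∀ la → ∃[ B ] ∀ e → B ≤ e → diagLengths la e ≡ 0
diagLengths-end la with atLeast-end la
... | B , end = B , λ e B≤e → end (suc e) (m≤n⇒m≤1+n B≤e)

bead⇒mult : ∀ {la e} → Bead (diagLengths la) e → 1 ≤ mult la (suc e)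
bead⇒mult {la} {e} b = +-cancelʳ-≤ (atLeast la (suc (suc e))) _ _
  (≤-trans b (≤-reflexive (atLeast-split la (suc e))))

gap⇒mult : ∀ {la e} → Gap (diagLengths la) e → mult la (suc e) ≡ 0
gap⇒mult {la} {e} g = n≤0⇒n≡0 (+-cancelʳ-≤ (atLeast la (suc (suc e))) _ _
  (≤-trans (≤-reflexive (sym (atLeast-split la (suc e)))) g))

excess : List ℕ → List ℕ → ℕ
excess al be = length al ∸ (length al ⊓ length be)

excess′ : List ℕ → List ℕ → ℕ
excess′ al be = length be ∸ (length al ⊓ length be)

∸-⊓-balance : ∀ a b → a + (b ∸ (a ⊓ b)) ≡ b + (a ∸ (a ⊓ b))
∸-⊓-balance zero    b       = sym (+-identityʳ b)
∸-⊓-balance (suc a) zero    = +-identityʳ (suc a)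
∸-⊓-balance (suc a) (suc b) = cong suc (∸-⊓-balance a b)

∸-⊓-zero : ∀ a b → a ∸ (a ⊓ b) ≡ 0 ⊎ b ∸ (a ⊓ b) ≡ 0
∸-⊓-zero zero    b       = inj₁ refl
∸-⊓-zero (suc a) zero    = inj₂ refl
∸-⊓-zero (suc a) (suc b) = ∸-⊓-zero a b

excess-balance : ∀ {al be} → Strict al → Strict be →
  diagLengths al 0 + excess′ al be ≡ diagLengths be 0 + excess al be
excess-balance {al} {be} sa sb rewrite atLeast-one sa | atLeast-one sb = ∸-⊓-balance (length al) (length be)

FoldRegion : List ℕ → List ℕ → ℕ → ℕ → Region
FoldRegion al be = Folded (diagLengths al) (diagLengths be)

-- The columns deleted from α are those with v ≤ 0: if s is 0 nothing is deleted, and otherwise t is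
-- 0 and v = x - s; likewise for β. The offsets are variables tied by equations so that the shape
-- after a move can be presented with the offsets of the shape before it.
fold-presents : ∀ {al be} → Strict al → Strict be → ∀ s t → s ≡ excess al be → t ≡ excess′ al be →
                Presents (fold al be) s t Quadrant (FoldRegion al be s t)
fold-presents {al} {be} sa sb s t refl refl = record
  { to        = to
  ; from      = from
  ; closed    = folded-closed (slow sa) (slow sb) (excess-balance sa sb)
  ; inAmb     = proj₁
  ; Amb-right = λ { (1≤u , 1≤v) → s≤s z≤n , 1≤v }
  ; P?        = folded? (diagLengths al) (diagLengths be) s t
  ; bounded   = folded-bounded (slow sa) (slow sb) (proj₂ (diagLengths-end al)) (proj₂ (diagLengths-end be)) s t
  }
  where
  inside : ∀ {s t x} → s < x → 1 ≤ (x + t) ∸ s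
  inside {t = t} s<x = m<n⇒0<n∸m (≤-trans s<x (m≤m+n _ t))
  restore : ∀ {s t x} → s < x → x + t ≡ (x + t) ∸ s + s
  restore {t = t} s<x = sym (m∸n+n≡m (<⇒≤ (≤-trans s<x (m≤m+n _ t))))
  to : ∀ {z} → z ∈C fold al be → ∃[ u ] ∃[ v ] z ≡ at s t u v × FoldRegion al be s t u v
  to (inj₁ (x , y , xy∈ , s<x , refl , refl)) with ∈S⇒ sa xy∈
  ... | e , refl , 1≤y , y≤ = y , (x + t) ∸ s , cong (y ⊝ s ,_) (⊝-cong x s _ t (restore s<x)) ,
        (1≤y , inside s<x) , inj₁ (e , restore s<x , y≤)
  to (inj₂ (x , y , xy∈ , t<x , refl , refl)) with ∈S⇒ sb xy∈
  ... | e , refl , 1≤y , y≤ = (x + s) ∸ t , y , cong (_, y ⊝ t) (⊝-cong x t _ s (restore t<x)) ,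
        (inside t<x , 1≤y) , inj₂ (e , restore t<x , y≤)
  s<u+e : ∀ {s t u v e} → s ≡ 0 ⊎ t ≡ 0 → 1 ≤ u → 1 ≤ v → u + e + t ≡ v + s → s < u + e
  s<u+e {u = u} {e = e} (inj₁ refl) 1≤u _ _ = ≤-trans 1≤u (m≤m+n u e)
  s<u+e {s} {u = u} {v} {e} (inj₂ refl) _ 1≤v eq =
    ≤-trans (+-monoˡ-≤ s 1≤v) (≤-reflexive (trans (sym eq) (+-identityʳ (u + e))))
  from : ∀ {u v} → FoldRegion al be s t u v → at s t u v ∈C fold al be
  from {u} {v} ((1≤u , 1≤v) , inj₁ (e , eq , le)) =
    inj₁ (u + e , u , ⇒∈S sa e 1≤u le , s<u+e (∸-⊓-zero (length al) (length be)) 1≤u 1≤v eq ,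
          refl , ⊝-cong v t (u + e) s (sym eq))
  from {u} {v} ((1≤u , 1≤v) , inj₂ (e , eq , le)) =
    inj₂ (v + e , v , ⇒∈S sb e 1≤v le , s<u+e (swap (∸-⊓-zero (length al) (length be))) 1≤v 1≤u eq ,
          ⊝-cong u s (v + e) t (sym eq) , refl)

shift-presents : ∀ {al} → Strict al → Presents (shift al) 0 0 Octant (Shifted (diagLengths al))
shift-presents {al} sa = record
  { to        = to
  ; from      = λ { {u} {v} (1≤v , e , refl , le) → u , v , ⇒∈S sa e 1≤v le , ⊝-zero u , ⊝-zero v }
  ; closed    = shifted-closed (slow sa)
  ; inAmb     = λ { {u} {v} (1≤v , e , refl , _) → 1≤v , m≤m+n v e }
  ; Amb-right = λ { (1≤v , v≤u) → 1≤v , m≤n⇒m≤1+n v≤u }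
  ; P?        = shifted? (diagLengths al)
  ; bounded   = shifted-bounded (slow sa) (proj₂ (diagLengths-end al))
  }
  where
  to : ∀ {z} → z ∈C shift al → ∃[ u ] ∃[ v ] z ≡ at 0 0 u v × Shifted (diagLengths al) u v
  to (x , y , xy∈ , refl , refl) with ∈S⇒ sa xy∈
  ... | e , eq , 1≤y , le = x , y , cong₂ _,_ (sym (⊝-zero x)) (sym (⊝-zero y)) , 1≤y , e , eq , le

length-falls : ∀ {al al′ e} → Strict al → Strict al′ → Drop (diagLengths al) (diagLengths al′) e →
               length al ≡ length al′ + ⟦ 0 ≡ e ⟧
length-falls {e = e} sa sa′ drop = trans (sym (atLeast-one sa)) (trans (drop 0) (cong (_+ ⟦ 0 ≡ e ⟧) (atLeast-one sa′)))

fold-left-removes : ∀ {al al′ be e} → Strict al → Strict al′ → Strict be →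
  Drop (diagLengths al) (diagLengths al′) (suc e) →
  ∃[ z ] Removes (fold al be) (fold al′ be) z × diagZ z ≡ ℤ.- + suc e
fold-left-removes {al} {al′} {be} {e} sa sa′ sb drop
  with folded-drop {g = diagLengths be} {s = excess al be} {t = excess′ al be} (slow sa′) drop
         (≤-trans (m∸n≤m (length al) (length al ⊓ length be)) (≤-reflexive (sym (atLeast-one sa))))
... | u , v , eq , l = at s t u v ,
      removes (fold-presents sa sb s t refl refl)
              (fold-presents sa′ sb s t (cong (λ a → a ∸ (a ⊓ length be)) len) (cong (λ a → length be ∸ (a ⊓ length be)) len)) l ,
      diagZ-below s t u v (suc e) eq
  where
  s = excess al be
  t = excess′ al be
  -- A drop off the main diagonal keeps the number of rows, hence the offsets.
  len : length al ≡ length al′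
  len = trans (length-falls sa sa′ drop) (+-identityʳ _)

fold-right-removes : ∀ {al be be′ e} → Strict al → Strict be → Strict be′ →
  Drop (diagLengths be) (diagLengths be′) (suc e) →
  ∃[ z ] Removes (fold al be) (fold al be′) z × diagZ z ≡ + suc e
fold-right-removes {al} {be} {be′} {e} sa sb sb′ drop
  with folded-drop {g = diagLengths al} {s = excess′ al be} {t = excess al be} (slow sb′) drop
         (≤-trans (m∸n≤m (length be) (length al ⊓ length be)) (≤-reflexive (sym (atLeast-one sb))))
... | v , u , eq , l = at s t u v ,
      removes (fold-presents sa sb s t refl refl)
              (fold-presents sa sb′ s t (cong (λ b → length al ∸ (length al ⊓ b)) len) (cong (λ b → b ∸ (length al ⊓ b)) len))
              (loses-swap l) ,
      diagZ-above s t u v (suc e) eq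
  where
  s = excess al be
  t = excess′ al be
  len : length be ≡ length be′
  len = trans (length-falls sb sb′ drop) (+-identityʳ _)

fold-main-removes : ∀ {al al′ be be′} → Strict al → Strict al′ → Strict be → Strict be′ →
  Drop (diagLengths al) (diagLengths al′) 0 → Drop (diagLengths be) (diagLengths be′) 0 →
  ∃[ z ] Removes (fold al be) (fold al′ be′) z × diagZ z ≡ + 0
fold-main-removes {al} {al′} {be} {be′} sa sa′ sb sb′ dropa dropb =
  at s t u v ,
  removes (fold-presents sa sb s t refl refl)
          -- Both old lengths are successors, and `suc a ∸ (suc a ⊓ suc b)` computes to
          -- `a ∸ (a ⊓ b)`, so the offsets are kept.
          (fold-presents sa′ sb′ s t (cong₂ (λ a b → a ∸ (a ⊓ b)) lena lenb) (cong₂ (λ a b → b ∸ (a ⊓ b)) lena lenb))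
          (folded-drop₂ dropa dropb (excess-balance sa sb)) ,
  diagZ-above s t u v 0 (trans (cong (_+ s) (+-identityʳ v)) (sym (excess-balance sa sb)))
  where
  s = excess al be
  t = excess′ al be
  u = diagLengths al 0
  v = diagLengths be 0
  lena : length al ≡ suc (length al′)
  lena = trans (length-falls sa sa′ dropa) (+-comm _ 1)
  lenb : length be ≡ suc (length be′)
  lenb = trans (length-falls sb sb′ dropb) (+-comm _ 1)

shift-removes : ∀ {al al′ e} → Strict al → Strict al′ → Drop (diagLengths al) (diagLengths al′) e →
  ∃[ z ] Removes (shift al) (shift al′) z × diagZ z ≡ + e
shift-removes {al} {al′} {e} sa sa′ drop = at 0 0 (v + e) v ,
  removes (shift-presents sa) (shift-presents sa′) (shifted-drop drop) ,
  diagZ-above 0 0 (v + e) v e refl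
  where v = diagLengths al e

data FoldCornerZ (al be : List ℕ) (D : ℤ) : Set where
  left  : ∀ e → D ≡ ℤ.- + suc e → 1 ≤ mult al (suc (suc e)) → mult al (suc e) ≡ 0 → FoldCornerZ al be D
  right : ∀ e → D ≡ + suc e → 1 ≤ mult be (suc (suc e)) → mult be (suc e) ≡ 0 → FoldCornerZ al be D
  main  : D ≡ + 0 → 1 ≤ mult al 1 → 1 ≤ mult be 1 → FoldCornerZ al be D

fold-corner : ∀ {al be z} → Strict al → Strict be → CornerZ (fold al be) z → FoldCornerZ al be (diagZ z)
fold-corner {al} {be} sa sb c with corner-to (fold-presents sa sb _ _ refl refl) c
... | u , v , refl , cP with folded-corner (excess-balance sa sb) cP
... | left e eq b g  = left e (diagZ-below _ _ u v (suc e) eq) (bead⇒mult {al} b) (gap⇒mult {al} g)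
... | right e eq b g = right e (diagZ-above _ _ u v (suc e) eq) (bead⇒mult {be} b) (gap⇒mult {be} g)
... | main eq a b    = main (diagZ-above _ _ u v 0 (trans (cong (_+ _) (+-identityʳ v)) (sym eq)))
                            (bead⇒mult {al} a) (bead⇒mult {be} b)

shift-corner : ∀ {al z} → Strict al → CornerZ (shift al) z →
  ∃[ e ] diagZ z ≡ + e × 1 ≤ mult al (suc e) × (∀ e′ → e ≡ suc e′ → mult al (suc e′) ≡ 0)
shift-corner {al} sa c with corner-to (shift-presents sa) c
... | u , v , refl , cP with shifted-corner cP
... | e , eq , b , g = e , diagZ-above 0 0 u v e (trans (+-identityʳ _) (trans (sym eq) (sym (+-identityʳ u)))) ,
      bead⇒mult {al} b , λ e′ e≡ → gap⇒mult {al} (g e′ e≡)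

-- Doubling, and positions in a list of components

*2≡+ : ∀ m → m * 2 ≡ m + m
*2≡+ = solve-∀

double-cancel-< : ∀ {a b} → a + a < b + b → a < b
double-cancel-< {a} {b} lt = ≰⇒> λ b≤a → <⇒≱ lt (+-mono-≤ b≤a b≤a)

double-cancel-≤ : ∀ {a b} → a + a < suc b + suc b → a ≤ b
double-cancel-≤ {a} {b} lt = ≤-pred (double-cancel-< lt)

module _ (G : ℕ → Component) where

  InQ-++⁻ : ∀ m ys j z → InQ (applyUpTo G m ++ ys) j z → (j < m × z ∈C G j) ⊎ (∃[ j′ ] j ≡ m + j′ × InQ ys j′ z)
  InQ-++⁻ m ys = go G m
    where
    go : ∀ G m j z → InQ (applyUpTo G m ++ ys) j z → (j < m × z ∈C G j) ⊎ (∃[ j′ ] j ≡ m + j′ × InQ ys j′ z)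
    go G zero    j       z p = inj₂ (j , refl , p)
    go G (suc m) zero    z p = inj₁ (s≤s z≤n , p)
    go G (suc m) (suc j) z p with go (λ i → G (suc i)) m j z p
    ... | inj₁ (j<m , q)      = inj₁ (s≤s j<m , q)
    ... | inj₂ (j′ , eq , q) = inj₂ (j′ , cong suc eq , q)

InQ-++ˡ : ∀ G m ys j z → j < m → z ∈C G j → InQ (applyUpTo G m ++ ys) j z
InQ-++ˡ G (suc m) ys zero    z _         p = p
InQ-++ˡ G (suc m) ys (suc j) z (s≤s j<m) p = InQ-++ˡ (λ i → G (suc i)) m ys j z j<m p

InQ-++ʳ : ∀ G m ys j z → InQ ys j z → InQ (applyUpTo G m ++ ys) (m + j) z
InQ-++ʳ G zero    ys j z p = p
InQ-++ʳ G (suc m) ys j z p = InQ-++ʳ (λ i → G (suc i)) m ys j z p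

-- Existence and uniqueness of moves

slide-exists : ∀ {k nu} q → Strict nu → 1 ≤ mult nu (q + k) → mult nu q ≡ 0 →
               ∃[ mu ] Strict mu × Step k nu mu (q + k)
slide-exists {k} {nu} q st p∈ q∉ with without st p∈
... | la , st-la , eq with bound la
... | B , ps with realise (λ d → mult la d + ⟦ d ≡ q ⟧) (B + q) w≤1 w0
  where
  mult-q : ∀ d → d ≡ q → mult la d ≡ 0
  -- For q = 0 nothing is really added: 0 is not a part of `la`, and `realise` ignores the value at
  -- 0.
  mult-q zero    _    = mult-∉ {la} λ 0∈ → contradiction (All.lookup (proj₂ st-la) 0∈) λ ()
  mult-q (suc d) refl = m+n≡0⇒m≡0 _ (trans (sym (eq d)) q∉)
  w≤1 : ∀ d → mult la d + ⟦ d ≡ q ⟧ ≤ 1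
  w≤1 d with d ≟ q
  ... | yes d≡q  = ≤-reflexive (cong₂ _+_ (mult-q d d≡q) (subst (λ x → ⟦ d ≡ x ⟧ ≡ 1) d≡q (⟦≡⟧-yes d)))
  ... | no d≢q   = ≤-trans (≤-reflexive (trans (cong (λ x → mult la d + x) (⟦≡⟧-no d≢q)) (+-identityʳ _))) (mult≤1 st-la d)
  w0 : ∀ d → B + q < d → mult la d + ⟦ d ≡ q ⟧ ≡ 0
  w0 d lt = cong₂ _+_ (mult-above (All.map (λ x<B → ≤-trans x<B (≤-trans (m≤m+n B q) (<⇒≤ lt))) ps))
                      (⟦≡⟧-no λ d≡q → <⇒≢ (≤-<-trans (m≤n+m q B) lt) (sym d≡q))
... | mu , st-mu , eq′ = mu , st-mu , slide q refl λ d → begin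
  mult nu (suc d) + ⟦ suc d ≡ q ⟧                         ≡⟨ cong (_+ ⟦ suc d ≡ q ⟧) (eq d) ⟩
  mult la (suc d) + ⟦ suc d ≡ q + k ⟧ + ⟦ suc d ≡ q ⟧     ≡⟨ swap₂ (mult la (suc d)) _ _ ⟩
  mult la (suc d) + ⟦ suc d ≡ q ⟧ + ⟦ suc d ≡ q + k ⟧     ≡⟨ cong (_+ ⟦ suc d ≡ q + k ⟧) (eq′ d) ⟨
  mult mu (suc d) + ⟦ suc d ≡ q + k ⟧                     ∎
  where
  open ≡-Reasoning
  swap₂ : ∀ a b c → a + b + c ≡ a + c + b
  swap₂ = solve-∀

annihilate-exists : ∀ {k nu} q p → Strict nu → 1 ≤ q → q < p → q + p ≡ k → 1 ≤ mult nu q → 1 ≤ mult nu p →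
                    ∃[ mu ] Strict mu × Step k nu mu p
annihilate-exists {k} {nu} (suc q) p st 1≤q q<p eq q∈ p∈ with without st p∈
... | la , st-la , eq₁ with without st-la {suc q} (subst (1 ≤_)
        (trans (eq₁ q) (trans (cong (λ x → mult la (suc q) + x) (⟦≡⟧-no (<⇒≢ q<p))) (+-identityʳ _))) q∈)
... | mu , st-mu , eq₂ = mu , st-mu , annihilate (suc q) 1≤q q<p eq λ d →
      trans (eq₁ d) (trans (cong (_+ ⟦ suc d ≡ p ⟧) (eq₂ d)) (+-assoc (mult mu (suc d)) _ _))

-- A slide has p ≥ k and an annihilation p < k, and q is then p - k or k - p, so the head determines
-- the move.
step-functional : ∀ {k nu mu mu′ p} → Strict mu → Strict mu′ → Step k nu mu p → Step k nu mu′ p → mu ≡ mu′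
step-functional {k} {p = p} sm sm′ (slide q p≡ eq) (slide q′ p≡′ eq′)
  with +-cancelʳ-≡ k q q′ (trans (sym p≡) p≡′)
... | refl = strict-ext sm sm′ λ d → +-cancelʳ-≡ ⟦ suc d ≡ p ⟧ _ _ (trans (sym (eq d)) (eq′ d))
step-functional {p = p} sm sm′ (annihilate q _ _ q+p eq) (annihilate q′ _ _ q′+p eq′)
  with +-cancelʳ-≡ p q q′ (trans q+p (sym q′+p))
... | refl = strict-ext sm sm′ λ d → +-cancelʳ-≡ (⟦ suc d ≡ q ⟧ + ⟦ suc d ≡ p ⟧) _ _ (trans (sym (eq d)) (eq′ d))
step-functional {k} sm sm′ (slide q refl eq) (annihilate q′ 1≤q′ _ q′+p eq′) =
  contradiction (m≤n+m k q) (<⇒≱ (≤-trans (+-monoˡ-≤ _ 1≤q′) (≤-reflexive q′+p)))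
step-functional {k} sm sm′ (annihilate q′ 1≤q′ _ q′+p eq′) (slide q refl eq) =
  contradiction (m≤n+m k q) (<⇒≱ (≤-trans (+-monoˡ-≤ _ 1≤q′) (≤-reflexive q′+p)))

-- The components of the quotient by position

module Quotient (k : ℕ) .{{_ : NonZero k}} where
  open Abacus k

  1≤k : 1 ≤ k
  1≤k = >-nonZero⁻¹ k

  -- The residue j + 1 is smaller than, equal to or larger than its partner k - (j + 1). The two
  -- bounds in `whole` say that j is k/2 rounded down, which is the last position for either parity
  -- of k.
  data Kind (j : ℕ) : Set where
    folded : ∀ i → suc j + i ≡ k → suc j < i → Kind j
    self   : suc j + suc j ≡ k → Kind j
    whole  : j + j ≤ k → k < suc j + suc j → Kind j

  component : ∀ {j} → Kind j → List ℕ → Component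
  component {j} (folded i _ _) la = fold (abacus k (suc j) la) (abacus k i la)
  component {j} (self _)       la = fold (abacus k (suc j) la) []
  component {j} (whole _ _)    la = shift (abacus k k la)

  component-irrelevant : ∀ {j} (K K′ : Kind j) la → component K la ≡ component K′ la
  component-irrelevant {j} (folded i eq _) (folded i′ eq′ _) la with +-cancelˡ-≡ (suc j) i i′ (trans eq (sym eq′))
  ... | refl = refl
  component-irrelevant {j} (folded i eq lt) (self eq′)     la = contradiction (+-cancelˡ-≡ (suc j) _ _ (trans eq′ (sym eq))) (<⇒≢ lt)
  component-irrelevant {j} (self eq′) (folded i eq lt)     la = contradiction (+-cancelˡ-≡ (suc j) _ _ (trans eq′ (sym eq))) (<⇒≢ lt)
  component-irrelevant {j} (folded i eq lt) (whole _ k<)   la =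
    contradiction (≤-trans k< (≤-trans (+-monoʳ-≤ (suc j) (<⇒≤ lt)) (≤-reflexive eq))) (<-irrefl refl)
  component-irrelevant {j} (whole _ k<) (folded i eq lt)   la =
    contradiction (≤-trans k< (≤-trans (+-monoʳ-≤ (suc j) (<⇒≤ lt)) (≤-reflexive eq))) (<-irrefl refl)
  component-irrelevant (self eq) (self eq′)     la = refl
  component-irrelevant (self eq) (whole _ k<)   la = contradiction (≤-trans k< (≤-reflexive eq)) (<-irrefl refl)
  component-irrelevant (whole _ k<) (self eq)   la = contradiction (≤-trans k< (≤-reflexive eq)) (<-irrefl refl)
  component-irrelevant (whole _ _) (whole _ _)  la = refl

  combination : List ℕ → ℕ → Component
  combination la j = fold (abacus k (suc j) la) (abacus k (k ∸ suc j) la)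

  data Parity : Set where
    even : ∀ m → k ≡ suc m + suc m → k % 2 ≡ 0 → k / 2 ≡ suc m → Parity
    odd  : ∀ m → k ≡ suc (m + m)   → k % 2 ≡ 1 → k / 2 ≡ m     → Parity

  parity : Parity
  parity with k % 2 in r | k / 2 in q | m%n<n k 2 | m≡m%n+[m/n]*n k 2
  ... | zero        | zero  | _ | eq = contradiction (subst (1 ≤_) eq 1≤k) λ ()
  ... | zero        | suc m | _ | eq = even m (trans eq (*2≡+ (suc m))) r q
  ... | suc zero    | m     | _ | eq = odd m (trans eq (cong suc (*2≡+ m))) r q
  ... | suc (suc _) | _     | s≤s (s≤s ()) | _

  evenEnd : ℕ → List ℕ → List Component
  evenEnd m la = fold (abacus k (suc m) la) [] ∷ shift (abacus k k la) ∷ []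

  oddEnd : List ℕ → List Component
  oddEnd la = shift (abacus k k la) ∷ []

  kQuotient-even : ∀ {m} la → k % 2 ≡ 0 → k / 2 ≡ suc m →
    kQuotient k la ≡ applyUpTo (combination la) m ++ evenEnd m la
  kQuotient-even {m} la r q rewrite r | q =
    cong (_++ evenEnd m la)
      (trans (cong (map _) (map-applyUpTo (λ x → x) suc m)) (map-applyUpTo suc _ m))

  kQuotient-odd : ∀ {m} la → k % 2 ≡ 1 → k / 2 ≡ m →
    kQuotient k la ≡ applyUpTo (combination la) m ++ oddEnd la
  kQuotient-odd {m} la r q rewrite r | q =
    cong (_++ oddEnd la)
      (trans (cong (map _) (map-applyUpTo (λ x → x) suc m)) (map-applyUpTo suc _ m))

  fold-kind : ∀ {j} → suc j + suc j < k → suc j + (k ∸ suc j) ≡ k × suc j < k ∸ suc j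
  fold-kind {j} lt = eq , +-cancelˡ-< (suc j) _ _ (≤-trans lt (≤-reflexive (sym eq)))
    where
    eq : suc j + (k ∸ suc j) ≡ k
    eq = m+[n∸m]≡n (≤-trans (m≤m+n (suc j) (suc j)) (<⇒≤ lt))

  folded-∸ : ∀ {j i} → suc j + i ≡ k → k ∸ suc j ≡ i
  folded-∸ {j} {i} eq = trans (cong (_∸ suc j) (sym eq)) (m+n∸m≡n (suc j) i)

  InQ⇒ : ∀ la j z → InQ (kQuotient k la) j z → Σ[ K ∈ Kind j ] z ∈C component K la
  InQ⇒ la j z z∈ with parity
  InQ⇒ la j z z∈ | even m k≡ r q
    with InQ-++⁻ (combination la) m (evenEnd m la) j z (subst (λ Q → InQ Q j z) (kQuotient-even la r q) z∈)
  ... | inj₁ (j<m , p) = folded (k ∸ suc j) (proj₁ fk) (proj₂ fk) , p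
    where fk = fold-kind (≤-trans (+-mono-< (s≤s j<m) (s≤s j<m)) (≤-reflexive (sym k≡)))
  ... | inj₂ (zero , refl , p) rewrite +-identityʳ m = self (sym k≡) , p
  ... | inj₂ (suc zero , refl , p) rewrite +-comm m 1 =
    whole (≤-reflexive (sym k≡)) (subst (_< suc (suc m) + suc (suc m)) (sym k≡) (+-mono-< (n<1+n (suc m)) (n<1+n (suc m)))) , p
  InQ⇒ la j z z∈ | odd m k≡ r q
    with InQ-++⁻ (combination la) m (oddEnd la) j z (subst (λ Q → InQ Q j z) (kQuotient-odd la r q) z∈)
  ... | inj₁ (j<m , p) = folded (k ∸ suc j) (proj₁ fk) (proj₂ fk) , p
    where fk = fold-kind (≤-trans (s≤s (+-mono-≤ j<m j<m)) (≤-reflexive (sym k≡)))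
  ... | inj₂ (zero , refl , p) rewrite +-identityʳ m =
    whole (≤-trans (n≤1+n _) (≤-reflexive (sym k≡)))
          (subst (_< suc m + suc m) (sym k≡) (s≤s (≤-reflexive (sym (+-suc m m))))) , p

  ⇒InQ : ∀ la {j z} (K : Kind j) → z ∈C component K la → InQ (kQuotient k la) j z
  ⇒InQ la {j} {z} K p with parity
  ⇒InQ la {j} {z} (folded i eq lt) p | even m k≡ r q = subst (λ Q → InQ Q j z) (sym (kQuotient-even la r q))
    (InQ-++ˡ (combination la) m (evenEnd m la) j z
      (≤-pred (double-cancel-< (≤-trans (≤-trans (+-monoʳ-< (suc j) lt) (≤-reflexive eq)) (≤-reflexive k≡))))
      (subst (λ i → z ∈C fold (abacus k (suc j) la) (abacus k i la)) (sym (folded-∸ eq)) p))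
  ⇒InQ la {j} {z} (folded i eq lt) p | odd m k≡ r q = subst (λ Q → InQ Q j z) (sym (kQuotient-odd la r q))
    (InQ-++ˡ (combination la) m (oddEnd la) j z
      (double-cancel-≤ (≤-trans (≤-trans (+-monoʳ-< (suc j) lt) (≤-trans (≤-reflexive (trans eq k≡)) (n≤1+n _)))
        (≤-reflexive (cong suc (sym (+-suc m m))))))
      (subst (λ i → z ∈C fold (abacus k (suc j) la) (abacus k i la)) (sym (folded-∸ eq)) p))
  ⇒InQ la {j} {z} (self eq) p | even m k≡ r q
    with ≤-antisym (double-cancel-≤ {suc j} {suc m} (s≤s (≤-trans (≤-reflexive (trans eq k≡)) (+-monoʳ-≤ (suc m) (n≤1+n (suc m))))))
                   (double-cancel-≤ {suc m} {suc j} (s≤s (≤-trans (≤-reflexive (trans (sym k≡) (sym eq))) (+-monoʳ-≤ (suc j) (n≤1+n (suc j))))))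
  ... | refl = subst (λ Q → InQ Q m z) (sym (kQuotient-even la r q))
    (subst (λ i → InQ (applyUpTo (combination la) m ++ evenEnd m la) i z) (+-identityʳ m) (InQ-++ʳ (combination la) m (evenEnd m la) 0 z p))
  ⇒InQ la {j} {z} (self eq) p | odd m k≡ r q = contradiction
    (trans (2*≡+ (suc j)) (trans (trans eq k≡) (cong suc (sym (2*≡+ m))))) (even≢odd (suc j) m)
    where
    2*≡+ : ∀ a → 2 * a ≡ a + a
    2*≡+ a = trans (*-comm 2 a) (*2≡+ a)
  ⇒InQ la {j} {z} (whole j+j≤k k<) p | even m k≡ r q with
    ≤-antisym (double-cancel-≤ {j} {suc m} (s≤s (≤-trans j+j≤k (≤-trans (≤-reflexive k≡) (+-monoʳ-≤ (suc m) (n≤1+n (suc m)))))))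
              (≤-pred (double-cancel-< {suc m} {suc j} (subst (_< suc j + suc j) k≡ k<)))
  ... | refl = subst (λ Q → InQ Q (suc m) z) (sym (kQuotient-even la r q))
    (subst (λ i → InQ (applyUpTo (combination la) m ++ evenEnd m la) i z) (+-comm m 1) (InQ-++ʳ (combination la) m (evenEnd m la) 1 z p))
  ⇒InQ la {j} {z} (whole j+j≤k k<) p | odd m k≡ r q with
    ≤-antisym (double-cancel-≤ {j} {m} (s≤s (≤-trans j+j≤k (≤-trans (≤-reflexive k≡) (≤-reflexive (sym (+-suc m m)))))))
              (≤-pred (double-cancel-< {m} {suc j} (≤-trans (s≤s (n≤1+n (m + m))) (subst (_< suc j + suc j) k≡ k<))))
  ... | refl = subst (λ Q → InQ Q m z) (sym (kQuotient-odd la r q))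
    (subst (λ i → InQ (applyUpTo (combination la) m ++ oddEnd la) i z) (+-identityʳ m) (InQ-++ʳ (combination la) m (oddEnd la) 0 z p))

-- Moves as removals of one cell of the quotient

module Moves (k : ℕ) .{{_ : NonZero k}} where
  open Abacus k
  open Quotient k

  -- The component in which the residue r lives, and its side there.
  data Place (r j : ℕ) : Set where
    lower : r ≡ suc j → r + r ≤ k → Place r j
    upper : suc j + r ≡ k → k < r + r → Place r j
    whole : r ≡ k → j + j ≤ k → k < suc j + suc j → Place r j

  private
    k+k≰k : ¬ (k + k ≤ k)
    k+k≰k le = <⇒≱ (+-monoˡ-< k 1≤k) le

    suc+k≢k : ∀ {j} → suc j + k ≢ k
    suc+k≢k {j} eq = <⇒≢ (s≤s (m≤n+m k j)) (sym eq)

    middle : ∀ {i j} → i + i ≤ k → k < suc j + suc j → i ≤ j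
    middle le lt = ≤-pred (double-cancel-< (≤-<-trans le lt))

  place-unique : ∀ {r j j′} → Place r j → Place r j′ → j ≡ j′
  place-unique (lower refl _)    (lower refl _)     = refl
  place-unique (lower _ le)      (upper _ lt)       = contradiction le (<⇒≱ lt)
  place-unique (lower refl le)   (whole refl _ _)   = contradiction le k+k≰k
  place-unique (upper _ lt)      (lower _ le)       = contradiction le (<⇒≱ lt)
  place-unique {r} (upper eq _)  (upper eq′ _)      = suc-injective (+-cancelʳ-≡ r _ _ (trans eq (sym eq′)))
  place-unique (upper eq _)      (whole refl _ _)   = contradiction eq suc+k≢k
  place-unique (whole refl _ _)  (lower refl le)    = contradiction le k+k≰k
  place-unique (whole refl _ _)  (upper eq _)       = contradiction eq suc+k≢k
  place-unique (whole _ le lt)   (whole _ le′ lt′)  = ≤-antisym (middle le lt′) (middle le′ lt)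

  component-cong : ∀ {j nu mu} (K : Kind j) →
    (∀ r → 1 ≤ r → r ≤ k → Place r j → abacus k r nu ≡ abacus k r mu) → component K nu ≡ component K mu
  component-cong {j} (folded i eq lt) same = cong₂ fold
    (same (suc j) (s≤s z≤n) (subst (suc j ≤_) eq (m≤m+n (suc j) i))
      (lower refl (≤-trans (+-monoʳ-≤ (suc j) (<⇒≤ lt)) (≤-reflexive eq))))
    (same i (≤-trans (s≤s z≤n) lt) (subst (i ≤_) eq (m≤n+m i (suc j)))
      (upper eq (≤-trans (s≤s (≤-reflexive (sym eq))) (+-monoˡ-< i lt))))
  component-cong {j} (self eq) same = cong (λ al → fold al [])
    (same (suc j) (s≤s z≤n) (subst (suc j ≤_) eq (m≤m+n (suc j) (suc j))) (lower refl (≤-reflexive eq)))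
  component-cong (whole le lt) same = cong shift (same k 1≤k ≤-refl (whole refl le lt))

  -- Loc p j D: a ribbon with head on diagonal p corresponds to a cell on diagonal D of component j.
  data Loc (p j : ℕ) (D : ℤ) : Set where
    below : ∀ e → suc j + suc j ≤ k → p ≡ suc j + suc e * k → D ≡ ℤ.- + suc e → Loc p j D
    above : ∀ r e → suc j + r ≡ k → k < r + r → p ≡ r + e * k → D ≡ + e → Loc p j D
    whole : ∀ e → j + j ≤ k → k < suc j + suc j → p ≡ k + e * k → D ≡ + e → Loc p j D

  private
    upper-bounds : ∀ {j r} → suc j + r ≡ k → k < r + r → 1 ≤ r × r ≤ k
    upper-bounds {j} {r} eq lt = positive r lt , subst (r ≤_) eq (m≤n+m r (suc j))
      where
      positive : ∀ r → k < r + r → 1 ≤ r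
      positive (suc r) _ = s≤s z≤n

    lower-bound : ∀ {j} → suc j + suc j ≤ k → suc j ≤ k
    lower-bound {j} le = ≤-trans (m≤m+n (suc j) (suc j)) le

  loc-place : ∀ {p j D} → Loc p j D → ∃[ r ] ∃[ e ] 1 ≤ r × r ≤ k × p ≡ r + e * k × Place r j
  loc-place {j = j} (below e le eq _) = suc j , suc e , s≤s z≤n , lower-bound le , eq , lower refl le
  loc-place (above r e eq lt p≡ _)    = let 1≤r , r≤k = upper-bounds eq lt in r , e , 1≤r , r≤k , p≡ , upper eq lt
  loc-place (whole e le lt eq _)      = k , e , 1≤k , ≤-refl , eq , whole refl le lt

  -- The digits of p name the runner, and each runner has its place in only one component.
  loc-component : ∀ {p j D j′ D′} → Loc p j D → Loc p j′ D′ → j ≡ j′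
  loc-component l l′ with loc-place l | loc-place l′
  ... | r , e , 1≤r , r≤k , eq , π | r′ , e′ , 1≤r′ , r′≤k , eq′ , π′
    with digits-unique {r} {e} {r′} {e′} 1≤r r≤k 1≤r′ r′≤k (trans (sym eq) eq′)
  ... | refl , refl = place-unique π π′

  loc-diag : ∀ {p j D D′} → Loc p j D → Loc p j D′ → D ≡ D′
  loc-diag {j = j} (below e le eq refl) (below e′ le′ eq′ refl)
    with digits-unique {suc j} {suc e} {suc j} {suc e′} (s≤s z≤n) (lower-bound le) (s≤s z≤n) (lower-bound le) (trans (sym eq) eq′)
  ... | _ , refl = refl
  loc-diag {j = j} (below e le eq _) (above r e′ r≡ lt eq′ _) = contradiction le (<⇒≱ (subst (λ x → k < x + x) (sym same) lt))
    where
    same : suc j ≡ r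
    same = let 1≤r , r≤k = upper-bounds r≡ lt in
      proj₁ (digits-unique {suc j} {suc e} {r} {e′} (s≤s z≤n) (lower-bound le) 1≤r r≤k (trans (sym eq) eq′))
  loc-diag (below e le _ _) (whole e′ _ lt _ _) = contradiction le (<⇒≱ lt)
  loc-diag {j = j} (above r e′ r≡ lt eq′ _) (below e le eq _) = contradiction le (<⇒≱ (subst (λ x → k < x + x) (sym same) lt))
    where
    same : suc j ≡ r
    same = let 1≤r , r≤k = upper-bounds r≡ lt in
      proj₁ (digits-unique {suc j} {suc e} {r} {e′} (s≤s z≤n) (lower-bound le) 1≤r r≤k (trans (sym eq) eq′))
  loc-diag (above r e r≡ lt eq refl) (above r′ e′ r′≡ lt′ eq′ refl)
    with upper-bounds r≡ lt | upper-bounds r′≡ lt′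
  ... | 1≤r , r≤k | 1≤r′ , r′≤k =
      cong +_ (proj₂ (digits-unique {r} {e} {r′} {e′} 1≤r r≤k 1≤r′ r′≤k (trans (sym eq) eq′)))
  loc-diag (above r e r≡ lt eq _) (whole e′ _ _ eq′ _) with upper-bounds r≡ lt
  ... | 1≤r , r≤k with digits-unique {r} {e} {k} {e′} 1≤r r≤k 1≤k ≤-refl (trans (sym eq) eq′)
  ... | refl , _ = contradiction r≡ suc+k≢k
  loc-diag (whole e′ _ lt _ _) (below e le _ _) = contradiction le (<⇒≱ lt)
  loc-diag (whole e′ _ _ eq′ _) (above r e r≡ lt eq _) with upper-bounds r≡ lt
  ... | 1≤r , r≤k with digits-unique {r} {e} {k} {e′} 1≤r r≤k 1≤k ≤-refl (trans (sym eq) eq′)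
  ... | refl , _ = contradiction r≡ suc+k≢k
  loc-diag (whole e _ _ eq refl) (whole e′ _ _ eq′ refl) =
    cong +_ (proj₂ (digits-unique {k} {e} {k} {e′} 1≤k ≤-refl 1≤k ≤-refl (trans (sym eq) eq′)))

  private
    upper-below : ∀ {j r} → suc j + r ≡ k → k < r + r → ¬ (k < suc j + suc j)
    upper-below {j} {r} eq lt lt′ = <⇒≱ (+-mono-< lt lt′) (≤-reflexive (trans (+-interchange r r (suc j) (suc j))
      (cong₂ _+_ (trans (+-comm r (suc j)) eq) (trans (+-comm r (suc j)) eq))))

  -- In a folded component the sign of D tells the half, hence the runner, and |D| the position on
  -- it. The value 0 is unambiguous because only `above` covers it: the head of an annihilation is
  -- the larger of the two parts.
  loc-head : ∀ {p p′ j D} → Loc p j D → Loc p′ j D → p ≡ p′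
  loc-head {j = j} (below e _ refl refl) (below e′ _ refl eq) =
    cong (λ x → suc j + x * k) (ℤ.+-injective (ℤ.neg-injective eq))
  loc-head (below e _ _ refl) (above r e′ _ _ _ ())
  loc-head (below e le _ _) (whole e′ _ lt _ _) = contradiction le (<⇒≱ lt)
  loc-head (above r e′ _ _ _ refl) (below e _ _ ())
  loc-head {j = j} (above r e r≡ _ refl refl) (above r′ e′ r′≡ _ refl eq) =
    cong₂ (λ x y → x + y * k) (+-cancelˡ-≡ (suc j) r r′ (trans r≡ (sym r′≡))) (ℤ.+-injective eq)
  loc-head (above r e r≡ lt _ _) (whole e′ _ lt′ _ _) = contradiction lt′ (upper-below r≡ lt)
  loc-head (whole e′ _ lt _ _) (below e le _ _) = contradiction le (<⇒≱ lt)
  loc-head (whole e′ _ lt′ _ _) (above r e r≡ lt _ _) = contradiction lt′ (upper-below r≡ lt)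
  loc-head (whole e _ _ refl refl) (whole e′ _ _ refl eq) = cong (λ x → k + x * k) (ℤ.+-injective eq)

  infix 4 _∈Q[_,_]

  _∈Q[_,_] : ZCell → List ℕ → ℕ → Set
  z ∈Q[ la , j ] = InQ (kQuotient k la) j z

  record RemovesAt (nu mu : List ℕ) (p j : ℕ) (z : ZCell) : Set where
    field
      had  : z ∈Q[ nu , j ]
      lost : ¬ z ∈Q[ mu , j ]
      sub  : ∀ {i w} → w ∈Q[ mu , i ] → w ∈Q[ nu , i ]
      new  : ∀ {i w} → w ∈Q[ nu , i ] → w ∈Q[ mu , i ] ⊎ (i ≡ j × w ≡ z)
      row  : ∀ {X} → proj₁ z ℤ.< X → ¬ (X , proj₂ z) ∈Q[ nu , j ]
      col  : ∀ {Y} → proj₂ z ℤ.< Y → ¬ (proj₁ z , Y) ∈Q[ nu , j ]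
      loc  : Loc p j (diagZ z)

  ∈component : ∀ {j la z} (K : Kind j) → z ∈Q[ la , j ] → z ∈C component K la
  ∈component {j} {la} {z} K z∈ with InQ⇒ la j z z∈
  ... | K′ , p = subst (z ∈C_) (component-irrelevant K′ K la) p

  removesAt : ∀ {nu mu p j z} (K : Kind j) → Removes (component K nu) (component K mu) z →
    (∀ {i} (K′ : Kind i) → i ≢ j → component K′ nu ≡ component K′ mu) → Loc p j (diagZ z) →
    RemovesAt nu mu p j z
  removesAt {nu} {mu} {p} {j} {z} K r same l = record
    { had  = ⇒InQ nu K R.had
    ; lost = λ z∈ → R.lost (∈component K z∈)
    ; sub  = sub
    ; new  = new
    ; row  = λ lt w∈ → R.row lt (∈component K w∈)
    ; col  = λ lt w∈ → R.col lt (∈component K w∈)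
    ; loc  = l }
    where
    module R = Removes r
    sub : ∀ {i w} → w ∈Q[ mu , i ] → w ∈Q[ nu , i ]
    sub {i} {w} w∈ with i ≟ j
    ... | yes refl = ⇒InQ nu K (R.sub (∈component K w∈))
    ... | no i≢j with InQ⇒ mu i w w∈
    ...   | K′ , q = ⇒InQ nu K′ (subst (w ∈C_) (sym (same K′ i≢j)) q)
    new : ∀ {i w} → w ∈Q[ nu , i ] → w ∈Q[ mu , i ] ⊎ (i ≡ j × w ≡ z)
    new {i} {w} w∈ with i ≟ j
    ... | yes refl = [ (λ q → inj₁ (⇒InQ mu K q)) , (λ eq → inj₂ (refl , eq)) ]′ (R.new (∈component K w∈))
    ... | no i≢j with InQ⇒ nu i w w∈
    ...   | K′ , q = inj₁ (⇒InQ mu K′ (subst (w ∈C_) (same K′ i≢j) q))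

  middle-index : ∃[ j ] j + j ≤ k × k < suc j + suc j
  middle-index with parity
  ... | even m k≡ _ _ = suc m , ≤-reflexive (sym k≡) ,
                        subst (_< suc (suc m) + suc (suc m)) (sym k≡) (+-mono-< (n<1+n (suc m)) (n<1+n (suc m)))
  ... | odd m k≡ _ _  = m , ≤-trans (n≤1+n _) (≤-reflexive (sym k≡)) ,
                        subst (_< suc m + suc m) (sym k≡) (s≤s (≤-reflexive (sym (+-suc m m))))

  module _ {nu mu : List ℕ} (st-nu : Strict nu) (st-mu : Strict mu) where

    private
      strict-nu : ∀ r → 1 ≤ r → r ≤ k → Strict (abacus k r nu)
      strict-nu r 1≤r r≤k = abacus-strict {r} 1≤r r≤k {nu} st-nu
      strict-mu : ∀ r → 1 ≤ r → r ≤ k → Strict (abacus k r mu)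
      strict-mu r 1≤r r≤k = abacus-strict {r} 1≤r r≤k {mu} st-mu

    whole-removes : ∀ {p e} → p ≡ k + e * k → Falls (abacus k k nu) (abacus k k mu) e →
      (∀ i → 1 ≤ i → i ≤ k → i ≢ k → abacus k i nu ≡ abacus k i mu) → ∃[ j ] ∃[ z ] RemovesAt nu mu p j z
    whole-removes {p} {e} p≡ drop others = place middle-index
      (shift-removes {abacus k k nu} {abacus k k mu} {e} (strict-nu k 1≤k ≤-refl) (strict-mu k 1≤k ≤-refl) drop)
      where
      place : ∃[ j ] (j + j ≤ k × k < suc j + suc j) →
              ∃[ z ] Removes (shift (abacus k k nu)) (shift (abacus k k mu)) z × diagZ z ≡ + e →
              ∃[ j ] ∃[ z ] RemovesAt nu mu p j z
      place (j , le , lt) (z , rem , dz) = j , z , removesAt {nu} {mu} (whole le lt) rem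
          (λ K i≢j → component-cong {nu = nu} {mu} K λ r 1≤r r≤k π →
            others r 1≤r r≤k λ { refl → i≢j (place-unique π (whole refl le lt)) })
          (whole e le lt p≡ dz)

    -- Trichotomy of 2r against k: runner r is the first factor of a combination, the factor
    -- combined with ∅, or the second factor, behind runner k - r. The partner runner is untouched.
    fold-removes : ∀ {p r e} → 1 ≤ r → r < k → p ≡ r + suc e * k → Falls (abacus k r nu) (abacus k r mu) (suc e) →
      (∀ i → 1 ≤ i → i ≤ k → i ≢ r → abacus k i nu ≡ abacus k i mu) → ∃[ j ] ∃[ z ] RemovesAt nu mu p j z
    fold-removes {p} {suc j} {e} 1≤r r<k p≡ drop others = cases (<-cmp (suc j + suc j) k)
      where
      α = abacus k (suc j) nu
      α′ = abacus k (suc j) mu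
      sα : Strict α
      sα = strict-nu (suc j) 1≤r (<⇒≤ r<k)
      sα′ : Strict α′
      sα′ = strict-mu (suc j) 1≤r (<⇒≤ r<k)
      unchanged : ∀ {j′} → Place (suc j) j′ → ∀ {i} (K : Kind i) → i ≢ j′ → component K nu ≡ component K mu
      unchanged {j′} π K i≢j′ = component-cong {nu = nu} {mu} K λ r′ 1≤r′ r′≤k π′ →
        others r′ 1≤r′ r′≤k λ { refl → i≢j′ (place-unique π′ π) }
      below-removes : suc j + suc j < k → suc j + (k ∸ suc j) ≡ k × suc j < k ∸ suc j → ∃[ j ] ∃[ z ] RemovesAt nu mu p j z
      below-removes lt (eq , j<i) = place (fold-left-removes {α} {α′} {abacus k i nu} {e} sα sα′ (strict-nu i 1≤i i≤k) drop)
        where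
        i = k ∸ suc j
        1≤i : 1 ≤ i
        1≤i = ≤-trans (s≤s z≤n) j<i
        i≤k : i ≤ k
        i≤k = m∸n≤m k (suc j)
        place : ∃[ z ] Removes (fold α (abacus k i nu)) (fold α′ (abacus k i nu)) z × diagZ z ≡ ℤ.- + suc e →
                ∃[ j ] ∃[ z ] RemovesAt nu mu p j z
        place (z , rem , dz) = j , z ,
            removesAt {nu} {mu} (folded i eq j<i)
              (subst (λ be → Removes (fold α (abacus k i nu)) (fold α′ be) z) (others i 1≤i i≤k (λ i≡ → <⇒≢ j<i (sym i≡))) rem)
              (unchanged (lower refl (<⇒≤ lt))) (below e (<⇒≤ lt) p≡ dz)
      self-removes : suc j + suc j ≡ k → ∃[ z ] Removes (fold α []) (fold α′ []) z × diagZ z ≡ ℤ.- + suc e →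
                     ∃[ j ] ∃[ z ] RemovesAt nu mu p j z
      self-removes eq (z , rem , dz) = j , z , removesAt {nu} {mu} (self eq) rem
              (unchanged (lower refl (≤-reflexive eq))) (below e (≤-reflexive eq) p≡ dz)
      above-removes : k < suc j + suc j → ∀ i → i + suc j ≡ k → ∃[ j ] ∃[ z ] RemovesAt nu mu p j z
      above-removes gt zero     eq = contradiction eq (<⇒≢ r<k)
      above-removes gt (suc j′) eq = place
        (fold-right-removes {abacus k (suc j′) nu} {α} {α′} {e} (strict-nu (suc j′) (s≤s z≤n) j′≤k) sα sα′ drop)
        where
        j′≤k : suc j′ ≤ k
        j′≤k = subst (suc j′ ≤_) eq (m≤m+n (suc j′) (suc j))
        j′<j : suc j′ < suc j
        j′<j = +-cancelʳ-< (suc j) _ _ (subst (_< suc j + suc j) (sym eq) gt)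
        place : ∃[ z ] Removes (fold (abacus k (suc j′) nu) α) (fold (abacus k (suc j′) nu) α′) z × diagZ z ≡ + suc e →
                ∃[ j ] ∃[ z ] RemovesAt nu mu p j z
        place (z , rem , dz) = j′ , z ,
            removesAt {nu} {mu} (folded (suc j) eq j′<j)
              (subst (λ al → Removes (fold (abacus k (suc j′) nu) α) (fold al α′) z)
                (others (suc j′) (s≤s z≤n) j′≤k (<⇒≢ j′<j)) rem)
              (unchanged (upper eq gt)) (above (suc j) (suc e) eq gt p≡ dz)
      cases : _ → ∃[ j ] ∃[ z ] RemovesAt nu mu p j z
      cases (tri< lt _ _) = below-removes lt (fold-kind lt)
      cases (tri≈ _ eq _) = self-removes eq (fold-left-removes {α} {α′} {[]} {e} sα sα′ strict-[] drop)
      cases (tri> _ _ gt) = above-removes gt (k ∸ suc j) (m∸n+n≡m (<⇒≤ r<k))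

    main-removes : ∀ {p r r′} → 1 ≤ r → r < r′ → r + r′ ≡ k → p ≡ r′ →
      Falls (abacus k r nu) (abacus k r mu) 0 → Falls (abacus k r′ nu) (abacus k r′ mu) 0 →
      (∀ i → 1 ≤ i → i ≤ k → i ≢ r → i ≢ r′ → abacus k i nu ≡ abacus k i mu) → ∃[ j ] ∃[ z ] RemovesAt nu mu p j z
    main-removes {p} {suc j} {r′} 1≤r r<r′ eq p≡ drop drop′ others = place
      (fold-main-removes {α} {α′} {β} {β′} (strict-nu (suc j) 1≤r r≤k) (strict-mu (suc j) 1≤r r≤k)
        (strict-nu r′ 1≤r′ r′≤k) (strict-mu r′ 1≤r′ r′≤k) drop drop′)
      where
      α = abacus k (suc j) nu
      α′ = abacus k (suc j) mu
      β = abacus k r′ nu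
      β′ = abacus k r′ mu
      1≤r′ : 1 ≤ r′
      1≤r′ = ≤-trans (s≤s z≤n) r<r′
      r≤k : suc j ≤ k
      r≤k = subst (suc j ≤_) eq (m≤m+n (suc j) r′)
      r′≤k : r′ ≤ k
      r′≤k = subst (r′ ≤_) eq (m≤n+m r′ (suc j))
      low : suc j + suc j ≤ k
      low = ≤-trans (+-monoʳ-≤ (suc j) (<⇒≤ r<r′)) (≤-reflexive eq)
      up : k < r′ + r′
      up = subst (_< r′ + r′) eq (+-monoˡ-< r′ r<r′)
      place : ∃[ z ] Removes (fold α β) (fold α′ β′) z × diagZ z ≡ + 0 → ∃[ j ] ∃[ z ] RemovesAt nu mu p j z
      place (z , rem , dz) = j , z , removesAt {nu} {mu} (folded r′ eq r<r′) rem
          (λ K i≢j → component-cong {nu = nu} {mu} K λ i 1≤i i≤k π → others i 1≤i i≤k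
            (λ { refl → i≢j (place-unique π (lower refl low)) }) (λ { refl → i≢j (place-unique π (upper eq up)) }))
          (above r′ 0 eq up (trans p≡ (sym (+-identityʳ r′))) dz)

    effect⇒removes : ∀ {p} → Effect nu mu p → ∃[ j ] ∃[ z ] RemovesAt nu mu p j z
    effect⇒removes (two r r′ 1≤r r<r′ eq p≡ drop drop′ others) = main-removes 1≤r r<r′ eq p≡ drop drop′ others
    effect⇒removes (one r e 1≤r r≤k p≡ e≥1⊎r≡k drop others) with r ≟ k
    effect⇒removes (one r e 1≤r r≤k p≡ e≥1⊎r≡k drop others)       | yes refl = whole-removes {e = e} p≡ drop others
    effect⇒removes (one r (suc e) 1≤r r≤k p≡ _ drop others)       | no r≢k   =
      fold-removes {e = e} 1≤r (≤∧≢⇒< r≤k r≢k) p≡ drop others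
    effect⇒removes (one r zero 1≤r r≤k p≡ (inj₂ r≡k) drop others) | no r≢k   = contradiction r≡k r≢k

    step⇒removes : ∀ {p} → Step k nu mu p → ∃[ j ] ∃[ z ] RemovesAt nu mu p j z
    step⇒removes st = effect⇒removes (effect (positive st) st-nu st-mu st)
      where
      positive : ∀ {p} → Step k nu mu p → 1 ≤ p
      positive (slide q refl _)           = ≤-trans 1≤k (m≤n+m k q)
      positive (annihilate q 1≤q q<p _ _) = ≤-trans 1≤q (<⇒≤ q<p)

  -- The cell gives back the head by `loc-head`, and the head gives back the smaller shape.
  removal-functional : ∀ {nu mu mu′ p p′ j z} → Strict mu → Strict mu′ → Step k nu mu p → Step k nu mu′ p′ →
    RemovesAt nu mu p j z → RemovesAt nu mu′ p′ j z → mu ≡ mu′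
  removal-functional sm sm′ st st′ r r′ with loc-head (RemovesAt.loc r) (RemovesAt.loc r′)
  ... | refl = step-functional sm sm′ st st′

  CornerQ : List ℕ → ℕ → ZCell → Set
  CornerQ la j (X , Y) = (X , Y) ∈Q[ la , j ] × ¬ (ℤ.suc X , Y) ∈Q[ la , j ] × ¬ (X , ℤ.suc Y) ∈Q[ la , j ]

  module _ {nu : List ℕ} (st : Strict nu) where

    private
      strict-nu : ∀ r → 1 ≤ r → r ≤ k → Strict (abacus k r nu)
      strict-nu r 1≤r r≤k = abacus-strict {r} 1≤r r≤k {nu} st

    record KindFacts {j} (K : Kind j) : Set where
      field
        ∈?     : ∀ z → Dec (z ∈C component K nu)
        exists : ∀ {z} → z ∈C component K nu → ∃[ w ] CornerZ (component K nu) w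
        unique : ∀ {z w} → CornerZ (component K nu) z → CornerZ (component K nu) w → diagZ z ≡ diagZ w → z ≡ w

    presented : ∀ {j} (K : Kind j) {s t Amb P} → Presents (component K nu) s t Amb P → KindFacts K
    presented K pr = record { ∈? = Presents.∈C? pr ; exists = cornerZ-exists pr ; unique = cornerZ-unique pr }

    first-residue : ∀ {j i} → suc j + i ≡ k → 1 ≤ suc j × suc j ≤ k
    first-residue {j} {i} eq = s≤s z≤n , subst (suc j ≤_) eq (m≤m+n (suc j) i)

    second-residue : ∀ {j i} → suc j + i ≡ k → suc j < i → 1 ≤ i × i ≤ k
    second-residue {j} {i} eq lt = ≤-trans (s≤s z≤n) lt , subst (i ≤_) eq (m≤n+m i (suc j))

    kind-facts : ∀ {j} (K : Kind j) → KindFacts K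
    kind-facts {j} K@(folded i eq lt) = presented K (fold-presents
      (strict-nu (suc j) (proj₁ (first-residue eq)) (proj₂ (first-residue eq)))
      (strict-nu i (proj₁ (second-residue eq lt)) (proj₂ (second-residue eq lt))) _ _ refl refl)
    kind-facts {j} K@(self eq)       = presented K (fold-presents
      (strict-nu (suc j) (proj₁ (first-residue eq)) (proj₂ (first-residue eq))) strict-[] _ _ refl refl)
    kind-facts K@(whole _ _)      = presented K (shift-presents (strict-nu k 1≤k ≤-refl))

    cornerQ⇒Z : ∀ {j z} (K : Kind j) → CornerQ nu j z → CornerZ (component K nu) z
    cornerQ⇒Z K (z∈ , ¬r , ¬u) = ∈component K z∈ , (λ r → ¬r (⇒InQ nu K r)) , (λ u → ¬u (⇒InQ nu K u))

    cornerZ⇒Q : ∀ {j z} (K : Kind j) → CornerZ (component K nu) z → CornerQ nu j z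
    cornerZ⇒Q K (z∈ , ¬r , ¬u) = ⇒InQ nu K z∈ , (λ r → ¬r (∈component K r)) , (λ u → ¬u (∈component K u))

    cornerQ-exists : ∀ {j z} → z ∈Q[ nu , j ] → ∃[ w ] CornerQ nu j w
    cornerQ-exists {j} {z} z∈ with InQ⇒ nu j z z∈
    ... | K , p with KindFacts.exists (kind-facts K) p
    ...   | w , c = w , cornerZ⇒Q K c

    cornerQ-unique : ∀ {j z w} → CornerQ nu j z → CornerQ nu j w → diagZ z ≡ diagZ w → z ≡ w
    cornerQ-unique {j} {z} c c′ with InQ⇒ nu j z (proj₁ c)
    ... | K , _ = KindFacts.unique (kind-facts K) (cornerQ⇒Z K c) (cornerQ⇒Z K c′)

    private
      at-residue : ∀ {r} → 1 ≤ r → r ≤ k → ∀ e → mult (abacus k r nu) (suc e) ≡ mult nu (r + e * k)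
      at-residue 1≤r r≤k = mult-abacus 1≤r r≤k (proj₂ st)

      next : ∀ r e → r + e * k + k ≡ r + suc e * k
      next r e = trans (+-assoc r (e * k) k) (cong (λ x → r + x) (+-comm (e * k) k))

      no-zero-part : mult nu 0 ≡ 0
      no-zero-part = mult-∉ {nu} λ 0∈ → contradiction (All.lookup (proj₂ st) 0∈) λ ()

      residue-slide : ∀ {r} → 1 ≤ r → r ≤ k → ∀ e → 1 ≤ mult (abacus k r nu) (suc (suc e)) →
        mult (abacus k r nu) (suc e) ≡ 0 → ∃[ mu ] Strict mu × Step k nu mu (r + suc e * k)
      residue-slide {r} 1≤r r≤k e b g = subst (λ p → ∃[ mu ] Strict mu × Step k nu mu p) (next r e)
        (slide-exists (r + e * k) st
          (subst (1 ≤_) (trans (at-residue 1≤r r≤k (suc e)) (cong (mult nu) (sym (next r e)))) b)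
          (trans (sym (at-residue 1≤r r≤k e)) g))

    -- In a combination, a corner off the main diagonal is a bead that can slide down one position,
    -- and a corner on it is a pair of parts j + 1 and k - (j + 1) that annihilate. On runner k the
    -- bead 1 slides to 0.
    corner⇒step : ∀ {j z} → CornerQ nu j z → ∃[ mu ] ∃[ p ] Strict mu × Step k nu mu p × Loc p j (diagZ z)
    corner⇒step {j} {z} c with InQ⇒ nu j z (proj₁ c)
    corner⇒step {j} {z} c | K@(folded i eq lt) , _
      with first-residue eq | second-residue eq lt
    ... | 1≤r , r≤k | 1≤i , i≤k with fold-corner (strict-nu (suc j) 1≤r r≤k) (strict-nu i 1≤i i≤k) (cornerQ⇒Z K c)
    ... | left e dz b g with residue-slide 1≤r r≤k e b g
    ...   | mu , sm , move = mu , _ , sm , move ,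
            below e (≤-trans (+-monoʳ-≤ (suc j) (<⇒≤ lt)) (≤-reflexive eq)) refl dz
    corner⇒step {j} {z} c | K@(folded i eq lt) , _ | 1≤r , r≤k | 1≤i , i≤k | right e dz b g with residue-slide 1≤i i≤k e b g
    ...   | mu , sm , move = mu , _ , sm , move , above i (suc e) eq (subst (_< i + i) eq (+-monoˡ-< i lt)) refl dz
    corner⇒step {j} {z} c | K@(folded i eq lt) , _ | 1≤r , r≤k | 1≤i , i≤k | main dz b b′
      with annihilate-exists (suc j) i st 1≤r lt eq
             (subst (1 ≤_) (trans (at-residue 1≤r r≤k 0) (cong (mult nu) (+-identityʳ (suc j)))) b)
             (subst (1 ≤_) (trans (at-residue 1≤i i≤k 0) (cong (mult nu) (+-identityʳ i))) b′)
    ...   | mu , sm , move = mu , _ , sm , move ,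
            above i 0 eq (subst (_< i + i) eq (+-monoˡ-< i lt)) (sym (+-identityʳ i)) dz
    corner⇒step {j} {z} c | K@(self eq) , _ with first-residue eq
    ... | 1≤r , r≤k with fold-corner (strict-nu (suc j) 1≤r r≤k) strict-[] (cornerQ⇒Z K c)
    ... | left e dz b g with residue-slide 1≤r r≤k e b g
    ...   | mu , sm , move = mu , _ , sm , move , below e (≤-reflexive eq) refl dz
    corner⇒step c | K@(whole le lt) , _ with shift-corner (strict-nu k 1≤k ≤-refl) (cornerQ⇒Z K c)
    ... | zero , dz , b , _ with slide-exists 0 st
            (subst (1 ≤_) (trans (at-residue 1≤k ≤-refl 0) (cong (mult nu) (+-identityʳ k))) b) no-zero-part
    ...   | mu , sm , move = mu , _ , sm , move , whole 0 le lt (sym (+-identityʳ k)) dz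
    corner⇒step c | K@(whole le lt) , _ | suc e , dz , b , g with residue-slide 1≤k ≤-refl e b (g e refl)
    ...   | mu , sm , move = mu , _ , sm , move , whole (suc e) le lt refl dz

    removesAt⇒corner : ∀ {mu p j z} → RemovesAt nu mu p j z → CornerQ nu j z
    removesAt⇒corner {z = X , Y} r = had , row (i<suc[i] X) , col (i<suc[i] Y)
      where open RemovesAt r

    -- The move found for the corner removes some corner. Component and diagonal of that one are
    -- both read off p, as are those of the given one, so the two corners coincide; no coordinates
    -- are computed.
    corner⇒removes : ∀ {j z} → CornerQ nu j z →
      ∃[ mu ] ∃[ p ] Strict mu × Step k nu mu p × RemovesAt nu mu p j z
    corner⇒removes c with corner⇒step c
    ... | mu , p , sm , move , l with step⇒removes st sm move
    ... | j′ , z′ , r with loc-component (RemovesAt.loc r) l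
    ... | refl with cornerQ-unique (removesAt⇒corner r) c (loc-diag (RemovesAt.loc r) l)
    ... | refl = mu , p , sm , move , r

    -- A nonempty component has a corner, and a corner yields a removable ribbon. With `empty⇒core`
    -- this identifies the k-cores as the shapes with empty quotient.
    core⇒empty : KCore k nu → ∀ {j z} → ¬ z ∈Q[ nu , j ]
    core⇒empty core {j} z∈ =
      let mu , _ , sm , move , _ = corner⇒removes {j} (proj₂ (cornerQ-exists {j} z∈))
      in core (mu , step⇒ribbon 1≤k st sm move)

    removable⇒removes : ∀ {mu} → RemovableKRibbon k nu mu → ∃[ p ] ∃[ j ] ∃[ z ] Step k nu mu p × RemovesAt nu mu p j z
    removable⇒removes (sm , mu⊆ , h , rib) with ribbon⇒step st sm mu⊆ rib
    ... | move with step⇒removes st sm move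
    ... | j , z , r = diag h , j , z , move , r

    empty⇒core : (∀ {j z} → ¬ z ∈Q[ nu , j ]) → KCore k nu
    empty⇒core empty (mu , rem) with removable⇒removes rem
    ... | _ , _ , _ , _ , r = empty (RemovesAt.had r)

    private
      kind? : ∀ j → Dec (Kind j)
      kind? j with <-cmp (suc j + suc j) k
      ... | tri< lt _ _ = yes (folded (k ∸ suc j) (proj₁ (fold-kind lt)) (proj₂ (fold-kind lt)))
      ... | tri≈ _ eq _ = yes (self eq)
      ... | tri> _ _ gt with j + j ≤? k
      ...   | yes le = yes (whole le gt)
      ...   | no ¬le = no λ { (folded i eq lt) → <⇒≱ gt (≤-trans (+-monoʳ-≤ (suc j) (<⇒≤ lt)) (≤-reflexive eq))
                            ; (self eq) → <⇒≱ gt (≤-reflexive eq)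
                            ; (whole le _) → ¬le le }

    ∈Q? : ∀ j z → Dec (z ∈Q[ nu , j ])
    ∈Q? j z with kind? j
    ... | no ¬K = no λ z∈ → ¬K (proj₁ (InQ⇒ nu j z z∈))
    ... | yes K = map′ (⇒InQ nu K) (∈component K) (KindFacts.∈? (kind-facts K) z)

-- Tableaux as chains of quotients

module Tableaux (k : ℕ) .{{_ : NonZero k}} where
  open Quotient k using (1≤k)
  open Moves k

  strict? : ∀ la → Dec (Strict la)
  strict? la = Linked.linked? _>?_ la ×-dec All.all? (0 <?_) la

  -- The value 0 for lists that are not strict is a dummy: `label` must be defined on all lists of
  -- shapes, but every shape of a tableau is strict.
  absent : List ℕ → ℕ → ZCell → ℕ
  absent la j z with strict? la
  ... | no _   = 0
  ... | yes st with ∈Q? st j z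
  ...   | yes _ = 0
  ...   | no _  = 1

  absent-∈ : ∀ {la j z} → z ∈Q[ la , j ] → absent la j z ≡ 0
  absent-∈ {la} {j} {z} z∈ with strict? la
  ... | no _   = refl
  ... | yes st with ∈Q? st j z
  ...   | yes _ = refl
  ...   | no z∉ = contradiction z∈ z∉

  absent-∉ : ∀ {la j z} → Strict la → ¬ z ∈Q[ la , j ] → absent la j z ≡ 1
  absent-∉ {la} {j} {z} st z∉ with strict? la
  ... | no ¬st  = contradiction st ¬st
  ... | yes st′ with ∈Q? st′ j z
  ...   | yes z∈ = contradiction z∈ z∉
  ...   | no _   = refl

  -- The cell of the quotient removed in passing from λ⁽ⁱ⁾ to λ⁽ⁱ⁻¹⁾ is absent
  -- from the quotients of exactly λ⁽⁰⁾, …, λ⁽ⁱ⁻¹⁾.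
  label : List (List ℕ) → Filling
  label []       j z = 0
  label (nu ∷ T) j z = absent nu j z + label T j z

  label-∷ʳ : ∀ T nu j z → label (T ∷ʳ nu) j z ≡ label T j z + absent nu j z
  label-∷ʳ []       nu j z = +-identityʳ _
  label-∷ʳ (mu ∷ T) nu j z = trans (cong (λ x → absent mu j z + x) (label-∷ʳ T nu j z)) (sym (+-assoc (absent mu j z) _ _))

  -- Tableaux grown at the end, so that induction strips the ribbon with the largest label; the
  -- index counts the ribbons.
  data Chain : List (List ℕ) → List ℕ → ℕ → Set where
    core   : ∀ {la} → Strict la → KCore k la → Chain (la ∷ []) la 0
    extend : ∀ {T mu nu n} → Chain T mu n → Strict nu → RemovableKRibbon k nu mu → Chain (T ∷ʳ nu) nu (suc n)

  tableau⇒chain : ∀ {la} T → StdRibbonTableau k la T → ∃[ n ] Chain T la n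
  tableau⇒chain (mu₀ ∷ rest) (st , co , valid) = grow rest (core st co) valid
    where
    grow : ∀ rest {T prev la n} → Chain T prev n → ValidChain k prev rest la → ∃[ m ] Chain (T ++ rest) la m
    grow []          {T} c refl = _ , subst (λ S → Chain S _ _) (sym (++-identityʳ T)) c
    grow (nu ∷ rest) {T} c (st , rem , valid) with grow rest (extend c st rem) valid
    ... | m , c′ = m , subst (λ S → Chain S _ m) (++-assoc T (nu ∷ []) rest) c′

  chain⇒tableau : ∀ {T la n} → Chain T la n → StdRibbonTableau k la T
  chain⇒tableau (core st co) = st , co , refl
  chain⇒tableau (extend {T} c st rem) = snoc T (chain⇒tableau c) st rem
    where
    grow : ∀ rest {prev mu nu} → ValidChain k prev rest mu → Strict nu → RemovableKRibbon k nu mu →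
           ValidChain k prev (rest ∷ʳ nu) nu
    grow []         refl              st rem = st , rem , refl
    grow (_ ∷ rest) (st′ , rem′ , v) st rem = st′ , rem′ , grow rest v st rem
    snoc : ∀ T {mu nu} → StdRibbonTableau k mu T → Strict nu → RemovableKRibbon k nu mu → StdRibbonTableau k nu (T ∷ʳ nu)
    snoc (_ ∷ rest) (st₀ , co , v) st rem = st₀ , co , grow rest v st rem

  -- The quotients are nested, so a cell outside the last one is missing from all n + 1 shapes. This
  -- is the label the cell acquires if the next shape contains it.
  label-outside : ∀ {T la n j z} → Chain T la n → ¬ z ∈Q[ la , j ] → label T j z ≡ suc n
  label-outside (core st _) z∉ = cong (λ x → x + 0) (absent-∉ st z∉)
  label-outside {j = j} {z} (extend {T} {mu} {nu} c st rem) z∉ with removable⇒removes st rem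
  ... | _ , _ , _ , _ , r = trans (label-∷ʳ T nu j z)
        (trans (cong₂ _+_ (label-outside c (λ z∈ → z∉ (RemovesAt.sub r z∈))) (absent-∉ st z∉)) (+-comm _ 1))

  label-inside : ∀ T {nu j z} → z ∈Q[ nu , j ] → label (T ∷ʳ nu) j z ≡ label T j z
  label-inside T {nu} {j} {z} z∈ =
    trans (label-∷ʳ T nu j z) (trans (cong (λ x → label T j z + x) (absent-∈ {nu} z∈)) (+-identityʳ _))

  record Standard (la : List ℕ) (F : Filling) (N : ℕ) : Set where
    field
      bounds : ∀ {j z} → z ∈Q[ la , j ] → 1 ≤ F j z × F j z ≤ N
      onto   : ∀ i → 1 ≤ i → i ≤ N → ∃[ j ] ∃[ z ] z ∈Q[ la , j ] × F j z ≡ i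
      inj    : ∀ {j z j′ z′} → z ∈Q[ la , j ] → z′ ∈Q[ la , j′ ] → F j z ≡ F j′ z′ → j ≡ j′ × z ≡ z′
      row    : ∀ {j X X′ Y} → (X , Y) ∈Q[ la , j ] → (X′ , Y) ∈Q[ la , j ] → X ℤ.< X′ → F j (X , Y) < F j (X′ , Y)
      col    : ∀ {j X Y Y′} → (X , Y) ∈Q[ la , j ] → (X , Y′) ∈Q[ la , j ] → Y ℤ.< Y′ → F j (X , Y) < F j (X , Y′)

  standard⇒ : ∀ {la F N} → Standard la F N → StdFilling (kQuotient k la) F
  standard⇒ {N = N} s = (N , (λ _ _ → bounds) , onto) , (λ _ _ _ _ → inj) , (λ _ _ _ _ → row) , (λ _ _ _ _ → col)
    where open Standard s

  ⇒standard : ∀ {la F} → StdFilling (kQuotient k la) F → ∃[ N ] Standard la F N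
  ⇒standard ((N , bounds , onto) , inj , row , col) = N , record
    { bounds = bounds _ _ ; onto = onto ; inj = inj _ _ _ _ ; row = row _ _ _ _ ; col = col _ _ _ _ }

  -- The new cell receives n + 1, above all old labels, and it ends its row and its column, so the
  -- filling stays increasing.
  module Extend {T mu nu n} (st : Strict nu) (c : Chain T mu n) (std : Standard mu (label T) n)
                {p j₀ z₀} (r : RemovesAt nu mu p j₀ z₀) where
    private
      module S = Standard std
      module R = RemovesAt r

    label-old : ∀ {j z} → z ∈Q[ mu , j ] → label (T ∷ʳ nu) j z ≡ label T j z
    label-old z∈ = label-inside T (R.sub z∈)

    label-old≤ : ∀ {j z} → z ∈Q[ mu , j ] → label (T ∷ʳ nu) j z ≤ n
    label-old≤ z∈ = subst (_≤ n) (sym (label-old z∈)) (proj₂ (S.bounds z∈))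

    label-new : label (T ∷ʳ nu) j₀ z₀ ≡ suc n
    label-new = trans (label-inside T R.had) (label-outside c R.lost)

    old<new : ∀ {j z} → z ∈Q[ mu , j ] → label (T ∷ʳ nu) j z < label (T ∷ʳ nu) j₀ z₀
    old<new z∈ = subst (label (T ∷ʳ nu) _ _ <_) (sym label-new) (s≤s (label-old≤ z∈))

    standard : Standard nu (label (T ∷ʳ nu)) (suc n)
    standard = record { bounds = bounds ; onto = onto ; inj = inj ; row = row ; col = col }
      where
      F = label (T ∷ʳ nu)
      bounds : ∀ {j z} → z ∈Q[ nu , j ] → 1 ≤ F j z × F j z ≤ suc n
      bounds z∈ with R.new z∈
      ... | inj₁ z∈mu         = subst (1 ≤_) (sym (label-old z∈mu)) (proj₁ (S.bounds z∈mu)) , m≤n⇒m≤1+n (label-old≤ z∈mu)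
      ... | inj₂ (refl , refl) = subst (1 ≤_) (sym label-new) (s≤s z≤n) , ≤-reflexive label-new
      onto : ∀ i → 1 ≤ i → i ≤ suc n → ∃[ j ] ∃[ z ] z ∈Q[ nu , j ] × F j z ≡ i
      onto i 1≤i i≤ with m≤n⇒m<n∨m≡n i≤
      ... | inj₂ refl = j₀ , z₀ , R.had , label-new
      ... | inj₁ i<   with S.onto i 1≤i (≤-pred i<)
      ...   | j , z , z∈ , eq = j , z , R.sub z∈ , trans (label-old z∈) eq
      inj : ∀ {j z j′ z′} → z ∈Q[ nu , j ] → z′ ∈Q[ nu , j′ ] → F j z ≡ F j′ z′ → j ≡ j′ × z ≡ z′
      inj z∈ z′∈ eq with R.new z∈ | R.new z′∈
      ... | inj₁ a             | inj₁ b             = S.inj a b (trans (sym (label-old a)) (trans eq (label-old b)))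
      ... | inj₁ a             | inj₂ (refl , refl) = contradiction eq (<⇒≢ (old<new a))
      ... | inj₂ (refl , refl) | inj₁ b             = contradiction (sym eq) (<⇒≢ (old<new b))
      ... | inj₂ (refl , refl) | inj₂ (refl , refl) = refl , refl
      row : ∀ {j X X′ Y} → (X , Y) ∈Q[ nu , j ] → (X′ , Y) ∈Q[ nu , j ] → X ℤ.< X′ → F j (X , Y) < F j (X′ , Y)
      row z∈ z′∈ lt with R.new z∈ | R.new z′∈
      ... | inj₁ a             | inj₁ b             = subst₂ _<_ (sym (label-old a)) (sym (label-old b)) (S.row a b lt)
      ... | inj₁ a             | inj₂ (refl , refl) = old<new a
      ... | inj₂ (refl , refl) | _                  = contradiction z′∈ (R.row lt)
      col : ∀ {j X Y Y′} → (X , Y) ∈Q[ nu , j ] → (X , Y′) ∈Q[ nu , j ] → Y ℤ.< Y′ → F j (X , Y) < F j (X , Y′)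
      col z∈ z′∈ lt with R.new z∈ | R.new z′∈
      ... | inj₁ a             | inj₁ b             = subst₂ _<_ (sym (label-old a)) (sym (label-old b)) (S.col a b lt)
      ... | inj₁ a             | inj₂ (refl , refl) = old<new a
      ... | inj₂ (refl , refl) | _                  = contradiction z′∈ (R.col lt)

  chain-standard : ∀ {T la n} → Chain T la n → Standard la (label T) n
  chain-standard (core st co) = record
    { bounds = λ z∈ → contradiction z∈ (core⇒empty st co)
    ; onto   = λ i 1≤i i≤0 → contradiction (≤-trans 1≤i i≤0) λ ()
    ; inj    = λ z∈ → contradiction z∈ (core⇒empty st co)
    ; row    = λ z∈ → contradiction z∈ (core⇒empty st co)
    ; col    = λ z∈ → contradiction z∈ (core⇒empty st co) }
  chain-standard (extend c st rem) with removable⇒removes st rem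
  ... | _ , _ , _ , _ , r = Extend.standard st c (chain-standard c) r

  -- The largest label marks the cell removed last, this cell determines the previous shape, and
  -- both chains can be cut there.
  chain-injective : ∀ {T T′ la n n′} → Chain T la n → Chain T′ la n′ →
    (∀ {j z} → z ∈Q[ la , j ] → label T j z ≡ label T′ j z) → T ≡ T′
  chain-injective (core _ _)  (core _ _)       same = refl
  chain-injective (core _ co) (extend _ _ rem) same = contradiction (_ , rem) co
  chain-injective (extend _ _ rem) (core _ co) same = contradiction (_ , rem) co
  chain-injective {la = la} (extend {T} {mu} {_} {n} c st rem) (extend {T′} {mu′} {_} {n′} c′ st′ rem′) same
    with removable⇒removes st rem | removable⇒removes st rem′
  ... | p , j , z , move , r | p′ , j′ , z′ , move′ , r′ = finish (Standard.inj std R.had R′.had top)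
    where
    module R = RemovesAt r
    module R′ = RemovesAt r′
    module E = Extend st c (chain-standard c) r
    module E′ = Extend st c′ (chain-standard c′) r′
    std = E.standard
    -- The numbers of ribbons are not assumed equal. One cell is largest for the first chain and the
    -- other for the second; since the labels agree on the quotient, both cells carry the same
    -- label.
    top : label (T ∷ʳ la) j z ≡ label (T ∷ʳ la) j′ z′
    top = ≤-antisym
      (subst₂ _≤_ (sym (same R.had)) (trans (sym E′.label-new) (sym (same R′.had))) (proj₂ (Standard.bounds E′.standard R.had)))
      (subst (label (T ∷ʳ la) j′ z′ ≤_) (sym E.label-new) (proj₂ (Standard.bounds E.standard R′.had)))
    finish : j ≡ j′ × z ≡ z′ → T ∷ʳ la ≡ T′ ∷ʳ la
    finish (refl , refl) with removal-functional (proj₁ rem) (proj₁ rem′) move move′ r r′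
    ... | refl = cong (_∷ʳ la) (chain-injective c c′
          (λ w∈ → trans (sym (E.label-old w∈)) (trans (same (R.sub w∈)) (E′.label-old w∈))))

  restrict : ∀ {nu mu F N p j z} → Standard nu F (suc N) → RemovesAt nu mu p j z → F j z ≡ suc N → Standard mu F N
  restrict {nu} {mu} {F} {N} s r Fz = record
    { bounds = λ w∈ → proj₁ (bounds (R.sub w∈)) , ≤-pred (≤∧≢⇒< (proj₂ (bounds (R.sub w∈)))
                 (λ Fw → R.lost (moved w∈ (inj (R.sub w∈) R.had (trans Fw (sym Fz))))))
    ; onto   = λ i 1≤i i≤N → keep i≤N (onto i 1≤i (m≤n⇒m≤1+n i≤N))
    ; inj    = λ a b → inj (R.sub a) (R.sub b)
    ; row    = λ a b → row (R.sub a) (R.sub b)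
    ; col    = λ a b → col (R.sub a) (R.sub b) }
    where
    open Standard s
    module R = RemovesAt r
    moved : ∀ {j w j′ w′} → w ∈Q[ mu , j ] → j ≡ j′ × w ≡ w′ → w′ ∈Q[ mu , j′ ]
    moved w∈ (refl , refl) = w∈
    keep : ∀ {i} → i ≤ N → ∃[ j ] ∃[ w ] w ∈Q[ nu , j ] × F j w ≡ i → ∃[ j ] ∃[ w ] w ∈Q[ mu , j ] × F j w ≡ i
    keep i≤N (j , w , w∈ , Fw) with R.new w∈
    ... | inj₁ w∈mu         = j , w , w∈mu , Fw
    ... | inj₂ (refl , refl) = contradiction (≤-trans (≤-reflexive (trans (sym Fz) Fw)) i≤N) (<-irrefl refl)

  chain-surjective : ∀ N {la F} → Strict la → Standard la F N →
    ∃[ T ] Chain T la N × (∀ {j z} → z ∈Q[ la , j ] → label T j z ≡ F j z)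
  chain-surjective zero    {la} st s = la ∷ [] , core st (empty⇒core st empty) , λ z∈ → contradiction z∈ empty
    where
    empty : ∀ {j z} → ¬ z ∈Q[ la , j ]
    empty z∈ = let 1≤F , F≤0 = Standard.bounds s z∈ in contradiction (≤-trans 1≤F F≤0) λ ()
  chain-surjective (suc N) {la} {F} st s with Standard.onto s (suc N) (s≤s z≤n) ≤-refl
  -- The largest entry sits on a corner: a neighbour to the right or above would exceed it.
  ... | j , (X , Y) , z∈ , Fz with corner⇒removes st {j} {X , Y} (z∈ ,
          (λ w∈ → <⇒≱ (subst (_< F j (ℤ.suc X , Y)) Fz (Standard.row s z∈ w∈ (i<suc[i] X))) (proj₂ (Standard.bounds s w∈))) ,
          (λ w∈ → <⇒≱ (subst (_< F j (X , ℤ.suc Y)) Fz (Standard.col s z∈ w∈ (i<suc[i] Y))) (proj₂ (Standard.bounds s w∈))))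
  ... | mu , p , sm , move , r with chain-surjective N sm (restrict s r Fz)
  ... | T , c , agree = T ∷ʳ la , extend c st (step⇒ribbon 1≤k st sm move) , agree′
    where
    module E = Extend st c (chain-standard c) r
    agree′ : ∀ {j z} → z ∈Q[ la , j ] → label (T ∷ʳ la) j z ≡ F j z
    agree′ w∈ with RemovesAt.new r w∈
    ... | inj₁ w∈mu         = trans (E.label-old w∈mu) (agree w∈mu)
    ... | inj₂ (refl , refl) = trans E.label-new (sym Fz)

  chain-length : ∀ {T la n} → Chain T la n → length T ≡ suc n
  chain-length (core _ _)             = refl
  chain-length (extend {T} {nu = nu} c _ _) = trans (length-++ T) (trans (+-comm (length T) 1) (cong suc (chain-length c)))

  chain-last : ∀ {T la n} → Chain T la n → ∃[ S ] T ≡ S ∷ʳ la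
  chain-last (core _ _)       = [] , refl
  chain-last (extend {T} _ _ _) = T , refl

  ribbonAt-< : ∀ {T i nu mu} → RibbonAt T i nu mu → i < length T
  ribbonAt-< here      = s≤s (s≤s z≤n)
  ribbonAt-< (there r) = s≤s (ribbonAt-< r)

  ribbonAt-∷ʳ : ∀ T {la i nu mu} → RibbonAt (T ∷ʳ la) i nu mu →
    RibbonAt T i nu mu ⊎ (i ≡ length T × nu ≡ la × ∃[ S ] T ≡ S ∷ʳ mu)
  ribbonAt-∷ʳ []          (there ())
  ribbonAt-∷ʳ (x ∷ [])    here        = inj₂ (refl , refl , [] , refl)
  ribbonAt-∷ʳ (x ∷ [])    (there (there ()))
  ribbonAt-∷ʳ (x ∷ y ∷ T) here        = inj₁ here
  ribbonAt-∷ʳ (x ∷ y ∷ T) (there r) with ribbonAt-∷ʳ (y ∷ T) r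
  ... | inj₁ r′                      = inj₁ (there r′)
  ... | inj₂ (refl , refl , S , eq) = inj₂ (refl , refl , x ∷ S , cong (x ∷_) eq)

  -- Ribbons added later bring only larger labels, so the cell with label i enters the quotient
  -- exactly in the step from mu to nu.
  chain-ribbon : ∀ {T la n i nu mu} → Chain T la n → RibbonAt T i nu mu →
    Strict nu × RemovableKRibbon k nu mu ×
    (∀ {j z} → z ∈Q[ la , j ] → label T j z ≡ i → z ∈Q[ nu , j ] × ¬ z ∈Q[ mu , j ])
  chain-ribbon (core _ _) (there ())
  chain-ribbon {i = i} {nu} {mu} (extend {T} {mu′} {la} {n} c st rem) ra with removable⇒removes st rem
  ... | _ , j₀ , z₀ , _ , r with ribbonAt-∷ʳ T ra
  ... | inj₁ ra′ with chain-ribbon c ra′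
  ...   | st′ , rem′ , removed = st′ , rem′ , removed′
    where
    module E = Extend st c (chain-standard c) r
    removed′ : ∀ {j z} → z ∈Q[ la , j ] → label (T ∷ʳ la) j z ≡ i → z ∈Q[ nu , j ] × ¬ z ∈Q[ mu , j ]
    removed′ z∈ eq with RemovesAt.new r z∈
    ... | inj₁ z∈mu         = removed z∈mu (trans (sym (E.label-old z∈mu)) eq)
    ... | inj₂ (refl , refl) = contradiction (trans (sym eq) E.label-new)
                                 (<⇒≢ (subst (i <_) (chain-length c) (ribbonAt-< ra′)))
  chain-ribbon (extend {T} {mu′} {la} {n} c st rem) ra | _ , j₀ , z₀ , _ , r | inj₂ (refl , refl , S , T≡)
    with chain-last c
  ... | S′ , T≡′ with proj₂ (∷ʳ-injective S′ S (trans (sym T≡′) T≡))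
  ... | refl = st , rem , removed′
    where
    module E = Extend st c (chain-standard c) r
    removed′ : ∀ {j z} → z ∈Q[ la , j ] → label (T ∷ʳ la) j z ≡ length T → z ∈Q[ la , j ] × ¬ z ∈Q[ mu′ , j ]
    removed′ z∈ eq with RemovesAt.new r z∈
    ... | inj₁ z∈mu         = contradiction
                                (≤-reflexive (sym (trans eq (chain-length c)))) (<⇒≱ (s≤s (E.label-old≤ z∈mu)))
    ... | inj₂ (refl , refl) = RemovesAt.had r , RemovesAt.lost r

  -- The cell with label i is the one removed by the move with head h, whichever description of the
  -- ribbon supplies h.
  head-loc : ∀ {T la n i h j z} → Chain T la n → RibbonHead k T i h → z ∈Q[ la , j ] → label T j z ≡ i →
             Loc (diag h) j (diagZ z)
  head-loc c (nu , mu , ra , head) z∈ eq with chain-ribbon c ra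
  ... | st , (sm , mu⊆ , _) , removed with step⇒removes st sm (ribbon⇒step st sm mu⊆ head)
  ... | j₀ , z₀ , r with removed z∈ eq
  ... | z∈nu , z∉mu with RemovesAt.new r z∈nu
  ... | inj₁ z∈mu          = contradiction z∈mu z∉mu
  ... | inj₂ (refl , refl) = RemovesAt.loc r

mainTheorem1 : (k : ℕ) → .{{_ : NonZero k}} → (la : List ℕ) → Strict la →
    Σ (List (List ℕ) → Filling) λ Φ →
    (∀ T → StdRibbonTableau k la T → StdFilling (kQuotient k la) (Φ T)) ×
    (∀ T T' → StdRibbonTableau k la T → StdRibbonTableau k la T' →
    Φ T ≈[ kQuotient k la ] Φ T' → T ≡ T') ×
    (∀ F → StdFilling (kQuotient k la) F →
    ∃[ T ] StdRibbonTableau k la T × Φ T ≈[ kQuotient k la ] F) ×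
    (∀ T → StdRibbonTableau k la T → ∀ i i' h h' →
    RibbonHead k T i h → RibbonHead k T i' h' → diag h ≡ diag h' →
    ∀ j z j' z' → InQ (kQuotient k la) j z → InQ (kQuotient k la) j' z' →
    Φ T j z ≡ i → Φ T j' z' ≡ i' → j ≡ j' × diagZ z ≡ diagZ z')
mainTheorem1 k la st = label , standard , injective , surjective , preserves-diag
  where
  open Moves k
  open Tableaux k
  standard : ∀ T → StdRibbonTableau k la T → StdFilling (kQuotient k la) (label T)
  standard T t = standard⇒ (chain-standard (proj₂ (tableau⇒chain T t)))
  injective : ∀ T T' → StdRibbonTableau k la T → StdRibbonTableau k la T' →
              label T ≈[ kQuotient k la ] label T' → T ≡ T'
  injective T T' t t' same =
    chain-injective (proj₂ (tableau⇒chain T t)) (proj₂ (tableau⇒chain T' t')) (λ {j} {z} → same j z)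
  surjective : ∀ F → StdFilling (kQuotient k la) F →
               ∃[ T ] StdRibbonTableau k la T × label T ≈[ kQuotient k la ] F
  surjective F std with ⇒standard std
  ... | N , s with chain-surjective N st s
  ... | T , c , agree = T , chain⇒tableau c , λ _ _ → agree
  preserves-diag : ∀ T → StdRibbonTableau k la T → ∀ i i' h h' →
    RibbonHead k T i h → RibbonHead k T i' h' → diag h ≡ diag h' →
    ∀ j z j' z' → InQ (kQuotient k la) j z → InQ (kQuotient k la) j' z' →
    label T j z ≡ i → label T j' z' ≡ i' → j ≡ j' × diagZ z ≡ diagZ z'
  -- Equal head diagonals place both cells by one and the same p, which fixes component and
  -- diagonal.
  preserves-diag T t i i' h h' head head' same-diag j z j' z' z∈ z'∈ eq eq'
    with head-loc (proj₂ (tableau⇒chain T t)) head z∈ eq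
       | subst (λ p → Loc p j' (diagZ z')) (sym same-diag) (head-loc (proj₂ (tableau⇒chain T t)) head' z'∈ eq')
  ... | l | l' with loc-component l l'
  ... | refl = refl , loc-diag l l'
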